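{- Given an SMTI-LC instance $I=(W,F,E,\{\mathcal{L}_a,q_a,P_a\}_{a\in W\cup F})$, one can find a stable matching $M$ of $I$ with $|M|\ge\frac{2}{3}|M_{\rm OPT}|$ in $O(k\cdot|E|^2)$ time, where $M_{\rm OPT}$ is a maximum-cardinality stable matching of $I$ and $k$ is the maximum level of nesting of the laminar families $\mathcal{L}_a$ $(a\in W\cup F)$.
   Context: Notation: $S+e:=S\cup\{e\}$, $S-e:=S\setminus\{e\}$; $\mathbf{Z}_+$ is the set of non-negative integers. A family of sets is laminar if any two members $L,L'$ satisfy $L\subseteq L'$, $L\supseteq L'$ or $L\cap L'=\emptyset$. The level of nesting of a laminar family $\mathcal{L}$ is the maximum length $k$ of a chain $L_1\subsetneq L_2\subsetneq\cdots\subsetneq L_k$ of members of $\mathcal{L}$; in the running-time bound, $k$ is read as at least $1$. SMTI-LC instance. A tuple $I=(W,F,E,\{\mathcal{L}_a,q_a,P_a\}_{a\in W\cup F})$, where $W$ (workers) and $F$ (firms) are disjoint finite sets, whose elements are called agents, and $E$ is a finite set of contracts. Each $e\in E$ is associated with one worker $\partial_W(e)\in W$ and one firm $\partial_F(e)\in F$; several contracts may be associated with the same pair. Put $E_w=\{e\in E\mid \partial_W(e)=w\}$ for $w\in W$ and $E_f=\{e\in E\mid\partial_F(e)=f\}$ for $f\in F$. Each agent $a$ has a laminar family $\mathcal{L}_a$ of subsets of $E_a$, a quota function $q_a:\mathcal{L}_a\to\mathbf{Z}_+$, and a preference list $P_a$ consisting of all elements of $E_a$ and possibly containing ties (i.e.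 a ranking of $E_a$ by a total preorder). Write $e\succ_a e'$ if $a$ strictly prefers $e$ to $e'$ according to $P_a$. Matchings and stability. For $M\subseteq E$ let $M_a:=M\cap E_a$. $M$ is feasible for $a$ if $|M_a\cap L|\le q_a(L)$ for all $L\in\mathcal{L}_a$. $M$ is a matching if it is feasible for all agents. For a matching $M$, a contract $e\in E\setminus M$ and $a\in\{\partial_W(e),\partial_F(e)\}$, $e$ is free for $a$ in $M$ if $M_a+e$ is feasible for $a$, or there is $e'\in M_a$ such that $e\succ_a e'$ and $M_a+e-e'$ is feasible for $a$. A contract $e\in E\setminus M$ blocks $M$ if it is free for both $\partial_W(e)$ and $\partial_F(e)$. A matching is stable if no contract of $E\setminus M$ blocks it. -}

module Defs where

open import Data.Bool using (if_then_else_; _∧_; not)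
open import Data.Fin using (Fin; toℕ)
import Data.Fin as Fin
open import Data.Fin.Properties using (_≟_)
open import Data.Fin.Subset using (Subset; _∈_; _∉_; _⊆_; _⊂_; _∩_; _∪_; ⁅_⁆; _-_; ∣_∣; Empty)
open import Data.Fin.Subset.Properties using (_∈?_)
open import Data.List using (List; []; _∷_; map; concat; concatMap; length; filter; allFin)
open import Data.List.Scans.Base using (scanl)
open import Data.Nat using (ℕ; zero; suc; _+_; _∸_; _≤_; _≡ᵇ_)
open import Data.Product using (∃-syntax; Σ-syntax; _×_; proj₁)
open import Data.Sum using (_⊎_; inj₁; inj₂; [_,_]′)
open import Data.Vec using (tabulate)
open import Function using (_on_)
open import Function.Definitions using (Injective)
open import Level using (0ℓ)
open import Relation.Binary using (Rel; Decidable; IsTotalPreorder)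
open import Relation.Binary.PropositionalEquality using (_≡_; _≢_)
open import Relation.Nullary using (¬_; does; ¬?; _×-dec_)

data Side : Set where
  workers firms : Side

record Instance : Set₁ where
  field
    #W #F #E : ℕ

  Contract : Set
  Contract = Fin #E

  Agent : Set
  Agent = Fin #W ⊎ Fin #F

  field
    ∂W : Contract → Fin #W
    ∂F : Contract → Fin #F

  E : Agent → Subset #E
  E = [ (λ w → tabulate λ e → does (∂W e ≟ w))
      , (λ f → tabulate λ e → does (∂F e ≟ f)) ]′

  -- The family of an agent a is {ℒ a i | i}; by injectivity it is a set, not
  -- a multiset.  The index only fixes the order in which it is listed in
  -- the input of an algorithm.
  field
    #ℒ          : Agent → ℕ
    ℒ           : ∀ a → Fin (#ℒ a) → Subset #E
    ℒ-injective : ∀ a → Injective _≡_ _≡_ (ℒ a)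
    ℒ⊆E         : ∀ a i → ℒ a i ⊆ E a
    laminar     : ∀ a i j → ℒ a i ⊆ ℒ a j ⊎ ℒ a j ⊆ ℒ a i ⊎ Empty (ℒ a i ∩ ℒ a j)
    quota       : ∀ a → Fin (#ℒ a) → ℕ

  -- e ≿[ a ] e′ : a likes e at least as much as e′.  The laws constrain the
  -- relation on E a only, and it is never used outside E a.
  field
    _≿[_]_ : Contract → Agent → Contract → Set
    ≿-isTotalPreorder : ∀ a → IsTotalPreorder {A = ∃[ e ] e ∈ E a}
                          (_≡_ on proj₁) ((λ e e′ → e ≿[ a ] e′) on proj₁)
    ≿-dec : ∀ a → Decidable (λ e e′ → e ≿[ a ] e′)

  ∂ : Side → Contract → Agent
  ∂ workers e = inj₁ (∂W e)
  ∂ firms   e = inj₂ (∂F e)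

  _≻[_]_ : Contract → Agent → Contract → Set
  e ≻[ a ] e′ = e ≿[ a ] e′ × ¬ e′ ≿[ a ] e

  ≻-dec : ∀ a → Decidable (λ e e′ → e ≻[ a ] e′)
  ≻-dec a e e′ = ≿-dec a e e′ ×-dec ¬? (≿-dec a e′ e)

module _ (I : Instance) where
  open Instance I

  Feasible : Agent → Subset #E → Set
  Feasible a M = ∀ i → ∣ (M ∩ E a) ∩ ℒ a i ∣ ≤ quota a i

  Matching : Subset #E → Set
  Matching M = ∀ a → Feasible a M

  Free : Subset #E → Contract → Agent → Set
  Free M e a =
      Feasible a ((M ∩ E a) ∪ ⁅ e ⁆)
    ⊎ ∃[ e′ ] (e′ ∈ M ∩ E a × e ≻[ a ] e′ × Feasible a (((M ∩ E a) ∪ ⁅ e ⁆) - e′))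

  Blocks : Contract → Subset #E → Set
  Blocks e M = e ∉ M × (∀ σ → Free M e (∂ σ e))

  Stable : Subset #E → Set
  Stable M = Matching M × (∀ e → ¬ Blocks e M)

  MaximumStable : Subset #E → Set
  MaximumStable M = Stable M × (∀ N → Stable N → ∣ N ∣ ≤ ∣ M ∣)

  Chain : Agent → ℕ → Set
  Chain a n = Σ[ c ∈ (Fin n → Fin (#ℒ a)) ] (∀ i j → i Fin.< j → ℒ a (c i) ⊂ ℒ a (c j))

  -- The second disjunct makes the maximum over no agents equal to 0.
  IsMaxNesting : ℕ → Set
  IsMaxNesting k = (∀ a n → Chain a n → n ≤ k) × ((∃[ a ] Chain a k) ⊎ k ≡ 0)

-- Structured programs for a unit-cost random-access machine
-- with addition and (truncated) subtraction.  The memory is divided into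
-- arrays numbered by literals in the program, so that a program uses
-- finitely many of them; array cells are addressed indirectly.

Store : Set
Store = ℕ → ℕ → ℕ

_[_,_↦_] : Store → ℕ → ℕ → ℕ → Store
(s [ x , i ↦ v ]) y j = if (x ≡ᵇ y) ∧ (i ≡ᵇ j) then v else s y j

infixl 6 _⊕_ _⊖_

data Exp : Set where
  lit     : ℕ → Exp
  _at_    : ℕ → Exp → Exp
  _⊕_ _⊖_ : Exp → Exp → Exp

eval : Exp → Store → ℕ
eval (lit n)  s = n
eval (x at i) s = s x (eval i s)
eval (p ⊕ q)  s = eval p s + eval q s
eval (p ⊖ q)  s = eval p s ∸ eval q s

cost : Exp → ℕ
cost (lit n)  = 1
cost (x at i) = 1 + cost i
cost (p ⊕ q)  = 1 + cost p + cost q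
cost (p ⊖ q)  = 1 + cost p + cost q

infixr 4 _⨾_

data Program : Set where
  skip     : Program
  _at_≔_   : ℕ → Exp → Exp → Program
  _⨾_      : Program → Program → Program
  If       : Exp → Program → Program → Program
  While    : Exp → Program → Program

-- ⟨ P , s ⟩⇓[ t ] s′ : started in s, P halts in s′ after t units of time.
-- A condition holds when its value is nonzero.
data ⟨_,_⟩⇓[_]_ : Program → Store → ℕ → Store → Set where
  skip : ∀ {s} → ⟨ skip , s ⟩⇓[ 1 ] s
  assign : ∀ {s x i e} →
    ⟨ x at i ≔ e , s ⟩⇓[ 1 + cost i + cost e ] (s [ x , eval i s ↦ eval e s ])
  seq : ∀ {s s′ s″ P Q t u} →
    ⟨ P , s ⟩⇓[ t ] s′ → ⟨ Q , s′ ⟩⇓[ u ] s″ → ⟨ P ⨾ Q , s ⟩⇓[ t + u ] s″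
  if-true : ∀ {s s′ b P Q t} → eval b s ≢ 0 →
    ⟨ P , s ⟩⇓[ t ] s′ → ⟨ If b P Q , s ⟩⇓[ 1 + cost b + t ] s′
  if-false : ∀ {s s′ b P Q t} → eval b s ≡ 0 →
    ⟨ Q , s ⟩⇓[ t ] s′ → ⟨ If b P Q , s ⟩⇓[ 1 + cost b + t ] s′
  while-true : ∀ {s s′ s″ b P t u} → eval b s ≢ 0 →
    ⟨ P , s ⟩⇓[ t ] s′ → ⟨ While b P , s′ ⟩⇓[ u ] s″ →
    ⟨ While b P , s ⟩⇓[ 1 + cost b + t + u ] s″
  while-false : ∀ {s b P} → eval b s ≡ 0 →
    ⟨ While b P , s ⟩⇓[ 1 + cost b ] s

-- Cells beyond the end of the list hold 0.
array : List ℕ → ℕ → ℕ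
array []       _       = 0
array (x ∷ xs) zero    = x
array (x ∷ xs) (suc i) = array xs i

-- A list of lists is stored as its concatenation together with the starting
-- positions of its entries, closed by the total length.
offsets : {A : Set} → List (List A) → List ℕ
offsets = scanl (λ n xs → n + length xs) 0

elements : ∀ {n} → Subset n → List (Fin n)
elements p = filter (_∈? p) (allFin _)

module _ (I : Instance) where
  open Instance I

  agents : Side → List Agent
  agents workers = map inj₁ (allFin #W)
  agents firms   = map inj₂ (allFin #F)

  index : Agent → ℕ
  index (inj₁ w) = toℕ w
  index (inj₂ f) = toℕ f

  -- The preference list of a is given by the position of each contract, equal
  -- for tied ones: the number of contracts of a strictly preferred to it.
  position : Agent → Contract → ℕ
  position a e = length (filter (λ e′ → ≻-dec a e′ e) (elements (E a)))

  family : Agent → List (List ℕ)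
  family a = map (λ i → map toℕ (elements (ℒ a i))) (allFin (#ℒ a))

  families : Side → List (List (List ℕ))
  families σ = map family (agents σ)

  endArray positionArray familyArray setArray memberArray quotaArray : Side → List ℕ
  endArray      σ = map (λ e → index (∂ σ e)) (allFin #E)
  positionArray σ = map (λ e → position (∂ σ e) e) (allFin #E)
  familyArray   σ = offsets (families σ)
  setArray      σ = offsets (concat (families σ))
  memberArray   σ = concat (concat (families σ))
  quotaArray    σ = concatMap (λ a → map (quota a) (allFin (#ℒ a))) (agents σ)

  encode : Store
  encode 0  = array (#E ∷ #W ∷ #F ∷ [])
  encode 1  = array (endArray workers)
  encode 2  = array (endArray firms)
  encode 3  = array (positionArray workers)
  encode 4  = array (positionArray firms)
  encode 5  = array (familyArray workers)
  encode 6  = array (familyArray firms)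
  encode 7  = array (setArray workers)
  encode 8  = array (setArray firms)
  encode 9  = array (memberArray workers)
  encode 10 = array (memberArray firms)
  encode 11 = array (quotaArray workers)
  encode 12 = array (quotaArray firms)
  encode _  = array []

  -- The output is the characteristic vector held in array 13.
  output : Store → Subset #E
  output s = tabulate λ e → not (s 13 (toℕ e) ≡ᵇ 0)

{-# OPTIONS --safe #-}

-- Each contract is replaced by three copies on which the agents have strict
-- preferences: a worker takes, within a tie, the copies 0 before the copies 1,
-- and puts all copies 2 last; a firm takes the copies 2 before the copies 1,
-- and puts all copies 0 last.  Deferred acceptance is run on the copies.  In
-- each round the first contract that some worker can add is proposed to its
-- firm; if a tight set contains it, the worst contract in the smallest such
-- set is rejected and moves on to its next copy.  At most 3 |E| rounds are
-- effective, each takes time linear in the total size of the families, and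
-- that size is at most k |E|, since the sets containing a contract on one side
-- form a chain.
--
-- In the end every copy of an unchosen contract is dominated: for one of its
-- agents it lies in a tight set all of whose chosen contracts are at least as
-- good.  For the copies 1 this says that the chosen set M is stable.  Given
-- another stable set N, laminarity yields for each side a partial matching
-- between M ∖ N and N ∖ M along which elements can be exchanged in M as well as
-- in N, and such that unmatched elements of N ∖ M can be added to M.  Domination
-- rules out an element of N ∖ M unmatched on both sides, as well as an element
-- of M ∖ N both of whose partners are unmatched on their other sides.  If each
-- element of N ∖ M gives 2 to its partners, those of M ∖ N then receive at most 3.
module Submission where

open import Defs
open import Data.Bool using (Bool; true; false; T; _∧_; _∨_; not; if_then_else_)
open import Data.Bool.Properties using (∨-zeroʳ) renaming (_≟_ to _≟ᵇ_)
open import Data.Empty using (⊥; ⊥-elim)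
open import Data.Fin using (Fin; zero; suc; toℕ; fromℕ<)
import Data.Fin as Fin
open import Data.Fin.Properties using (any?; all?; toℕ<n; toℕ-injective; toℕ-fromℕ<) renaming (_≟_ to _≟ᶠ_)
open import Data.Fin.Subset using (Subset; _∈_; _∉_; _⊂_; _∩_; _∪_; ⁅_⁆; _-_; _─_; ∣_∣; inside; outside)
open import Data.Fin.Subset.Properties using (_∈?_; x∈p∩q⁺; x∈p∩q⁻; x∈p∪q⁺; x∈p∪q⁻; x∈⁅x⁆; x∈⁅y⁆⇒x≡y; x∈p∧x≢y⇒x∈p-y; p─q⊆p)
open import Data.List using (List; []; _∷_; _++_; map; concat; length; take; filter; allFin; tabulate)
open import Data.List.Properties using (length-++; length-map; length-tabulate; length-filter)
import Data.List.Membership.Propositional as Mem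
open import Data.List.Membership.Propositional.Properties using (∈-filter⁺; ∈-filter⁻; ∈-allFin)
import Data.List.Relation.Unary.All as All
import Data.List.Relation.Unary.AllPairs as AllPairs
open import Data.List.Relation.Unary.Any using (here; there)
open import Data.List.Relation.Unary.Unique.Propositional using (Unique)
open import Data.List.Relation.Unary.Unique.Propositional.Properties using (filter⁺; allFin⁺)
open import Data.List.Scans.Base using (scanl)
open import Data.Nat using (ℕ; zero; suc; _+_; _*_; _∸_; _^_; _⊔_; _≤_; _<_; z≤n; s≤s; _≤?_; _<?_; _≡ᵇ_; >-nonZero)
open import Data.Nat.Properties
open import Algebra.Properties.CommutativeMonoid.Sum +-0-commutativeMonoid
  using (sum; ∑-distrib-+; ∑-comm; sum-cong-≗; sum-replicate-zero)
open import Data.Nat.Solver using (module +-*-Solver)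
open import Data.Product using (∃-syntax; Σ-syntax; _×_; _,_; proj₁; proj₂)
open import Data.Sum using (_⊎_; inj₁; inj₂)
open import Data.Unit using (tt)
open import Data.Vec using (lookup; []; _∷_)
open import Data.Vec.Properties using ([]=⇒lookup; lookup⇒[]=; lookup∘tabulate; tabulate∘lookup; tabulate-cong)
open import Function using (_∘_; case_of_)
open import Relation.Binary using (IsTotalPreorder)
open import Relation.Binary.PropositionalEquality
open import Relation.Nullary using (¬_; Dec; yes; no; does; contradiction; _×-dec_; _→-dec_)
open import Relation.Unary using () renaming (Decidable to Decidable₁)

-- Sets of different agents on one side are disjoint, so each side is treated as one laminar family
-- on all contracts; agents reappear only when stability is translated back. All claims about
-- quality are drawn from `Kernel`, which does not mention how the chosen set was found, so the loop
-- only has to preserve an invariant that ends in a kernel. On the worker side this invariant speaks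
-- of all feasible sets of preferred contracts rather than of the chosen set: in this form it
-- survives rejections, which free places at a worker. The time bound controls neither the number of
-- agents nor the number of empty sets; hence every loop of the program runs over contracts, over
-- entries (pairs of a set and a contract in it), or over the sets of an agent that has a contract.
-- The number of rounds is fixed in advance to 3 |E| + 1: an effective round adds one to a potential
-- that never exceeds 3 |E|, so at least one round finds nothing to propose.

sum-mono-≤ : ∀ {n} {f g : Fin n → ℕ} → (∀ i → f i ≤ g i) → sum f ≤ sum g
sum-mono-≤ {zero}  f≤g = z≤n
sum-mono-≤ {suc n} f≤g = +-mono-≤ (f≤g zero) (sum-mono-≤ (f≤g ∘ suc))

sum-zero : ∀ {n} {f : Fin n → ℕ} → (∀ i → f i ≡ 0) → sum f ≡ 0
sum-zero {n} f≡0 = trans (sum-cong-≗ f≡0) (sum-replicate-zero n)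

-- The two sums differ only in the term at `i`; adding the opposite term on each side keeps the
-- identity free of truncated subtraction.
sum-update : ∀ {n} (f g : Fin n → ℕ) i → (∀ j → j ≢ i → f j ≡ g j) →
  sum f + g i ≡ sum g + f i
sum-update {suc n} f g zero same =
  trans (cong (λ x → f zero + x + g zero) (sum-cong-≗ (λ j → same (suc j) λ ())))
    (solve 3 (λ a b c → a :+ b :+ c := c :+ b :+ a) refl (f zero) (sum (g ∘ suc)) (g zero))
  where open +-*-Solver
sum-update {suc n} f g (suc i) same = begin
  f zero + sum (f ∘ suc) + g (suc i)    ≡⟨ +-assoc (f zero) _ _ ⟩
  f zero + (sum (f ∘ suc) + g (suc i))  ≡⟨ cong₂ _+_ (same zero λ ())
    (sum-update (f ∘ suc) (g ∘ suc) i λ j j≢i → same (suc j) λ { refl → j≢i refl }) ⟩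
  g zero + (sum (g ∘ suc) + f (suc i))  ≡⟨ +-assoc (g zero) _ _ ⟨
  g zero + sum (g ∘ suc) + f (suc i)    ∎
  where open ≡-Reasoning

sum-single : ∀ {n} (f : Fin n → ℕ) i → (∀ j → j ≢ i → f j ≡ 0) → sum f ≡ f i
sum-single {n} f i others = begin
  sum f              ≡⟨ +-identityʳ _ ⟨
  sum f + 0          ≡⟨ sum-update f (λ _ → 0) i others ⟩
  sum (λ (_ : Fin n) → 0) + f i ≡⟨ cong (_+ f i) (sum-replicate-zero n) ⟩
  f i                ∎
  where open ≡-Reasoning

sum-term-≤ : ∀ {n} (f : Fin n → ℕ) i → f i ≤ sum f
sum-term-≤ f zero    = m≤m+n _ _
sum-term-≤ f (suc i) = ≤-trans (sum-term-≤ (f ∘ suc) i) (m≤n+m _ _)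

*-distribˡ-sum : ∀ {n} c (f : Fin n → ℕ) → c * sum f ≡ sum (λ i → c * f i)
*-distribˡ-sum {zero}  c f = *-zeroʳ c
*-distribˡ-sum {suc n} c f =
  trans (*-distribˡ-+ c (f zero) _) (cong (c * f zero +_) (*-distribˡ-sum c (f ∘ suc)))

sum≤*n : ∀ {n} (f : Fin n → ℕ) c → (∀ i → f i ≤ c) → sum f ≤ c * n
sum≤*n {zero}  f c f≤c = z≤n
sum≤*n {suc n} f c f≤c = ≤-trans (+-mono-≤ (f≤c zero) (sum≤*n (f ∘ suc) c (f≤c ∘ suc)))
  (≤-reflexive (sym (*-suc c n)))

-- Finite sets as Boolean functions

⟦_⟧ᵇ : Bool → ℕ
⟦ true ⟧ᵇ  = 1
⟦ false ⟧ᵇ = 0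

⟦⟧ᵇ≤1 : ∀ b → ⟦ b ⟧ᵇ ≤ 1
⟦⟧ᵇ≤1 true  = ≤-refl
⟦⟧ᵇ≤1 false = z≤n

ext-true : ∀ {a b} → (a ≡ true → b ≡ true) → (b ≡ true → a ≡ true) → a ≡ b
ext-true {true}  f g = sym (f refl)
ext-true {false} {true}  f g = g refl
ext-true {false} {false} f g = refl

not-true : ∀ {b} → b ≢ true → b ≡ false
not-true {true}  b≢ = contradiction refl b≢
not-true {false} b≢ = refl

∧-true : ∀ {a b} → a ∧ b ≡ true → a ≡ true × b ≡ true
∧-true {true} p = refl , p

opaque
  -- Opaque, so that goals keep a cardinality as an atom; the sum behind it is opened only where it
  -- is computed with.
  # : ∀ {n} → (Fin n → Bool) → ℕ
  # A = sum (⟦_⟧ᵇ ∘ A)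

  #-sum : ∀ {n} (A : Fin n → Bool) → # A ≡ sum (⟦_⟧ᵇ ∘ A)
  #-sum A = refl

  #-cong : ∀ {n} {A B : Fin n → Bool} → (∀ x → A x ≡ B x) → # A ≡ # B
  #-cong A≡B = sum-cong-≗ (cong ⟦_⟧ᵇ ∘ A≡B)

  #-update : ∀ {n} (A B : Fin n → Bool) x → (∀ y → y ≢ x → A y ≡ B y) →
    # A + ⟦ B x ⟧ᵇ ≡ # B + ⟦ A x ⟧ᵇ
  #-update A B x same = sum-update _ _ x λ y y≢x → cong ⟦_⟧ᵇ (same y y≢x)

does-refl : ∀ {n} (x : Fin n) → does (x ≟ᶠ x) ≡ true
does-refl x with x ≟ᶠ x
... | yes _  = refl
... | no x≢x = contradiction refl x≢x

_⊞_ : ∀ {n} → (Fin n → Bool) → Fin n → Fin n → Bool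
(A ⊞ e) x = A x ∨ does (x ≟ᶠ e)

⊞-here : ∀ {n} (A : Fin n → Bool) e → (A ⊞ e) e ≡ true
⊞-here A e rewrite does-refl e = ∨-zeroʳ (A e)

⊞-there : ∀ {n} (A : Fin n → Bool) e x → x ≢ e → (A ⊞ e) x ≡ A x
⊞-there A e x x≢e with A x | x ≟ᶠ e
... | _     | yes x≡e = contradiction x≡e x≢e
... | true  | no _    = refl
... | false | no _    = refl

_⊑_ : ∀ {n} → (Fin n → Bool) → (Fin n → Bool) → Set
A ⊑ B = ∀ {x} → A x ≡ true → B x ≡ true

opaque
  unfolding #

  #-mono : ∀ {n} {A B : Fin n → Bool} → A ⊑ B → # A ≤ # B
  #-mono {A = A} {B} A⊑B = sum-mono-≤ λ x → go (A x) (B x) A⊑B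
    where
    go : ∀ a b → (a ≡ true → b ≡ true) → ⟦ a ⟧ᵇ ≤ ⟦ b ⟧ᵇ
    go false b _ = z≤n
    go true  b h rewrite h refl = ≤-refl

  #-positive : ∀ {n} {A : Fin n → Bool} {x} → A x ≡ true → 1 ≤ # A
  #-positive {A = A} {x} a = ≤-trans (≤-reflexive (cong ⟦_⟧ᵇ (sym a))) (sum-term-≤ (⟦_⟧ᵇ ∘ A) x)

-- If some `x` of `B` were missing from `A`, adding it to `A` would give a larger set still inside
-- `B`.
#-⊑-antisym : ∀ {n} {A B : Fin n → Bool} → A ⊑ B → # B ≤ # A → B ⊑ A
#-⊑-antisym {n} {A} {B} A⊑B B≤A {x} b with A x in eq
... | true  = refl
... | false = contradiction B≤A (<⇒≱ (begin-strict
  # A                    <⟨ n<1+n _ ⟩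
  suc (# A)              ≡⟨ +-comm 1 _ ⟩
  # A + 1                ≡⟨ cong (λ t → # A + ⟦ t ⟧ᵇ) (⊞-here A x) ⟨
  # A + ⟦ (A ⊞ x) x ⟧ᵇ   ≡⟨ #-update A (A ⊞ x) x (λ y y≢x → sym (⊞-there A x y y≢x)) ⟩
  # (A ⊞ x) + ⟦ A x ⟧ᵇ   ≡⟨ cong (λ t → # (A ⊞ x) + ⟦ t ⟧ᵇ) eq ⟩
  # (A ⊞ x) + 0          ≡⟨ +-identityʳ _ ⟩
  # (A ⊞ x)              ≤⟨ #-mono A⊞x⊑B ⟩
  # B                    ∎))
  where
  open ≤-Reasoning
  A⊞x⊑B : (A ⊞ x) ⊑ B
  A⊞x⊑B {y} a with A y in eqy | y ≟ᶠ x
  ... | true  | _        = A⊑B eqy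
  ... | false | yes refl = b

opaque
  unfolding #

  #-split : ∀ {n} (A B : Fin n → Bool) →
    # A ≡ # (λ x → A x ∧ B x) + # (λ x → A x ∧ not (B x))
  #-split A B = trans (sum-cong-≗ λ x → go (A x) (B x))
    (∑-distrib-+ (λ x → ⟦ A x ∧ B x ⟧ᵇ) (λ x → ⟦ A x ∧ not (B x) ⟧ᵇ))
    where
    go : ∀ a b → ⟦ a ⟧ᵇ ≡ ⟦ a ∧ b ⟧ᵇ + ⟦ a ∧ not b ⟧ᵇ
    go true true = refl
    go true false = refl
    go false b = refl

module _ {n} {P : Fin n → Set} (P? : Decidable₁ P) where

  private
    -- Each restart moves to a strictly smaller value, and the value stays below `fuel`, so the
    -- search ends at a minimum.
    minimise : ∀ fuel (f : Fin n → ℕ) i → f i < fuel → P i → ∃[ j ] (P j × ∀ k → P k → f j ≤ f k)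
    minimise (suc fuel) f i fi<fuel pi with any? (λ k → P? k ×-dec (f k <? f i))
    ... | yes (k , pk , fk<fi) = minimise fuel f k (<-≤-trans fk<fi (≤-pred fi<fuel)) pk
    ... | no ∄ = i , pi , λ k pk → ≮⇒≥ λ fk<fi → ∄ (k , pk , fk<fi)

  argmin : (f : Fin n → ℕ) → ∃[ i ] P i → ∃[ j ] (P j × ∀ k → P k → f j ≤ f k)
  argmin f (i , pi) = minimise (suc (f i)) f i ≤-refl pi

  -- Subtracting from `sum f`, an upper bound of all values, reverses their order.
  argmax : (f : Fin n → ℕ) → ∃[ i ] P i → ∃[ j ] (P j × ∀ k → P k → f k ≤ f j)
  argmax f ∃P with argmin (λ i → sum f ∸ f i) ∃P
  ... | j , pj , min = j , pj , λ k pk →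
    ∸-cancelʳ-≤ (sum-term-≤ f k) (min k pk)

-- Laminar families

-- Indexed, with repetitions allowed: in the application a set occurs once for each contract in it.
record Family (n : ℕ) : Set where
  field
    size    : ℕ
    member  : Fin size → Fin n → Bool
    quota   : Fin size → ℕ
    laminar : ∀ p p′ → member p ⊑ member p′ ⊎ member p′ ⊑ member p
              ⊎ (∀ x → member p x ≡ true → member p′ x ≡ true → ⊥)

module Laminar {n} (ℱ : Family n) where
  open Family ℱ renaming (member to L; quota to q)

  on : (Fin n → Bool) → Fin size → ℕ
  on A p = # (λ x → A x ∧ L p x)

  Feas : (Fin n → Bool) → Set
  Feas A = ∀ p → on A p ≤ q p

  -- For feasible `A` and `e` outside `A` this says that `A` + `e` is feasible, or in matroid terms
  -- that `A` does not span `e`.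
  Open : (Fin n → Bool) → Fin n → Set
  Open A e = ∀ p → L p e ≡ true → on A p < q p

  Tight : (Fin n → Bool) → Fin n → Fin size → Set
  Tight A e p = L p e ≡ true × q p ≤ on A p

  Tight? : ∀ A e → Decidable₁ (Tight A e)
  Tight? A e p = (L p e ≟ᵇ true) ×-dec (q p ≤? on A p)

  open-or-tight : ∀ A e → Open A e ⊎ ∃[ p ] Tight A e p
  open-or-tight A e with any? (Tight? A e)
  ... | yes tight = inj₂ tight
  ... | no ∄ = inj₁ λ p e∈p → ≰⇒> λ q≤ → ∄ (p , e∈p , q≤)

  on-mono : ∀ {A B} p → (∀ {x} → L p x ≡ true → A x ≡ true → B x ≡ true) → on A p ≤ on B p
  on-mono {A} {B} p h = #-mono λ ab → let (a , l) = ∧-true ab in cong₂ _∧_ (h l a) l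

  on-update : ∀ {A B} e p → (∀ x → x ≢ e → A x ≡ B x) →
    on A p + ⟦ B e ∧ L p e ⟧ᵇ ≡ on B p + ⟦ A e ∧ L p e ⟧ᵇ
  on-update e p same = #-update _ _ e λ x x≢e → cong (_∧ L p x) (same x x≢e)

  on-insert : ∀ {A B} e p → A e ≡ false → B e ≡ true → (∀ x → x ≢ e → B x ≡ A x) →
    on B p ≡ on A p + ⟦ L p e ⟧ᵇ
  on-insert {A} {B} e p a b same with on-update {B} {A} e p same
  ... | eq rewrite a | b = trans (sym (+-identityʳ _)) eq

  Feas-insert : ∀ {A B} e → Feas A → Open A e → A e ≡ false → B e ≡ true →
    (∀ x → x ≢ e → B x ≡ A x) → Feas B
  Feas-insert {A} {B} e feas open-e a b same p
    rewrite on-insert e p a b same with L p e in eq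
  ... | true  = ≤-trans (≤-reflexive (+-comm _ 1)) (open-e p eq)
  ... | false = ≤-trans (≤-reflexive (+-identityʳ _)) (feas p)

  Feas-anti : ∀ {A B} → A ⊑ B → Feas B → Feas A
  Feas-anti sub feas p = ≤-trans (on-mono p λ _ → sub) (feas p)

  intersecting : ∀ {p p′ x} → L p x ≡ true → L p′ x ≡ true → L p ⊑ L p′ ⊎ L p′ ⊑ L p
  intersecting {p} {p′} {x} l l′ with laminar p p′
  ... | inj₁ sub        = inj₁ sub
  ... | inj₂ (inj₁ sub) = inj₂ sub
  ... | inj₂ (inj₂ dis) = ⊥-elim (dis x l l′)

  -- Intersecting members are comparable, and between comparable sets the size decides.
  -- Inclusion-minimal and inclusion-maximal sets can therefore be found by counting.
  ⊑-of-size : ∀ {p p′ x} → L p x ≡ true → L p′ x ≡ true → # (L p) ≤ # (L p′) → L p ⊑ L p′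
  ⊑-of-size l l′ le with intersecting l l′
  ... | inj₁ sub = sub
  ... | inj₂ sub = #-⊑-antisym sub le

  -- `B` is `A` + `e` - `m`, described pointwise because some of the sets concerned are read off a
  -- store.
  record Swap (A : Fin n → Bool) (e m : Fin n) (B : Fin n → Bool) : Set where
    field
      e≢m    : e ≢ m
      e∉A    : A e ≡ false
      m∈A    : A m ≡ true
      e∈B    : B e ≡ true
      m∉B    : B m ≡ false
      others : ∀ x → x ≢ e → x ≢ m → B x ≡ A x

  -- `A` + `e` and `B` + `m` are the same set `C`; its elements in `p` are counted both ways.
  on-swap : ∀ {A e m B} → Swap A e m B → ∀ p → on B p + ⟦ L p m ⟧ᵇ ≡ on A p + ⟦ L p e ⟧ᵇ
  on-swap {A} {e} {m} {B} sw p = trans (sym (on-insert m p m∉B c-m same₁)) (on-insert e p e∉A c-e same₂)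
    where
    open Swap sw
    C : Fin n → Bool
    C x = A x ∨ B x
    c-m : C m ≡ true
    c-m rewrite m∈A = refl
    c-e : C e ≡ true
    c-e rewrite e∉A = e∈B
    same₁ : ∀ x → x ≢ m → C x ≡ B x
    same₁ x x≢m with x ≟ᶠ e
    ... | yes refl = trans c-e (sym e∈B)
    ... | no x≢e rewrite others x x≢e x≢m with A x
    ...   | true  = refl
    ...   | false = refl
    same₂ : ∀ x → x ≢ e → C x ≡ A x
    same₂ x x≢e with x ≟ᶠ m
    ... | yes refl = trans c-m (sym m∈A)
    ... | no x≢m rewrite others x x≢e x≢m with A x
    ...   | true  = refl
    ...   | false = refl

  MinTight : (Fin n → Bool) → Fin n → Fin size → Set
  MinTight A e p = Tight A e p × ∀ p′ → Tight A e p′ → # (L p) ≤ # (L p′)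

  open-or-minTight : ∀ A e → Open A e ⊎ ∃[ p ] MinTight A e p
  open-or-minTight A e with open-or-tight A e
  ... | inj₁ o = inj₁ o
  ... | inj₂ t = inj₂ (argmin (Tight? A e) (# ∘ L) t)

  MinTight-⊑ : ∀ {A e p} → MinTight A e p → ∀ p′ → Tight A e p′ → L p ⊑ L p′
  MinTight-⊑ ((e∈p , _) , min) p′ t = ⊑-of-size e∈p (proj₁ t) (min p′ t)

  -- A tight set that gains `e` contains the minimal tight set `p`, as they share `e`, and hence
  -- loses `m`; a set that is not tight has room for one more.
  Feas-swap : ∀ {A e m B p} → Feas A → MinTight A e p → L p m ≡ true → Swap A e m B → Feas B
  Feas-swap {A} {e} {m} {B} {p} feas mt m∈p sw p′ with L p′ e in eq | q p′ ≤? on A p′ | on-swap sw p′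
  ... | true | yes q≤ | swp rewrite MinTight-⊑ mt p′ (eq , q≤) m∈p =
    ≤-trans (≤-reflexive (+-cancelʳ-≡ 1 _ _ swp)) (feas p′)
  ... | true | no q≰ | swp = begin
    on B p′               ≤⟨ m≤m+n _ _ ⟩
    on B p′ + ⟦ L p′ m ⟧ᵇ ≡⟨ swp ⟩
    on A p′ + 1           ≡⟨ +-comm _ 1 ⟩
    suc (on A p′)         ≤⟨ ≰⇒> q≰ ⟩
    q p′                  ∎
    where open ≤-Reasoning
  ... | false | _ | swp = begin
    on B p′               ≤⟨ m≤m+n _ _ ⟩
    on B p′ + ⟦ L p′ m ⟧ᵇ ≡⟨ swp ⟩
    on A p′ + 0           ≡⟨ +-identityʳ _ ⟩
    on A p′               ≤⟨ feas p′ ⟩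
    q p′                  ∎
    where open ≤-Reasoning

  -- Peel off an inclusion-maximal one of the given sets: the rest of the
  -- region is again covered by those of the sets that are disjoint from it.
  private
    Peelable : (A B D : Fin n → Bool) → Fin size → Set
    Peelable A B D p = (∀ x → L p x ≡ true → D x ≡ true) × on B p ≤ on A p × ∃[ x ] (L p x ≡ true)

    Peelable? : ∀ A B D → Decidable₁ (Peelable A B D)
    Peelable? A B D p = all? (λ x → (L p x ≟ᵇ true) →-dec (D x ≟ᵇ true))
      ×-dec (on B p ≤? on A p) ×-dec any? (λ x → L p x ≟ᵇ true)

    covered : ∀ fuel (A B D : Fin n → Bool) → # D < fuel →
      (∀ {x} → D x ≡ true → B x ≡ true →
        A x ≡ true ⊎ ∃[ p ] (L p x ≡ true × L p ⊑ D × on B p ≤ on A p)) →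
      # (λ x → B x ∧ D x) ≤ # (λ x → A x ∧ D x)
    covered (suc fuel) A B D D<fuel cov with any? (Peelable? A B D)
    ... | no ∄ = #-mono λ bd → let (b , d) = ∧-true bd in cong₂ _∧_ (inA b d) d
      where
      inA : ∀ {x} → B x ≡ true → D x ≡ true → A x ≡ true
      inA {x} b d with cov d b
      ... | inj₁ a = a
      ... | inj₂ (p , l , sub , le) = contradiction (p , (λ _ → sub) , le , x , l) ∄
    ... | yes ∃P with argmax (Peelable? A B D) (# ∘ L) ∃P
    ...   | p , (p⊑D , le , x , x∈p) , max = begin
      # (λ y → B y ∧ D y)       ≡⟨ #-split (λ y → B y ∧ D y) (L p) ⟩
      # (λ y → (B y ∧ D y) ∧ L p y) + # (λ y → (B y ∧ D y) ∧ not (L p y))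
        ≤⟨ +-mono-≤ (#-mono (inner B)) (#-mono (outer B)) ⟩
      on B p + # (λ y → B y ∧ D′ y)
        ≤⟨ +-mono-≤ le (covered fuel A B D′ D′<fuel cov′) ⟩
      on A p + # (λ y → A y ∧ D′ y)
        ≤⟨ +-mono-≤ (#-mono (inner⁻ A)) (#-mono (outer⁻ A)) ⟩
      # (λ y → (A y ∧ D y) ∧ L p y) + # (λ y → (A y ∧ D y) ∧ not (L p y))
        ≡⟨ #-split (λ y → A y ∧ D y) (L p) ⟨
      # (λ y → A y ∧ D y)       ∎
      where
      open ≤-Reasoning
      D′ : Fin n → Bool
      D′ y = D y ∧ not (L p y)
      inner : ∀ (X : Fin n → Bool) {y} → (X y ∧ D y) ∧ L p y ≡ true → X y ∧ L p y ≡ true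
      inner X {y} e with X y | D y
      ... | true | true = e
      outer : ∀ (X : Fin n → Bool) {y} → (X y ∧ D y) ∧ not (L p y) ≡ true → X y ∧ D′ y ≡ true
      outer X {y} e with X y | D y
      ... | true | true = e
      inner⁻ : ∀ (X : Fin n → Bool) {y} → X y ∧ L p y ≡ true → (X y ∧ D y) ∧ L p y ≡ true
      inner⁻ X {y} e with ∧-true {X y} e
      ... | x∈ , l rewrite p⊑D y l | x∈ = l
      outer⁻ : ∀ (X : Fin n → Bool) {y} → X y ∧ D′ y ≡ true → (X y ∧ D y) ∧ not (L p y) ≡ true
      outer⁻ X {y} e with X y | D y
      ... | true | true = e
      D′<fuel : # D′ < fuel
      D′<fuel = <-≤-trans (≰⇒> λ D≤D′ → case ∧-true {D x} (#-⊑-antisym {A = D′} (λ e → proj₁ (∧-true e)) D≤D′ (p⊑D x x∈p))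
        of λ { (_ , nl) → case trans (sym (cong not x∈p)) nl of λ () }) (≤-pred D<fuel)
      cov′ : ∀ {y} → D′ y ≡ true → B y ≡ true →
        A y ≡ true ⊎ ∃[ p′ ] (L p′ y ≡ true × L p′ ⊑ D′ × on B p′ ≤ on A p′)
      cov′ {y} d′ b with ∧-true {D y} d′
      ... | d , y∉p with cov d b
      ...   | inj₁ a = inj₁ a
      ...   | inj₂ (p′ , y∈p′ , p′⊑D , le′) = inj₂ (p′ , y∈p′ , p′⊑D′ , le′)
        where
        -- A common element would make `p` and `p′` comparable; as `p` has maximum size, `p′` would
        -- lie in `p`, and so would `y`.
        apart : ∀ z → L p z ≡ true → L p′ z ≡ true → ⊥
        apart z l l′ = case trans (sym y∉p) (cong not (⊑-of-size l′ l
          (max p′ ((λ _ → p′⊑D) , le′ , y , y∈p′)) y∈p′)) of λ ()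
        p′⊑D′ : L p′ ⊑ D′
        p′⊑D′ {z} l′ with L p z in eq
        ... | true  = ⊥-elim (apart z eq l′)
        ... | false rewrite p′⊑D l′ = refl

  -- Augmentation: were e blocked in B by a set p, the tight sets of A meeting
  -- p would lie inside p and show that A has as many elements in p as B.
  Open-transfer : ∀ {A B e} → Feas B → Open A e → A e ≡ false →
    (∀ {x} → B x ≡ true → A x ≡ true ⊎ ¬ Open A x) → Open B e
  Open-transfer {A} {B} {e} feasB open-e e∉A spanned p e∈p =
    ≤-<-trans (covered (suc (# (L p))) A B (L p) ≤-refl cov) (open-e p e∈p)
    where
    cov : ∀ {x} → L p x ≡ true → B x ≡ true →
      A x ≡ true ⊎ ∃[ p′ ] (L p′ x ≡ true × L p′ ⊑ L p × on B p′ ≤ on A p′)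
    cov {x} x∈p b with spanned b
    ... | inj₁ a = inj₁ a
    ... | inj₂ ¬open with open-or-tight A x
    ...   | inj₁ o = contradiction o ¬open
    ...   | inj₂ (p′ , x∈p′ , q≤) with intersecting x∈p x∈p′
    ...     | inj₂ sub = inj₂ (p′ , x∈p′ , sub , ≤-trans (feasB p′) q≤)
    ...     | inj₁ sub = contradiction (open-e p′ (sub e∈p)) (≤⇒≯ q≤)

  -- Pairing off two feasible sets along exchanges

  module _ (M N : Fin n → Bool) (feasM : Feas M) (feasN : Feas N) where

    -- The exchange fields make `M` + `u` - `m` and `N` + `m` - `u` feasible for each pair: a full
    -- set that gains one element also loses one. `π` has Boolean values so that partners can be
    -- counted by summation.
    record Pairing (A B : Fin n → Bool) : Set where
      field
        π        : Fin n → Fin n → Bool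
        π-domain : ∀ {m u} → π m u ≡ true → A m ≡ true × B u ≡ true
        π-unique : ∀ {m u u′} → π m u ≡ true → π m u′ ≡ true → u ≡ u′
        π-unique⁻ : ∀ {m m′ u} → π m u ≡ true → π m′ u ≡ true → m ≡ m′
        common   : ∀ {m u} → π m u ≡ true → ∃[ p ] (L p m ≡ true × L p u ≡ true)
        exchange : ∀ {m u} → π m u ≡ true → ∀ p → L p u ≡ true → q p ≤ on M p → L p m ≡ true
        exchange⁻ : ∀ {m u} → π m u ≡ true → ∀ p → L p m ≡ true → q p ≤ on N p → L p u ≡ true
        unpaired : ∀ {u} → B u ≡ true → (∀ m → π m u ≡ false) → Open M u

    private
      -- As long as p has an unpaired element of the one side, the pairs with
      -- just one element in p cannot have removed too many of the other.
      Balanced : (A B : Fin n → Bool) → Set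
      Balanced A B = ∀ p →
          (∀ {u} → B u ≡ true → L p u ≡ true → on M p + on B p ≤ on N p + on A p)
        × (∀ {m} → A m ≡ true → L p m ≡ true → on N p + on A p ≤ on M p + on B p)

      Meets : (A B : Fin n → Bool) → Fin size → Set
      Meets A B p = (∃[ m ] (A m ≡ true × L p m ≡ true)) × (∃[ u ] (B u ≡ true × L p u ≡ true))

      Meets? : ∀ A B → Decidable₁ (Meets A B)
      Meets? A B p = any? (λ m → (A m ≟ᵇ true) ×-dec (L p m ≟ᵇ true))
        ×-dec any? (λ u → (B u ≟ᵇ true) ×-dec (L p u ≟ᵇ true))

      on-empty : ∀ {A} p → (∀ x → A x ≡ true → L p x ≡ true → ⊥) → on A p ≡ 0
      on-empty {A} p none = trans (#-sum _) (sum-zero λ x → go x (A x) (L p x) refl refl)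
        where
        go : ∀ x a l → A x ≡ a → L p x ≡ l → ⟦ a ∧ l ⟧ᵇ ≡ 0
        go x true true a l = ⊥-elim (none x a l)
        go x true false _ _ = refl
        go x false _ _ _ = refl

      on-positive : ∀ {A x} p → A x ≡ true → L p x ≡ true → 1 ≤ on A p
      on-positive {A} {x} p a l = #-positive {x = x} (cong₂ _∧_ a l)

      _⊟_ : (Fin n → Bool) → Fin n → Fin n → Bool
      (A ⊟ e) x = A x ∧ not (does (x ≟ᶠ e))

      ⊟-here : ∀ A e → (A ⊟ e) e ≡ false
      ⊟-here A e with A e | e ≟ᶠ e
      ... | _     | no e≢e = contradiction refl e≢e
      ... | true  | yes _  = refl
      ... | false | yes _  = refl

      ⊟-there : ∀ A e x → x ≢ e → A x ≡ (A ⊟ e) x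
      ⊟-there A e x x≢e with A x | x ≟ᶠ e
      ... | _     | yes x≡e = contradiction x≡e x≢e
      ... | true  | no _    = refl
      ... | false | no _    = refl

      ⊟-⊑ : ∀ A e → (A ⊟ e) ⊑ A
      ⊟-⊑ A e {x} h = proj₁ (∧-true {A x} h)

      ⊟-≢ : ∀ A e {x} → (A ⊟ e) x ≡ true → x ≢ e
      ⊟-≢ A e h refl = case trans (sym h) (⊟-here A e) of λ ()

      on-⊟ : ∀ A e p → A e ≡ true → on A p ≡ on (A ⊟ e) p + ⟦ L p e ⟧ᵇ
      on-⊟ A e p a = on-insert e p (⊟-here A e) a (⊟-there A e)

      -- Taking the pair from a smallest set `p₀` that meets both sides makes it exchangeable: a set
      -- that contains just one of `m₀` and `u₀` has no remaining element of the opposite side.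
      module Pick (A B : Fin n → Bool) (bal : Balanced A B) (p₀ : Fin size)
        (min : ∀ p → Meets A B p → # (L p₀) ≤ # (L p))
        (m₀ u₀ : Fin n) (a₀ : A m₀ ≡ true) (m₀∈ : L p₀ m₀ ≡ true) (b₀ : B u₀ ≡ true) (u₀∈ : L p₀ u₀ ≡ true) where

        -- Otherwise `p` would meet both sides, be at least as large as `p₀` and, sharing `u₀` with
        -- it, contain `p₀` and thus `m₀`.
        no-A : ∀ p → L p u₀ ≡ true → L p m₀ ≡ false → ∀ x → A x ≡ true → L p x ≡ true → ⊥
        no-A p u∈ m∉ x a l =
          case trans (sym m∉) (⊑-of-size u₀∈ u∈ (min p ((x , a , l) , u₀ , b₀ , u∈)) m₀∈) of λ ()

        no-B : ∀ p → L p m₀ ≡ true → L p u₀ ≡ false → ∀ x → B x ≡ true → L p x ≡ true → ⊥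
        no-B p m∈ u∉ x b l =
          case trans (sym u∉) (⊑-of-size m₀∈ m∈ (min p ((m₀ , a₀ , m∈) , x , b , l)) u₀∈) of λ ()

        -- With no element of `A` left in `p`, the balance compares `M` together with at least `u₀`
        -- directly with `N`, which respects the quota.
        open-M : ∀ p → L p u₀ ≡ true → L p m₀ ≡ false → on M p < q p
        open-M p u∈ m∉ = begin-strict
          on M p            <⟨ m<m+n _ (on-positive p b₀ u∈) ⟩
          on M p + on B p   ≤⟨ proj₁ (bal p) b₀ u∈ ⟩
          on N p + on A p   ≡⟨ cong (on N p +_) (on-empty p (no-A p u∈ m∉)) ⟩
          on N p + 0        ≡⟨ +-identityʳ _ ⟩
          on N p            ≤⟨ feasN p ⟩
          q p               ∎
          where open ≤-Reasoning

        open-N : ∀ p → L p m₀ ≡ true → L p u₀ ≡ false → on N p < q p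
        open-N p m∈ u∉ = begin-strict
          on N p            <⟨ m<m+n _ (on-positive p a₀ m∈) ⟩
          on N p + on A p   ≤⟨ proj₂ (bal p) a₀ m∈ ⟩
          on M p + on B p   ≡⟨ cong (on M p +_) (on-empty p (no-B p m∈ u∉)) ⟩
          on M p + 0        ≡⟨ +-identityʳ _ ⟩
          on M p            ≤⟨ feasM p ⟩
          q p               ∎
          where open ≤-Reasoning

        cancel : ∀ w x y z → w + (x + 1) ≤ y + (z + 1) → w + x ≤ y + z
        cancel w x y z le = +-cancelʳ-≤ 1 (w + x) (y + z)
          (≤-trans (≤-reflexive (+-assoc w x 1)) (≤-trans le (≤-reflexive (sym (+-assoc y z 1)))))

        drop : ∀ w x y z → w + (x + 1) ≤ y + (z + 0) → w + x ≤ y + z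
        drop w x y z le = ≤-trans (+-monoʳ-≤ w (m≤m+n x 1)) (≤-trans le (≤-reflexive (cong (y +_) (+-identityʳ z))))

        keep : ∀ w x y z → w + (x + 0) ≤ y + (z + 0) → w + x ≤ y + z
        keep w x y z le rewrite +-identityʳ x | +-identityʳ z = le

        bal′ : Balanced (A ⊟ m₀) (B ⊟ u₀)
        bal′ p with L p m₀ in eqm | L p u₀ in equ | on-⊟ A m₀ p a₀ | on-⊟ B u₀ p b₀ | bal p
        ... | true | true | eA | eB | b₁ , b₂ rewrite eA | eB =
            (λ b l → cancel (on M p) _ (on N p) _ (b₁ (⊟-⊑ B u₀ b) l))
          , (λ a l → cancel (on N p) _ (on M p) _ (b₂ (⊟-⊑ A m₀ a) l))
        ... | false | false | eA | eB | b₁ , b₂ rewrite eA | eB =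
            (λ b l → keep (on M p) _ (on N p) _ (b₁ (⊟-⊑ B u₀ b) l))
          , (λ a l → keep (on N p) _ (on M p) _ (b₂ (⊟-⊑ A m₀ a) l))
        -- When only `u₀` lies in `p`, the first inequality loses one on its smaller side, and the
        -- second is void because `A` has no element in `p`.
        ... | false | true | eA | eB | b₁ , b₂ rewrite eA | eB =
            (λ b l → drop (on M p) _ (on N p) _ (b₁ (⊟-⊑ B u₀ b) l))
          , (λ a l → ⊥-elim (no-A p equ eqm _ (⊟-⊑ A m₀ a) l))
        ... | true | false | eA | eB | b₁ , b₂ rewrite eA | eB =
            (λ b l → ⊥-elim (no-B p eqm equ _ (⊟-⊑ B u₀ b) l))
          , (λ a l → drop (on N p) _ (on M p) _ (b₂ (⊟-⊑ A m₀ a) l))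

        extend : Pairing (A ⊟ m₀) (B ⊟ u₀) → Pairing A B
        extend R = record
          { π = π′ ; π-domain = dom ; π-unique = uniq ; π-unique⁻ = uniq⁻ ; common = com
          ; exchange = exch ; exchange⁻ = exch⁻ ; unpaired = unp }
          where
          open Pairing R
          π′ : Fin n → Fin n → Bool
          π′ m u = (does (m ≟ᶠ m₀) ∧ does (u ≟ᶠ u₀)) ∨ π m u
          new : π′ m₀ u₀ ≡ true
          new with m₀ ≟ᶠ m₀ | u₀ ≟ᶠ u₀
          ... | yes _ | yes _ = refl
          ... | no ≢  | _     = contradiction refl ≢
          ... | yes _ | no ≢  = contradiction refl ≢
          split : ∀ {m u} → π′ m u ≡ true → (m ≡ m₀ × u ≡ u₀) ⊎ π m u ≡ true
          split {m} {u} h with m ≟ᶠ m₀ | u ≟ᶠ u₀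
          ... | yes m≡ | yes u≡ = inj₁ (m≡ , u≡)
          ... | yes _  | no _   = inj₂ h
          ... | no _   | _      = inj₂ h
          dom : ∀ {m u} → π′ m u ≡ true → A m ≡ true × B u ≡ true
          dom h with split h
          ... | inj₁ (refl , refl) = a₀ , b₀
          ... | inj₂ old = ⊟-⊑ A m₀ (proj₁ (π-domain old)) , ⊟-⊑ B u₀ (proj₂ (π-domain old))
          uniq : ∀ {m u u′} → π′ m u ≡ true → π′ m u′ ≡ true → u ≡ u′
          uniq h h′ with split h | split h′
          ... | inj₁ (refl , refl) | inj₁ (_ , refl) = refl
          ... | inj₁ (refl , refl) | inj₂ old = contradiction refl (⊟-≢ A m₀ (proj₁ (π-domain old)))
          ... | inj₂ old | inj₁ (refl , refl) = contradiction refl (⊟-≢ A m₀ (proj₁ (π-domain old)))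
          ... | inj₂ old | inj₂ old′ = π-unique old old′
          uniq⁻ : ∀ {m m′ u} → π′ m u ≡ true → π′ m′ u ≡ true → m ≡ m′
          uniq⁻ h h′ with split h | split h′
          ... | inj₁ (refl , refl) | inj₁ (refl , _) = refl
          ... | inj₁ (refl , refl) | inj₂ old = contradiction refl (⊟-≢ B u₀ (proj₂ (π-domain old)))
          ... | inj₂ old | inj₁ (refl , refl) = contradiction refl (⊟-≢ B u₀ (proj₂ (π-domain old)))
          ... | inj₂ old | inj₂ old′ = π-unique⁻ old old′
          com : ∀ {m u} → π′ m u ≡ true → ∃[ p ] (L p m ≡ true × L p u ≡ true)
          com h with split h
          ... | inj₁ (refl , refl) = p₀ , m₀∈ , u₀∈
          ... | inj₂ old = common old
          exch : ∀ {m u} → π′ m u ≡ true → ∀ p → L p u ≡ true → q p ≤ on M p → L p m ≡ true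
          exch h p l q≤ with split h
          ... | inj₂ old = exchange old p l q≤
          ... | inj₁ (refl , refl) with L p m₀ in eq
          ...   | true  = refl
          ...   | false = contradiction (open-M p l eq) (≤⇒≯ q≤)
          exch⁻ : ∀ {m u} → π′ m u ≡ true → ∀ p → L p m ≡ true → q p ≤ on N p → L p u ≡ true
          exch⁻ h p l q≤ with split h
          ... | inj₂ old = exchange⁻ old p l q≤
          ... | inj₁ (refl , refl) with L p u₀ in eq
          ...   | true  = refl
          ...   | false = contradiction (open-N p l eq) (≤⇒≯ q≤)
          unp : ∀ {u} → B u ≡ true → (∀ m → π′ m u ≡ false) → Open M u
          unp {u} b none = unpaired (trans (sym (⊟-there B u₀ u u≢u₀)) b) λ m → old-none m
            where
            u≢u₀ : u ≢ u₀
            u≢u₀ refl = case trans (sym new) (none m₀) of λ ()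
            old-none : ∀ m → π m u ≡ false
            old-none m with π m u | does (m ≟ᶠ m₀) ∧ does (u ≟ᶠ u₀) | none m
            ... | false | _     | _ = refl
            ... | true  | true  | ()
            ... | true  | false | ()

      -- Once no set meets both sides, every set containing a remaining `u` is free of `A`, and the
      -- balance shows that it has room in `M`.
      pair-up : ∀ fuel A B → # A < fuel → Balanced A B → Pairing A B
      pair-up (suc fuel) A B A<fuel bal with any? (Meets? A B)
      ... | no ∄ = record
        { π = λ _ _ → false
        ; π-domain = λ () ; π-unique = λ () ; π-unique⁻ = λ () ; common = λ ()
        ; exchange = λ () ; exchange⁻ = λ ()
        ; unpaired = λ {u} b _ p l → begin-strict
            on M p            <⟨ m<m+n _ (on-positive p b l) ⟩
            on M p + on B p   ≤⟨ proj₁ (bal p) b l ⟩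
            on N p + on A p   ≡⟨ cong (on N p +_) (on-empty p λ x a l′ → ∄ (p , (x , a , l′) , u , b , l)) ⟩
            on N p + 0        ≡⟨ +-identityʳ _ ⟩
            on N p            ≤⟨ feasN p ⟩
            q p               ∎
        }
        where open ≤-Reasoning
      ... | yes ∃p with argmin (Meets? A B) (# ∘ L) ∃p
      ...   | p₀ , ((m₀ , a₀ , m₀∈) , u₀ , b₀ , u₀∈) , min =
        extend (pair-up fuel (A ⊟ m₀) (B ⊟ u₀) smaller bal′)
        where
        open Pick A B bal p₀ min m₀ u₀ a₀ m₀∈ b₀ u₀∈
        smaller : # (A ⊟ m₀) < fuel
        smaller = <-≤-trans (≰⇒> λ le → ⊟-≢ A m₀ (#-⊑-antisym (⊟-⊑ A m₀) le a₀) refl) (≤-pred A<fuel)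

    opaque
      -- Before any pair is removed, both sides of the balance count the union of `M` and `N` in
      -- `p`, so it holds with equality.
      pairing : Pairing (λ x → M x ∧ not (N x)) (λ x → N x ∧ not (M x))
      pairing = pair-up _ _ _ ≤-refl λ p →
        (λ _ _ → ≤-reflexive (balance p)) , (λ _ _ → ≤-reflexive (sym (balance p)))
        where
        open ≡-Reasoning
        regroup : ∀ (x y : Fin n → Bool) p → # (λ z → (x z ∧ L p z) ∧ not (y z)) ≡ on (λ z → x z ∧ not (y z)) p
        regroup x y p = #-cong λ z → go (x z) (L p z) (y z)
          where
          go : ∀ a b c → (a ∧ b) ∧ not c ≡ (a ∧ not c) ∧ b
          go true true true = refl
          go true true false = refl
          go true false true = refl
          go true false false = refl
          go false _ _ = refl
        meet : ∀ p → # (λ z → (M z ∧ L p z) ∧ N z) ≡ # (λ z → (N z ∧ L p z) ∧ M z)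
        meet p = #-cong λ z → go (M z) (L p z) (N z)
          where
          go : ∀ a b c → (a ∧ b) ∧ c ≡ (c ∧ b) ∧ a
          go true true true = refl
          go true true false = refl
          go true false true = refl
          go true false false = refl
          go false true true = refl
          go false true false = refl
          go false false true = refl
          go false false false = refl
        balance : ∀ p → on M p + on (λ x → N x ∧ not (M x)) p ≡ on N p + on (λ x → M x ∧ not (N x)) p
        balance p = begin
          on M p + on (λ x → N x ∧ not (M x)) p
            ≡⟨ cong₂ _+_ (#-split (λ z → M z ∧ L p z) N) (sym (regroup N M p)) ⟩
          # (λ z → (M z ∧ L p z) ∧ N z) + # (λ z → (M z ∧ L p z) ∧ not (N z)) + # (λ z → (N z ∧ L p z) ∧ not (M z))
            ≡⟨ solve 3 (λ a b c → a :+ b :+ c := a :+ c :+ b) refl (# (λ z → (M z ∧ L p z) ∧ N z)) _ _ ⟩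
          # (λ z → (M z ∧ L p z) ∧ N z) + # (λ z → (N z ∧ L p z) ∧ not (M z)) + # (λ z → (M z ∧ L p z) ∧ not (N z))
            ≡⟨ cong₂ (λ a b → a + # (λ z → (N z ∧ L p z) ∧ not (M z)) + b) (meet p) (regroup M N p) ⟩
          # (λ z → (N z ∧ L p z) ∧ M z) + # (λ z → (N z ∧ L p z) ∧ not (M z)) + on (λ x → M x ∧ not (N x)) p
            ≡⟨ cong (_+ on (λ x → M x ∧ not (N x)) p) (#-split (λ z → N z ∧ L p z) M) ⟨
          on N p + on (λ x → M x ∧ not (N x)) p ∎
          where open +-*-Solver

-- The approximation guarantee

other : Side → Side
other workers = firms
other firms   = workers

-- The copies 0, 1, 2 of a contract, in the order of its proposals: copies 0
-- and 1 compete within a tie of the worker and copies 2 and 1 within a tie of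
-- the firm; the copy 2 of the worker and 0 of the firm come after all others.
offset : ℕ → Side → ℕ → ℕ
offset n workers 0             = 0
offset n workers 1             = 1
offset n workers (suc (suc _)) = suc (n + n)
offset n firms   0             = suc (n + n)
offset n firms   1             = 1
offset n firms   (suc (suc _)) = 0

-- Doubled positions of different ties differ by at least two, which an offset of 1 cannot bridge.
double-cancel-≤ : ∀ a b {c} → a + a + c ≤ suc (b + b) → a ≤ b
double-cancel-≤ a b {c} le with a ≤? b
... | yes a≤b = a≤b
... | no a≰b  = contradiction le (<⇒≱ (begin-strict
  suc (b + b)   <⟨ n<1+n _ ⟩
  suc (suc (b + b)) ≡⟨ cong suc (+-suc b b) ⟨
  suc b + suc b ≤⟨ +-mono-≤ (≰⇒> a≰b) (≰⇒> a≰b) ⟩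
  a + a         ≤⟨ m≤m+n _ c ⟩
  a + a + c     ∎))
  where open ≤-Reasoning

record Market (n : ℕ) : Set where
  field
    ℱ     : Side → Family n
    pos   : Side → Fin n → ℕ
    pos≤n : ∀ σ e → pos σ e ≤ n

  -- Doubling the position leaves room for the offsets 0 and 1 within a tie, while the offset 2n + 1
  -- exceeds every doubled position, positions being at most `n`.
  key : Side → Fin n → ℕ → ℕ
  key σ e s = pos σ e + pos σ e + offset n σ s

  L = λ σ → Family.member (ℱ σ)
  q = λ σ → Family.quota (ℱ σ)
  module Fam σ = Laminar (ℱ σ)

  Dominated : Side → (Fin n → Bool) → (Fin n → ℕ) → Fin n → ℕ → Set
  Dominated σ M st e κ = ∃[ p ] (Fam.Tight σ M e p
    × ∀ {m} → M m ≡ true → L σ p m ≡ true → key σ m (st m) ≤ κ)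

  -- A kernel of the two laminar matroids on the copies.
  record Kernel (M : Fin n → Bool) (st : Fin n → ℕ) : Set where
    field
      feasible  : ∀ σ → Fam.Feas σ M
      dominated : ∀ {e} → M e ≡ false → ∀ s → s ≤ 2 → ∃[ σ ] Dominated σ M st e (key σ e s)

  Kernel-cong : ∀ {M M′ st} → (∀ e → M e ≡ M′ e) → Kernel M st → Kernel M′ st
  Kernel-cong {M} {M′} {st} M≡ kernel = record
    { feasible = λ σ p → subst (_≤ q σ p) (on-≡ σ p) (feasible σ p)
    ; dominated = λ {e} e∉M′ s s≤2 → let (σ , p , (e∈p , q≤) , best) = dominated (trans (M≡ e) e∉M′) s s≤2 in
        σ , p , (e∈p , subst (q σ p ≤_) (on-≡ σ p) q≤) , λ {m} m∈M′ → best (trans (M≡ m) m∈M′) }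
    where
    open Kernel kernel
    on-≡ : ∀ σ p → Fam.on σ M p ≡ Fam.on σ M′ p
    on-≡ σ p = #-cong λ x → cong (_∧ L σ p x) (M≡ x)

  -- For `m` outside a feasible `N`: `m` is free for its agent on this side, who can drop the
  -- strictly worse `u`, since each full set that gains `m` also contains `u`.
  Improves : (N : Fin n → Bool) → Fin n → Side → Set
  Improves N m σ = ∃[ u ] (N u ≡ true × (∃[ p ] (L σ p m ≡ true × L σ p u ≡ true))
    × pos σ m < pos σ u
    × ∀ p → L σ p m ≡ true → q σ p ≤ Fam.on σ N p → L σ p u ≡ true)

  module Approximation {M st} (kernel : Kernel M st) {N : Fin n → Bool}
    (feasN : ∀ σ → Fam.Feas σ N) (stableN : ∀ {m} → N m ≡ false → ¬ (∀ σ → Improves N m σ)) where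

    open Kernel kernel

    M∖N N∖M : Fin n → Bool
    M∖N x = M x ∧ not (N x)
    N∖M x = N x ∧ not (M x)

    ∧-not : ∀ {a b} → a ∧ not b ≡ true → a ≡ true × b ≡ false
    ∧-not {true} {false} _ = refl , refl

    module P σ = Laminar.Pairing (Laminar.pairing (ℱ σ) M N (feasible σ) (feasN σ))

    open P using (π)

    degree : Side → Fin n → ℕ
    degree σ u = sum λ m → ⟦ π σ m u ⟧ᵇ

    degree-cases : ∀ σ u → (∃[ m ] π σ m u ≡ true) × degree σ u ≡ 1
                         ⊎ (∀ m → π σ m u ≡ false) × degree σ u ≡ 0
    degree-cases σ u with any? (λ m → π σ m u ≟ᵇ true)
    ... | yes (m , h) = inj₁ ((m , h) , trans (sum-single _ m λ m′ m′≢m →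
            cong ⟦_⟧ᵇ (not-true λ h′ → m′≢m (P.π-unique⁻ σ h′ h))) (cong ⟦_⟧ᵇ h))
    ... | no ∄ = inj₂ (none , sum-zero (cong ⟦_⟧ᵇ ∘ none))
      where
      none = λ m → not-true λ h → ∄ (m , h)

    -- u gives 2 to its partners: 1 to each of two, or 2 to a single one.
    gift : Side → Fin n → ℕ
    gift σ u = 2 ∸ degree (other σ) u

    received : Side → Fin n → ℕ
    received σ m = sum λ u → ⟦ π σ m u ⟧ᵇ * gift σ u

    received-cases : ∀ σ m → (∃[ u ] (π σ m u ≡ true × received σ m ≡ gift σ u)) ⊎ received σ m ≡ 0
    received-cases σ m with any? (λ u → π σ m u ≟ᵇ true)
    ... | yes (u , h) = inj₁ (u , h , trans
            (sum-single _ u λ u′ u′≢u → cong (λ b → ⟦ b ⟧ᵇ * gift σ u′) (not-true λ h′ → u′≢u (P.π-unique σ h′ h)))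
            (trans (cong (λ b → ⟦ b ⟧ᵇ * gift σ u) h) (+-identityʳ _)))
    ... | no ∄ = inj₂ (sum-zero λ u → cong (λ b → ⟦ b ⟧ᵇ * gift σ u) (not-true λ h → ∄ (u , h)))

    -- An unpaired element can be added to `M`, so no tight set contains it.
    unpaired⇒¬dominated : ∀ σ {u κ} → N∖M u ≡ true → (∀ m → π σ m u ≡ false) → ¬ Dominated σ M st u κ
    unpaired⇒¬dominated σ u∈ none (p , (l , q≤) , _) = contradiction (P.unpaired σ u∈ none p l) (≤⇒≯ q≤)

    paired⇒key≤ : ∀ σ {m u κ} → π σ m u ≡ true → Dominated σ M st u κ → key σ m (st m) ≤ κ
    paired⇒key≤ σ h (p , (l , q≤) , best) =
      best (proj₁ (∧-not (proj₁ (P.π-domain σ h)))) (P.exchange σ h p l q≤)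

    some-partner : ∀ {u} → N∖M u ≡ true → ¬ (∀ σ → ∀ m → π σ m u ≡ false)
    some-partner u∈ none with dominated (proj₂ (∧-not u∈)) 1 (s≤s z≤n)
    ... | σ , dom = unpaired⇒¬dominated σ u∈ (none σ) dom

    -- Without a partner on the other side `u` can be added there, so no copy of it is dominated
    -- there. All its copies are dominated on `σ`, in tight sets that contain `m` by the exchange
    -- property.
    one-sided : ∀ σ {m u} → π σ m u ≡ true → degree (other σ) u ≡ 0 → ∀ s → s ≤ 2 →
      key σ m (st m) ≤ key σ u s
    one-sided σ {m} {u} h deg s s≤2 with P.π-domain σ h
    ... | _ , u∈ with dominated (proj₂ (∧-not u∈)) s s≤2
    ...   | τ , dom = go σ τ h (none (degree-cases (other σ) u)) dom
      where
      none : (∃[ m ] π (other σ) m u ≡ true) × degree (other σ) u ≡ 1 ⊎ (∀ m → π (other σ) m u ≡ false) × degree (other σ) u ≡ 0 →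
        ∀ m → π (other σ) m u ≡ false
      none (inj₁ (_ , deg≡1)) = case trans (sym deg) deg≡1 of λ ()
      none (inj₂ (none , _)) = none
      go : ∀ σ τ → π σ m u ≡ true → (∀ m → π (other σ) m u ≡ false) → Dominated τ M st u (key τ u s) →
        key σ m (st m) ≤ key σ u s
      go workers workers h none dom = paired⇒key≤ workers h dom
      go firms   firms h none dom = paired⇒key≤ firms h dom
      go workers firms h none dom = ⊥-elim (unpaired⇒¬dominated firms u∈ none dom)
      go firms   workers h none dom = ⊥-elim (unpaired⇒¬dominated workers u∈ none dom)

    -- m is at least as good for its worker as the copy 0 of u₁ and for its
    -- firm as the copy 2 of u₂, which are the first ones in their ties.  Only
    -- the copy 1 of m can be so, and not when tied with either.
    no-path : ∀ {m u₁ u₂} → π workers m u₁ ≡ true → π firms m u₂ ≡ true →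
      degree firms u₁ ≡ 0 → degree workers u₂ ≡ 0 → ⊥
    no-path {m} {u₁} {u₂} h₁ h₂ d₁ d₂ = stableN (proj₂ (∧-not (proj₁ (P.π-domain workers h₁)))) λ
      { workers → u₁ , N-of workers h₁ , P.common workers h₁ , proj₁ better , P.exchange⁻ workers h₁
      ; firms   → u₂ , N-of firms h₂ , P.common firms h₂ , proj₂ better , P.exchange⁻ firms h₂ }
      where
      N-of : ∀ σ {u} → π σ m u ≡ true → N u ≡ true
      N-of σ h = proj₁ (∧-not (proj₂ (P.π-domain σ h)))
      last-≰ : ∀ σ {u} → ¬ (pos σ m + pos σ m + suc (n + n) ≤ pos σ u + pos σ u + 0)
      last-≰ σ {u} le = <⇒≱ (begin-strict
        pos σ u + pos σ u + 0 ≡⟨ +-identityʳ _ ⟩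
        pos σ u + pos σ u     ≤⟨ +-mono-≤ (pos≤n σ u) (pos≤n σ u) ⟩
        n + n                 <⟨ n<1+n _ ⟩
        suc (n + n)           ≤⟨ m≤n+m _ _ ⟩
        pos σ m + pos σ m + suc (n + n) ∎) le
        where open ≤-Reasoning
      strictly : ∀ σ {u} → pos σ m + pos σ m + 1 ≤ pos σ u + pos σ u + 0 → pos σ m < pos σ u
      strictly σ {u} le = ≰⇒> λ u≤m → <⇒≱ (begin-strict
        pos σ u + pos σ u + 0 ≡⟨ +-identityʳ _ ⟩
        pos σ u + pos σ u     ≤⟨ +-mono-≤ u≤m u≤m ⟩
        pos σ m + pos σ m     <⟨ m<m+n _ (s≤s z≤n) ⟩
        pos σ m + pos σ m + 1 ∎) le
        where open ≤-Reasoning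
      better : pos workers m < pos workers u₁ × pos firms m < pos firms u₂
      better with st m | one-sided workers h₁ d₁ 0 z≤n | one-sided firms h₂ d₂ 2 ≤-refl
      ... | 0           | _   | le₂ = ⊥-elim (last-≰ firms le₂)
      ... | 1           | le₁ | le₂ = strictly workers le₁ , strictly firms le₂
      ... | suc (suc _) | le₁ | _   = ⊥-elim (last-≰ workers le₁)

    gift≤2 : ∀ σ u → gift σ u ≤ 2
    gift≤2 σ u = m∸n≤m 2 (degree (other σ) u)

    received≤2 : ∀ σ m → received σ m ≤ 2
    received≤2 σ m with received-cases σ m
    ... | inj₁ (u , _ , eq) = ≤-trans (≤-reflexive eq) (gift≤2 σ u)
    ... | inj₂ eq = ≤-trans (≤-reflexive eq) z≤n

    gift-cases : ∀ σ u → degree (other σ) u ≡ 0 ⊎ gift σ u ≤ 1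
    gift-cases σ u with degree-cases (other σ) u
    ... | inj₁ (_ , eq) = inj₂ (≤-reflexive (cong (2 ∸_) eq))
    ... | inj₂ (_ , eq) = inj₁ eq

    -- Each partner gives at most 2, and a total of 4 would require both partners to be unpaired on
    -- their other sides, which `no-path` excludes.
    received≤3 : ∀ m → received workers m + received firms m ≤ 3 * ⟦ M∖N m ⟧ᵇ
    received≤3 m with M∖N m in eq
    ... | false = ≤-reflexive (cong₂ _+_ (nothing workers) (nothing firms))
      where
      nothing : ∀ σ → received σ m ≡ 0
      nothing σ with received-cases σ m
      ... | inj₁ (_ , h , _) = case trans (sym eq) (proj₁ (P.π-domain σ h)) of λ ()
      ... | inj₂ r = r
    ... | true with received-cases workers m | received-cases firms m
    ...   | inj₂ r | _ rewrite r = m≤n⇒m≤1+n (received≤2 firms m)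
    ...   | inj₁ _ | inj₂ r rewrite r = ≤-trans (≤-reflexive (+-identityʳ _)) (m≤n⇒m≤1+n (received≤2 workers m))
    ...   | inj₁ (u₁ , h₁ , r₁) | inj₁ (u₂ , h₂ , r₂) rewrite r₁ | r₂ with gift-cases workers u₁ | gift-cases firms u₂
    ...     | inj₂ g | _ = +-mono-≤ g (gift≤2 firms u₂)
    ...     | inj₁ _ | inj₂ g = +-mono-≤ (gift≤2 workers u₁) g
    ...     | inj₁ d₁ | inj₁ d₂ = ⊥-elim (no-path h₁ h₂ d₁ d₂)

    given : ∀ u → 2 * ⟦ N∖M u ⟧ᵇ ≤ degree workers u * gift workers u + degree firms u * gift firms u
    given u with N∖M u in eq
    ... | false = z≤n
    ... | true with degree-cases workers u | degree-cases firms u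
    ...   | inj₁ (_ , w) | inj₁ (_ , f) rewrite w | f = ≤-refl
    ...   | inj₁ (_ , w) | inj₂ (_ , f) rewrite w | f = ≤-refl
    ...   | inj₂ (_ , w) | inj₁ (_ , f) rewrite w | f = ≤-refl
    ...   | inj₂ (w , _) | inj₂ (f , _) = ⊥-elim (some-partner eq λ { workers → w ; firms → f })

    -- Double counting of the pairs, each weighted by the gift that passes along it.
    exchange-sums : ∀ σ → sum (λ u → degree σ u * gift σ u) ≡ sum (received σ)
    exchange-sums σ = begin
      sum (λ u → degree σ u * gift σ u)
        ≡⟨ sum-cong-≗ (λ u → trans (*-comm (degree σ u) (gift σ u)) (trans (*-distribˡ-sum (gift σ u) (λ m → ⟦ π σ m u ⟧ᵇ))
             (sum-cong-≗ λ m → *-comm (gift σ u) ⟦ π σ m u ⟧ᵇ))) ⟩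
      sum (λ u → sum λ m → ⟦ π σ m u ⟧ᵇ * gift σ u)
        ≡⟨ ∑-comm (λ u m → ⟦ π σ m u ⟧ᵇ * gift σ u) ⟩
      sum (received σ) ∎
      where open ≡-Reasoning

    2∣N∖M∣≤3∣M∖N∣ : 2 * # N∖M ≤ 3 * # M∖N
    2∣N∖M∣≤3∣M∖N∣ = begin
      2 * # N∖M                          ≡⟨ cong (2 *_) (#-sum N∖M) ⟩
      2 * sum (⟦_⟧ᵇ ∘ N∖M)               ≡⟨ *-distribˡ-sum 2 (⟦_⟧ᵇ ∘ N∖M) ⟩
      sum (λ u → 2 * ⟦ N∖M u ⟧ᵇ)         ≤⟨ sum-mono-≤ given ⟩
      sum (λ u → degree workers u * gift workers u + degree firms u * gift firms u)
        ≡⟨ ∑-distrib-+ (λ u → degree workers u * gift workers u) (λ u → degree firms u * gift firms u) ⟩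
      sum (λ u → degree workers u * gift workers u) + sum (λ u → degree firms u * gift firms u)
        ≡⟨ cong₂ _+_ (exchange-sums workers) (exchange-sums firms) ⟩
      sum (received workers) + sum (received firms)
        ≡⟨ ∑-distrib-+ (received workers) (received firms) ⟨
      sum (λ m → received workers m + received firms m) ≤⟨ sum-mono-≤ received≤3 ⟩
      sum (λ m → 3 * ⟦ M∖N m ⟧ᵇ)         ≡⟨ *-distribˡ-sum 3 (⟦_⟧ᵇ ∘ M∖N) ⟨
      3 * sum (⟦_⟧ᵇ ∘ M∖N)               ≡⟨ cong (3 *_) (#-sum M∖N) ⟨
      3 * # M∖N                          ∎
      where open ≤-Reasoning

    2∣N∣≤3∣M∣ : 2 * # N ≤ 3 * # M
    2∣N∣≤3∣M∣ = begin
      2 * # N                              ≡⟨ cong (2 *_) (#-split N M) ⟩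
      2 * (# (λ x → N x ∧ M x) + # N∖M)    ≡⟨ *-distribˡ-+ 2 (# (λ x → N x ∧ M x)) _ ⟩
      2 * # (λ x → N x ∧ M x) + 2 * # N∖M
        -- The common elements count 2 on the left and may count 3 on the right.
        ≤⟨ +-mono-≤ (*-monoˡ-≤ (# (λ x → N x ∧ M x)) {2} {3} (s≤s (s≤s z≤n))) 2∣N∖M∣≤3∣M∖N∣ ⟩
      3 * # (λ x → N x ∧ M x) + 3 * # M∖N  ≡⟨ *-distribˡ-+ 3 (# (λ x → N x ∧ M x)) _ ⟨
      3 * (# (λ x → N x ∧ M x) + # M∖N)    ≤⟨ *-monoʳ-≤ 3 (+-monoˡ-≤ _ (#-mono λ {x} → swap (N x) (M x))) ⟩
      3 * (# (λ x → M x ∧ N x) + # M∖N)    ≡⟨ cong (3 *_) (#-split M N) ⟨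
      3 * # M                              ∎
      where
      open ≤-Reasoning
      swap : ∀ a b → a ∧ b ≡ true → b ∧ a ≡ true
      swap true true _ = refl

  -- Deferred acceptance

  -- Along its proposals a contract becomes worse for its worker and better for its firm within the
  -- fixed position. Domination of one copy thus carries over to later copies at the worker and to
  -- earlier ones at the firm.
  offset-workers-mono : ∀ {s s′} → s ≤ s′ → offset n workers s ≤ offset n workers s′
  offset-workers-mono {0} _ = z≤n
  offset-workers-mono {1} {1} _ = ≤-refl
  offset-workers-mono {1} {suc (suc _)} _ = s≤s z≤n
  offset-workers-mono {suc (suc _)} {suc (suc _)} _ = ≤-refl
  offset-workers-mono {suc (suc _)} {1} (s≤s ())

  offset-firms-anti : ∀ {s s′} → s ≤ s′ → offset n firms s′ ≤ offset n firms s
  offset-firms-anti {0} {0} _ = ≤-refl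
  offset-firms-anti {0} {1} _ = s≤s z≤n
  offset-firms-anti {_} {suc (suc _)} _ = z≤n
  offset-firms-anti {1} {1} _ = ≤-refl
  offset-firms-anti {suc (suc _)} {1} (s≤s ())

  -- Breaks the remaining ties by the index of the contract.
  priority : (Fin n → ℕ) → Fin n → ℕ
  priority st e = key workers e (st e) * n + toℕ e

  lexicographic-< : ∀ {a b} (i j : Fin n) → a < b → a * n + toℕ i < b * n + toℕ j
  lexicographic-< {a} {b} i j a<b = begin-strict
    a * n + toℕ i  <⟨ +-monoʳ-< (a * n) (toℕ<n i) ⟩
    a * n + n      ≡⟨ +-comm (a * n) n ⟩
    suc a * n      ≤⟨ *-monoˡ-≤ n a<b ⟩
    b * n          ≤⟨ m≤m+n _ _ ⟩
    b * n + toℕ j  ∎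
    where open ≤-Reasoning

  priority-≤⇒key-≤ : ∀ {st e e′} → priority st e ≤ priority st e′ →
    key workers e (st e) ≤ key workers e′ (st e′)
  priority-≤⇒key-≤ {st} {e} {e′} le = ≮⇒≥ λ lt → <⇒≱ (lexicographic-< e′ e lt) le

  priority-injective : ∀ st {e e′} → priority st e ≡ priority st e′ → e ≡ e′
  priority-injective st {e} {e′} eq = toℕ-injective (+-cancelˡ-≡ (key workers e (st e) * n) _ _
    (trans eq (cong (λ k → k * n + toℕ e′) (sym key-≡))))
    where
    key-≡ : key workers e (st e) ≡ key workers e′ (st e′)
    key-≡ = ≤-antisym (priority-≤⇒key-≤ {st} (≤-reflexive eq)) (priority-≤⇒key-≤ {st} (≤-reflexive (sym eq)))

  priority-mono : ∀ {st st′ : Fin n → ℕ} e → st e ≤ st′ e → priority st e ≤ priority st′ e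
  priority-mono e le = +-monoˡ-≤ (toℕ e) (*-monoˡ-≤ n (+-monoʳ-≤ (pos workers e + pos workers e) (offset-workers-mono le)))

  Candidate : (Fin n → Bool) → (Fin n → ℕ) → Fin n → Set
  Candidate M st e = M e ≡ false × st e ≤ 2 × Fam.Open workers M e

  -- Stage 3 means that all copies are rejected, so a chosen contract has stage at most 2.
  -- `proposed` ranges over arbitrary feasible `Y`: as stages grow, fewer `Y` qualify, so the clause
  -- persists while `m` stays chosen.
  record Invariant (M : Fin n → Bool) (st : Fin n → ℕ) : Set where
    field
      feasible : ∀ σ → Fam.Feas σ M
      bounded  : ∀ e → st e + ⟦ M e ⟧ᵇ ≤ 3
      -- m is not spanned by the contracts that its worker prefers to it.
      proposed : ∀ {m} → M m ≡ true → ∀ Y → Fam.Feas workers Y →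
        (∀ {y} → Y y ≡ true → st y ≤ 2 × priority st y < priority st m) → Fam.Open workers Y m
      rejected : ∀ {e} → M e ≡ false → ∀ s → s < st e → Dominated firms M st e (key firms e s)

  exchanged : (Fin n → Bool) → Fin n → Fin n → Fin n → Bool
  exchanged M e m x = does (x ≟ᶠ e) ∨ (M x ∧ not (does (x ≟ᶠ m)))

  exchanged-Swap : ∀ σ {M e m} → M e ≡ false → M m ≡ true → Fam.Swap σ M e m (exchanged M e m)
  exchanged-Swap σ {M} {e} {m} e∉M m∈M = record
    { e≢m = e≢m ; e∉A = e∉M ; m∈A = m∈M ; e∈B = e∈ ; m∉B = m∉ ; others = others }
    where
    e≢m : e ≢ m
    e≢m refl = case trans (sym e∉M) m∈M of λ ()
    e∈ : exchanged M e m e ≡ true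
    e∈ = cong (_∨ (M e ∧ not (does (e ≟ᶠ m)))) (does-refl e)
    m∉ : exchanged M e m m ≡ false
    m∉ with m ≟ᶠ e | m ≟ᶠ m
    ... | yes m≡e | _      = contradiction (sym m≡e) e≢m
    ... | no _    | no m≢m = contradiction refl m≢m
    ... | no _    | yes _ rewrite m∈M = refl
    others : ∀ x → x ≢ e → x ≢ m → exchanged M e m x ≡ M x
    others x x≢e x≢m with x ≟ᶠ e | x ≟ᶠ m
    ... | yes x≡e | _       = contradiction x≡e x≢e
    ... | no _    | yes x≡m = contradiction x≡m x≢m
    ... | no _    | no _ with M x
    ...   | true  = refl
    ...   | false = refl

  invariant⇒kernel : ∀ {M st} → Invariant M st → (∀ e → ¬ Candidate M st e) → Kernel M st
  invariant⇒kernel {M} {st} inv none = record { feasible = feasible ; dominated = dom }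
    where
    open Invariant inv
    -- Were the worst chosen `w` in the minimal tight set `p` worse than `e`, the contracts of `M` +
    -- `e` - `w` in `p` would all be preferred to `w` and would fill `p`, against the invariant for
    -- `w`.
    dom-worker : ∀ {e} → M e ≡ false → st e ≤ 2 → Dominated workers M st e (key workers e (st e))
    dom-worker {e} e∉M st≤2 with Fam.open-or-minTight workers M e
    ... | inj₁ o = contradiction (e∉M , st≤2 , o) (none e)
    ... | inj₂ (p , mt@((e∈p , q≤) , _)) = p , (e∈p , q≤) , λ {m} m∈M m∈p →
      priority-≤⇒key-≤ {st} (worst-≤ (argmax In? (priority st) (m , m∈M , m∈p)) m∈M m∈p)
      where
      In : Fin n → Set
      In m = M m ≡ true × L workers p m ≡ true
      In? : ∀ m → Dec (In m)
      In? m = (M m ≟ᵇ true) ×-dec (L workers p m ≟ᵇ true)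
      worst-≤ : ∃[ w ] (In w × ∀ m → In m → priority st m ≤ priority st w) →
        ∀ {m} → M m ≡ true → L workers p m ≡ true → priority st m ≤ priority st e
      worst-≤ (w , (w∈M , w∈p) , max) {m} m∈M m∈p with priority st w ≤? priority st e
      ... | yes le = ≤-trans (max m (m∈M , m∈p)) le
      ... | no gt  = contradiction (proposed w∈M Y feasY preferred p w∈p) (≤⇒≯ q≤Y)
        where
        sw = exchanged-Swap workers e∉M w∈M
        B Y : Fin n → Bool
        B = exchanged M e w
        Y x = B x ∧ L workers p x
        feasY : Fam.Feas workers Y
        feasY = Fam.Feas-anti workers (λ h → proj₁ (∧-true h))
          (Fam.Feas-swap workers (feasible workers) mt w∈p sw)
        preferred : ∀ {y} → Y y ≡ true → st y ≤ 2 × priority st y < priority st w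
        preferred {y} y∈Y with ∧-true {B y} y∈Y
        ... | y∈B , y∈p with y ≟ᶠ e | y ≟ᶠ w
        ...   | yes refl | _    = st≤2 , ≰⇒> gt
        ...   | no y≢e | yes refl = case trans (sym y∈B) (cong (λ b → b ∧ false) w∈M) of λ ()
        ...   | no y≢e | no y≢w = ≤-pred (≤-trans (≤-reflexive (trans (+-comm 1 _) (cong (λ b → st y + ⟦ b ⟧ᵇ) (sym y∈M)))) (bounded y))
                                , ≤∧≢⇒< (max y (y∈M , y∈p)) λ eq → y≢w (priority-injective st eq)
          where
          y∈M : M y ≡ true
          y∈M = proj₁ (∧-true {M y} y∈B)
        q≤Y : q workers p ≤ Fam.on workers Y p
        q≤Y = begin
          q workers p           ≤⟨ q≤ ⟩
          Fam.on workers M p    ≡⟨ +-cancelʳ-≡ 1 _ _ on-≡ ⟨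
          Fam.on workers B p    ≤⟨ Fam.on-mono workers p (λ l b → cong₂ _∧_ b l) ⟩
          Fam.on workers Y p    ∎
          where
          open ≤-Reasoning
          on-≡ : Fam.on workers B p + 1 ≡ Fam.on workers M p + 1
          on-≡ with Fam.on-swap workers sw p
          ... | eq rewrite w∈p | e∈p = eq
    dom : ∀ {e} → M e ≡ false → ∀ s → s ≤ 2 → ∃[ σ ] Dominated σ M st e (key σ e s)
    -- Copies already rejected are dominated at the firm, the current and later ones at the worker.
    dom {e} e∉M s s≤2 with s <? st e
    ... | yes s<st = firms , rejected e∉M s s<st
    ... | no s≮st with dom-worker e∉M (≤-trans (≮⇒≥ s≮st) s≤2)
    ...   | p , tight , best = workers , p , tight , λ m∈M m∈p →
      ≤-trans (best m∈M m∈p) (+-monoʳ-≤ _ (offset-workers-mono (≮⇒≥ s≮st)))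

  -- Pointwise, so that it can be read off the store after a round. In `reject` the worst contract
  -- `w` may be `c` itself, which then only moves to its next copy.
  data Update (M : Fin n → Bool) (st : Fin n → ℕ) (c : Fin n) (M′ : Fin n → Bool) (st′ : Fin n → ℕ) : Set where
    accept : Fam.Open firms M c → M′ c ≡ true → (∀ x → x ≢ c → M′ x ≡ M x) →
      (∀ x → st′ x ≡ st x) → Update M st c M′ st′
    reject : ∀ p w → Fam.MinTight firms M c p → w ≡ c ⊎ (M w ≡ true × L firms p w ≡ true) →
      (∀ {m} → M m ≡ true → L firms p m ≡ true → key firms m (st m) ≤ key firms w (st w)) →
      key firms c (st c) ≤ key firms w (st w) →
      M′ w ≡ false → (c ≢ w → M′ c ≡ true) → (∀ x → x ≢ c → x ≢ w → M′ x ≡ M x) →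
      st′ w ≡ suc (st w) → (∀ x → x ≢ w → st′ x ≡ st x) → Update M st c M′ st′

  -- Accepting `c` adds a member, rejecting `c` raises its stage, and when another `w` makes way for
  -- `c`, its lost membership is offset by its higher stage. Every effective round thus adds exactly
  -- one.
  potential : (Fin n → Bool) → (Fin n → ℕ) → ℕ
  potential M st = sum λ e → st e + ⟦ M e ⟧ᵇ

  module _ {M st} (inv : Invariant M st) {c} (cand : Candidate M st c)
    (first : ∀ e → Candidate M st e → priority st c ≤ priority st e) where

    open Invariant inv

    private
      c∉M = proj₁ cand
      st≤2 = proj₁ (proj₂ cand)
      openW = proj₂ (proj₂ cand)

      c-or : ∀ x → x ≡ c ⊎ x ≢ c
      c-or x with x ≟ᶠ c
      ... | yes eq = inj₁ eq
      ... | no neq = inj₂ neq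

    module _ {M′ : Fin n → Bool} {st′ : Fin n → ℕ}
      (M′⊆ : ∀ {m} → M′ m ≡ true → m ≢ c → M m ≡ true)
      (same : ∀ {m} → M′ m ≡ true → st′ m ≡ st m) (grows : ∀ e → st e ≤ st′ e) where

      private
        -- For a contract chosen earlier the old clause applies. For `c`, the first candidate, every
        -- `y` of higher priority is chosen or spanned by `M`; as `M` leaves room for `c`, so does
        -- `Y`.
        proposed′ : ∀ {m} → M′ m ≡ true → ∀ Y → Fam.Feas workers Y →
          (∀ {y} → Y y ≡ true → st′ y ≤ 2 × priority st′ y < priority st′ m) → Fam.Open workers Y m
        proposed′ {m} m∈M′ Y feasY pref = go (c-or m)
          where
          pref′ : ∀ {y} → Y y ≡ true → st y ≤ 2 × priority st y < priority st m
          pref′ {y} y∈Y with pref y∈Y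
          ... | st≤ , lt = ≤-trans (grows y) st≤ , ≤-<-trans (priority-mono {st} {st′} y (grows y))
            (<-≤-trans lt (≤-reflexive (cong (λ s → key workers m s * n + toℕ m) (same m∈M′))))
          go : m ≡ c ⊎ m ≢ c → Fam.Open workers Y m
          go (inj₂ m≢c)  = proposed (M′⊆ m∈M′ m≢c) Y feasY pref′
          go (inj₁ refl) = Fam.Open-transfer workers feasY openW c∉M spanned
            where
            spanned : ∀ {y} → Y y ≡ true → M y ≡ true ⊎ ¬ Fam.Open workers M y
            spanned {y} y∈Y with M y in eq
            ... | true  = inj₁ refl
            ... | false = inj₂ λ o → <⇒≱ (proj₂ (pref′ y∈Y)) (first y (eq , proj₁ (pref′ y∈Y) , o))

        feasibleW : Fam.Feas workers M′
        feasibleW = Fam.Feas-anti workers M′⊑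
          (Fam.Feas-insert workers c (feasible workers) openW c∉M (⊞-here M c) (⊞-there M c))
          where
          M′⊑ : M′ ⊑ (M ⊞ c)
          M′⊑ {x} h with c-or x
          ... | inj₁ refl = ⊞-here M c
          ... | inj₂ x≢c rewrite M′⊆ h x≢c = refl

      invariant′ : Fam.Feas firms M′ → (∀ e → st′ e + ⟦ M′ e ⟧ᵇ ≤ 3) →
        (∀ {e} → M′ e ≡ false → ∀ s → s < st′ e → Dominated firms M′ st′ e (key firms e s)) →
        Invariant M′ st′
      invariant′ feasF bounded′ rejected′ = record
        { feasible = λ { workers → feasibleW ; firms → feasF }
        ; bounded = bounded′ ; proposed = proposed′ ; rejected = rejected′ }

    counted : ∀ {M′ st′} → st′ c + ⟦ M′ c ⟧ᵇ ≡ suc (st c + ⟦ M c ⟧ᵇ) →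
      (∀ x → x ≢ c → st′ x + ⟦ M′ x ⟧ᵇ ≡ st x + ⟦ M x ⟧ᵇ) →
      (∀ e → st′ e + ⟦ M′ e ⟧ᵇ ≤ 3) × potential M′ st′ ≡ suc (potential M st)
    counted {M′} {st′} hit miss = bounded′ , +-cancelʳ-≡ (st c + ⟦ M c ⟧ᵇ) _ _ (begin
      potential M′ st′ + (st c + ⟦ M c ⟧ᵇ)    ≡⟨ sum-update _ _ c miss ⟩
      potential M st + (st′ c + ⟦ M′ c ⟧ᵇ)    ≡⟨ cong (potential M st +_) hit ⟩
      potential M st + suc (st c + ⟦ M c ⟧ᵇ)  ≡⟨ +-suc _ _ ⟩
      suc (potential M st + (st c + ⟦ M c ⟧ᵇ)) ∎)
      where
      open ≡-Reasoning
      bounded′ : ∀ e → st′ e + ⟦ M′ e ⟧ᵇ ≤ 3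
      bounded′ e with c-or e
      ... | inj₂ e≢c  = ≤-trans (≤-reflexive (miss e e≢c)) (bounded e)
      ... | inj₁ refl = ≤-trans (≤-reflexive (trans hit (cong (λ b → suc (st c + ⟦ b ⟧ᵇ)) c∉M)))
        (s≤s (≤-trans (≤-reflexive (+-identityʳ _)) st≤2))

    step : ∀ {M′ st′} → Update M st c M′ st′ → Invariant M′ st′ × potential M′ st′ ≡ suc (potential M st)
    step {M′} {st′} (accept openF c∈M′ others sameSt) =
      invariant′ (λ {m} h m≢c → trans (sym (others m m≢c)) h) (λ _ → sameSt _) (λ e → ≤-reflexive (sym (sameSt e)))
        (Fam.Feas-insert firms c (feasible firms) openF c∉M c∈M′ others) (proj₁ tally) rejected′
      , proj₂ tally
      where
      tally = counted {M′} {st′}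
        (trans (cong₂ (λ s b → s + ⟦ b ⟧ᵇ) (sameSt c) c∈M′) (trans (+-comm _ 1)
          (cong suc (sym (trans (cong (λ b → st c + ⟦ b ⟧ᵇ) c∉M) (+-identityʳ _))))))
        (λ x x≢c → cong₂ (λ s b → s + ⟦ b ⟧ᵇ) (sameSt x) (others x x≢c))
      M⊑M′ : M ⊑ M′
      M⊑M′ {x} h with c-or x
      ... | inj₁ refl = c∈M′
      ... | inj₂ x≢c  = trans (others x x≢c) h
      rejected′ : ∀ {e} → M′ e ≡ false → ∀ s → s < st′ e → Dominated firms M′ st′ e (key firms e s)
      rejected′ {e} e∉M′ s s<st′ with rejected e∉M s (<-≤-trans s<st′ (≤-reflexive (sameSt e)))
        where
        e∉M : M e ≡ false
        e∉M = not-true λ h → case trans (sym (M⊑M′ h)) e∉M′ of λ ()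
      ... | p , (e∈p , q≤) , best = p , (e∈p , ≤-trans q≤ (Fam.on-mono firms p λ _ → M⊑M′)) , best′
        where
        best′ : ∀ {m} → M′ m ≡ true → L firms p m ≡ true → key firms m (st′ m) ≤ key firms e s
        best′ {m} m∈M′ m∈p rewrite sameSt m with c-or m
        ... | inj₁ refl = contradiction (openF p m∈p) (≤⇒≯ q≤)
        ... | inj₂ m≢c  = best (trans (sym (others m m≢c)) m∈M′) m∈p
    step {M′} {st′} (reject p w mt@((c∈p , q≤p) , _) w∈ worst c≤w w∉M′ c∈M′ others stw sameSt) with c-or w
    ... | inj₁ refl =
      invariant′ (λ m∈M′ m≢c → trans (sym (M′≡M _)) m∈M′) (λ m∈M′ → sameSt _ (in⇒≢w m∈M′)) grows
        (Fam.Feas-anti firms (λ {x} h → trans (sym (M′≡M x)) h) (feasible firms)) (proj₁ tally) rejected′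
      , proj₂ tally
      where
      in⇒≢w : ∀ {m} → M′ m ≡ true → m ≢ c
      in⇒≢w h refl = case trans (sym h) w∉M′ of λ ()
      M′≡M : ∀ x → M′ x ≡ M x
      M′≡M x with c-or x
      ... | inj₁ refl = trans w∉M′ (sym c∉M)
      ... | inj₂ x≢c  = others x x≢c x≢c
      grows : ∀ e → st e ≤ st′ e
      grows e with c-or e
      ... | inj₁ refl = ≤-trans (n≤1+n _) (≤-reflexive (sym stw))
      ... | inj₂ e≢c  = ≤-reflexive (sym (sameSt e e≢c))
      tally = counted {M′} {st′} (cong₂ (λ s b → s + ⟦ b ⟧ᵇ) stw (M′≡M c))
        (λ x x≢c → cong₂ (λ s b → s + ⟦ b ⟧ᵇ) (sameSt x x≢c) (M′≡M x))
      rejected′ : ∀ {e} → M′ e ≡ false → ∀ s → s < st′ e → Dominated firms M′ st′ e (key firms e s)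
      rejected′ {e} e∉M′ s s<st′ with c-or e
      ... | inj₁ refl = p , (c∈p , ≤-trans q≤p (≤-reflexive (#-cong λ x → cong (_∧ L firms p x) (sym (M′≡M x)))))
        , λ {m} m∈M′ m∈p → ≤-trans
            (≤-reflexive (cong (key firms m) (sameSt m (in⇒≢w m∈M′))))
            (≤-trans (worst (trans (sym (M′≡M m)) m∈M′) m∈p)
              (+-monoʳ-≤ _ (offset-firms-anti (≤-pred (≤-trans s<st′ (≤-reflexive stw))))))
      ... | inj₂ e≢c with rejected (trans (sym (M′≡M e)) e∉M′) s (<-≤-trans s<st′ (≤-reflexive (sameSt e e≢c)))
      ...   | p′ , (e∈p′ , q≤) , best = p′
        , (e∈p′ , ≤-trans q≤ (≤-reflexive (#-cong λ x → cong (_∧ L firms p′ x) (sym (M′≡M x)))))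
        , λ {m} m∈M′ m∈p′ → ≤-trans (≤-reflexive (cong (key firms m) (sameSt m (in⇒≢w m∈M′))))
            (best (trans (sym (M′≡M m)) m∈M′) m∈p′)
    ... | inj₂ w≢c with w∈
    ...   | inj₁ w≡c = contradiction w≡c w≢c
    ...   | inj₂ (w∈M , w∈p) =
      invariant′ (λ m∈M′ m≢c → in-M m∈M′ m≢c) (λ m∈M′ → sameSt _ (in⇒≢w m∈M′)) grows
        (Fam.Feas-swap firms (feasible firms) mt w∈p sw) (proj₁ tally) rejected′
      , proj₂ tally
      where
      c∈ : M′ c ≡ true
      c∈ = c∈M′ (λ eq → w≢c (sym eq))
      sw : Fam.Swap firms M c w M′
      sw = record { e≢m = λ eq → w≢c (sym eq) ; e∉A = c∉M ; m∈A = w∈M ; e∈B = c∈ ; m∉B = w∉M′ ; others = others }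
      in⇒≢w : ∀ {m} → M′ m ≡ true → m ≢ w
      in⇒≢w h refl = case trans (sym h) w∉M′ of λ ()
      in-M : ∀ {m} → M′ m ≡ true → m ≢ c → M m ≡ true
      in-M {m} h m≢c = trans (sym (others m m≢c (in⇒≢w h))) h
      grows : ∀ e → st e ≤ st′ e
      grows e with e ≟ᶠ w
      ... | yes refl = ≤-trans (n≤1+n _) (≤-reflexive (sym stw))
      ... | no e≢w   = ≤-reflexive (sym (sameSt e e≢w))
      tally = counted {M′} {st′}
        (trans (cong₂ (λ s b → s + ⟦ b ⟧ᵇ) (sameSt c (λ eq → w≢c (sym eq))) c∈) (trans (+-comm _ 1)
          (cong suc (sym (trans (cong (λ b → st c + ⟦ b ⟧ᵇ) c∉M) (+-identityʳ _))))))
        miss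
        where
        miss : ∀ x → x ≢ c → st′ x + ⟦ M′ x ⟧ᵇ ≡ st x + ⟦ M x ⟧ᵇ
        miss x x≢c with x ≟ᶠ w
        ... | no x≢w   = cong₂ (λ s b → s + ⟦ b ⟧ᵇ) (sameSt x x≢w) (others x x≢c x≢w)
        ... | yes refl rewrite stw | w∉M′ | w∈M = trans (+-identityʳ _) (+-comm 1 _)
      tight-swap : ∀ {p′} → L firms p′ c ≡ true → L firms p′ w ≡ true → q firms p′ ≤ Fam.on firms M p′ →
        q firms p′ ≤ Fam.on firms M′ p′
      tight-swap {p′} c∈p′ w∈p′ q≤ with Fam.on-swap firms sw p′
      ... | eq rewrite c∈p′ | w∈p′ = ≤-trans q≤ (≤-reflexive (sym (+-cancelʳ-≡ 1 _ _ eq)))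
      key-≤w : ∀ {m} → M′ m ≡ true → L firms p m ≡ true → key firms m (st′ m) ≤ key firms w (st w)
      key-≤w {m} m∈M′ m∈p rewrite sameSt m (in⇒≢w m∈M′) with c-or m
      ... | inj₁ refl = c≤w
      ... | inj₂ m≢c  = worst (in-M m∈M′ m≢c) m∈p
      rejected′ : ∀ {e} → M′ e ≡ false → ∀ s → s < st′ e → Dominated firms M′ st′ e (key firms e s)
      rejected′ {e} e∉M′ s s<st′ with e ≟ᶠ w
      ... | yes refl = p , (w∈p , tight-swap c∈p w∈p q≤p) , λ m∈M′ m∈p → ≤-trans (key-≤w m∈M′ m∈p)
        (+-monoʳ-≤ _ (offset-firms-anti (≤-pred (≤-trans s<st′ (≤-reflexive stw)))))
      ... | no e≢w with rejected e∉M s (<-≤-trans s<st′ (≤-reflexive (sameSt e e≢w)))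
        where
        e≢c : e ≢ c
        e≢c refl = case trans (sym c∈) e∉M′ of λ ()
        e∉M : M e ≡ false
        e∉M = trans (sym (others e e≢c e≢w)) e∉M′
      ...   | p′ , (e∈p′ , q≤) , best = go (L firms p′ c) (L firms p′ w) refl refl
        where
        κ = key firms e s
        go : ∀ a b → L firms p′ c ≡ a → L firms p′ w ≡ b → Dominated firms M′ st′ e κ
        -- A tight `p′` containing `c` contains `p` and with it `w`, so the swap leaves it tight.
        go true b c∈p′ _ = p′ , (e∈p′ , tight-swap c∈p′ w∈p′ q≤) , best′
          where
          w∈p′ : L firms p′ w ≡ true
          w∈p′ = Fam.MinTight-⊑ firms mt p′ (c∈p′ , q≤) w∈p
          best′ : ∀ {m} → M′ m ≡ true → L firms p′ m ≡ true → key firms m (st′ m) ≤ κ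
          best′ {m} m∈M′ m∈p′ rewrite sameSt m (in⇒≢w m∈M′) with c-or m
          ... | inj₁ refl = ≤-trans c≤w (best w∈M w∈p′)
          ... | inj₂ m≢c  = best (in-M m∈M′ m≢c) m∈p′
        go false false c∉p′ w∉p′ = p′ , (e∈p′ , q≤′) , best′
          where
          q≤′ : q firms p′ ≤ Fam.on firms M′ p′
          q≤′ with Fam.on-swap firms sw p′
          ... | eq rewrite c∉p′ | w∉p′ = ≤-trans q≤ (≤-reflexive (sym (+-cancelʳ-≡ 0 _ _ eq)))
          best′ : ∀ {m} → M′ m ≡ true → L firms p′ m ≡ true → key firms m (st′ m) ≤ κ
          best′ {m} m∈M′ m∈p′ rewrite sameSt m (in⇒≢w m∈M′) with c-or m
          ... | inj₁ refl = case trans (sym c∉p′) m∈p′ of λ ()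
          ... | inj₂ m≢c  = best (in-M m∈M′ m≢c) m∈p′
        -- Here `p′` loses an element and may cease to be tight. It lies inside `p`, which stays
        -- tight and takes its place; `w`, the worst in `p`, meets the bound `κ` because it was a
        -- chosen member of `p′`.
        go false true c∉p′ w∈p′ with Fam.intersecting firms w∈p w∈p′
        ... | inj₁ p⊑p′ = case trans (sym c∉p′) (p⊑p′ c∈p) of λ ()
        ... | inj₂ p′⊑p = p , (p′⊑p e∈p′ , tight-swap c∈p w∈p q≤p) , λ m∈M′ m∈p →
          ≤-trans (key-≤w m∈M′ m∈p) (best w∈M w∈p′)

  -- Stores before and after a search give the same sets and stages only pointwise, so every notion
  -- has to be transported along pointwise equality.
  Candidate-cong : ∀ {M M′ : Fin n → Bool} {st st′ : Fin n → ℕ} → (∀ e → M e ≡ M′ e) → (∀ e → st e ≡ st′ e) →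
    ∀ {e} → Candidate M st e → Candidate M′ st′ e
  Candidate-cong M≡ st≡ {e} (e∉M , st≤2 , o) = trans (sym (M≡ e)) e∉M , subst (_≤ 2) (st≡ e) st≤2
    , λ p e∈p → subst (_< q workers p) (#-cong λ x → cong (_∧ L workers p x) (M≡ x)) (o p e∈p)

  Invariant-cong : ∀ {M M′ : Fin n → Bool} {st st′ : Fin n → ℕ} → (∀ e → M e ≡ M′ e) → (∀ e → st e ≡ st′ e) →
    Invariant M st → Invariant M′ st′
  Invariant-cong {M} {M′} {st} {st′} M≡ st≡ inv = record
    { feasible = λ σ p → subst (_≤ q σ p) (on-≡ σ p) (feasible σ p)
    ; bounded = λ e → subst₂ (λ s b → s + ⟦ b ⟧ᵇ ≤ 3) (st≡ e) (M≡ e) (bounded e)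
    ; proposed = λ {m} m∈M′ Y feasY pref → proposed (trans (M≡ m) m∈M′) Y feasY λ {y} y∈Y →
        subst (_≤ 2) (sym (st≡ y)) (proj₁ (pref y∈Y)) ,
        subst₂ _<_ (priority-≡ y) (priority-≡ m) (proj₂ (pref y∈Y))
    ; rejected = λ {e} e∉M′ s s<st → rejected′ e (rejected (trans (M≡ e) e∉M′) s (subst (s <_) (sym (st≡ e)) s<st)) }
    where
    open Invariant inv
    on-≡ : ∀ σ p → Fam.on σ M p ≡ Fam.on σ M′ p
    on-≡ σ p = #-cong λ x → cong (_∧ L σ p x) (M≡ x)
    priority-≡ : ∀ y → priority st′ y ≡ priority st y
    priority-≡ y = cong (λ s → key workers y s * n + toℕ y) (sym (st≡ y))
    rejected′ : ∀ e {κ} → Dominated firms M st e κ → Dominated firms M′ st′ e κ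
    rejected′ e {κ} (p , (e∈p , q≤) , best) = p , (e∈p , subst (q firms p ≤_) (on-≡ firms p) q≤)
      , λ {m} m∈M′ m∈p → subst (λ s → key firms m s ≤ κ) (st≡ m) (best (trans (M≡ m) m∈M′) m∈p)

  initial : ∀ {M st} → (∀ e → M e ≡ false) → (∀ e → st e ≡ 0) → Invariant M st
  initial {M} {st} none zeros = record
    { feasible = λ σ p → ≤-trans (≤-reflexive (trans (#-sum _) (sum-zero λ x → cong (λ b → ⟦ b ∧ L σ p x ⟧ᵇ) (none x)))) z≤n
    ; bounded = λ e → subst₂ (λ s b → s + ⟦ b ⟧ᵇ ≤ 3) (sym (zeros e)) (sym (none e)) z≤n
    ; proposed = λ {m} m∈M → case trans (sym m∈M) (none m) of λ ()
    ; rejected = λ {e} _ s s<st → case subst (s <_) (zeros e) s<st of λ () }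

  potential≤ : ∀ {M st} → Invariant M st → potential M st ≤ 3 * n
  potential≤ {M} {st} inv = sum≤*n (λ e → st e + ⟦ M e ⟧ᵇ) 3 (Invariant.bounded inv)

  invariant⇒stage≤2 : ∀ {M st} → Invariant M st → ∀ {m} → M m ≡ true → st m ≤ 2
  invariant⇒stage≤2 {M} {st} inv {m} m∈M = ≤-pred (≤-trans
    (≤-reflexive (trans (+-comm 1 _) (cong (λ b → st m + ⟦ b ⟧ᵇ) (sym m∈M)))) (Invariant.bounded inv m))

-- Running programs

writes : Program → ℕ → Bool
writes skip         x = false
writes (y at i ≔ e) x = y ≡ᵇ x
writes (P ⨾ Q)      x = writes P x ∨ writes Q x
writes (If b P Q)   x = writes P x ∨ writes Q x
writes (While b P)  x = writes P x

∨-false : ∀ {a b} → a ∨ b ≡ false → a ≡ false × b ≡ false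
∨-false {false} h = refl , h

frame : ∀ {P s t s′} → ⟨ P , s ⟩⇓[ t ] s′ → ∀ x → writes P x ≡ false → ∀ i → s′ x i ≡ s x i
frame skip x h i = refl
frame (assign {x = y}) x h i rewrite h = refl
frame (seq d d′) x h i =
  trans (frame d′ x (proj₂ (∨-false h)) i) (frame d x (proj₁ (∨-false h)) i)
frame (if-true {P = P} {Q} _ d) x h i = frame d x (proj₁ (∨-false {writes P x} {writes Q x} h)) i
frame (if-false {P = P} {Q} _ d) x h i = frame d x (proj₂ (∨-false {writes P x} {writes Q x} h)) i
frame (while-true _ d d′) x h i = trans (frame d′ x h i) (frame d x h i)
frame (while-false _) x h i = refl

independent : Exp → (ℕ → Bool) → Bool
independent (lit n)  W = true
independent (x at i) W = not (W x) ∧ independent i W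
independent (p ⊕ q)  W = independent p W ∧ independent q W
independent (p ⊖ q)  W = independent p W ∧ independent q W

eval-agree : ∀ e {W s s′} → independent e W ≡ true →
  (∀ x → W x ≡ false → ∀ i → s′ x i ≡ s x i) → eval e s′ ≡ eval e s
eval-agree (lit n)  _ same = refl
eval-agree (x at i) {W} {s} {s′} h same with W x in eq
... | false = trans (same x eq _) (cong (s x) (eval-agree i h same))
eval-agree (p ⊕ q) {W} h same with independent p W in eq
... | true = cong₂ _+_ (eval-agree p eq same) (eval-agree q h same)
eval-agree (p ⊖ q) {W} h same with independent p W in eq
... | true = cong₂ _∸_ (eval-agree p eq same) (eval-agree q h same)

-- Total correctness with a time bound, anchored at one initial store so that postconditions can
-- refer to it.
Runs : Program → Store → ℕ → (Store → Set) → Set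
Runs P s T Q = ∃[ t ] ∃[ s′ ] (⟨ P , s ⟩⇓[ t ] s′ × t ≤ T × Q s′)

branch : {A : Set} → ℕ → A → A → A
branch zero    _ a = a
branch (suc _) a _ = a

-- A function, so that the effect of loop-free code is found by normalisation. The clause for
-- `While` is a default value that `loopFree` excludes.
run : Program → Store → Store
run skip         s = s
run (x at i ≔ e) s = s [ x , eval i s ↦ eval e s ]
run (P ⨾ Q)      s = run Q (run P s)
run (If b P Q)   s = branch (eval b s) (run P s) (run Q s)
run (While b P)  s = s

loopFree : Program → Bool
loopFree skip         = true
loopFree (x at i ≔ e) = true
loopFree (P ⨾ Q)      = loopFree P ∧ loopFree Q
loopFree (If b P Q)   = loopFree P ∧ loopFree Q
loopFree (While b P)  = false

-- Adding up both branches of a conditional is crude but suffices for O(_).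
maxCost : Program → ℕ
maxCost skip         = 1
maxCost (x at i ≔ e) = 1 + cost i + cost e
maxCost (P ⨾ Q)      = maxCost P + maxCost Q
maxCost (If b P Q)   = 1 + cost b + (maxCost P + maxCost Q)
maxCost (While b P)  = 0

run-loopFree : ∀ P s → loopFree P ≡ true → ∃[ t ] (⟨ P , s ⟩⇓[ t ] run P s × t ≤ maxCost P)
run-loopFree skip         s h = _ , skip , ≤-refl
run-loopFree (x at i ≔ e) s h = _ , assign , ≤-refl
run-loopFree (P ⨾ Q)      s h with loopFree P in eq
... | true with run-loopFree P s eq | run-loopFree Q (run P s) h
...   | _ , d , le | _ , d′ , le′ = _ , seq d d′ , +-mono-≤ le le′
run-loopFree (If b P Q)   s h with loopFree P in eq
... | true with eval b s in eqb | run-loopFree P s eq | run-loopFree Q s h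
...   | zero  | _ | _ , d , le = _ , if-false eqb d , s≤s (+-monoʳ-≤ (cost b) (≤-trans le (m≤n+m _ _)))
...   | suc _ | _ , d , le | _ = _ , if-true (λ z → case trans (sym eqb) z of λ ()) d
  , s≤s (+-monoʳ-≤ (cost b) (≤-trans le (m≤m+n _ _)))

runs-loopFree : ∀ P {s} {Q : Store → Set} → loopFree P ≡ true → Q (run P s) → Runs P s (maxCost P) Q
runs-loopFree P {s} h q with run-loopFree P s h
... | _ , d , le = _ , _ , d , le , q

runs-⨾ : ∀ {P Q s T U} {R S : Store → Set} → Runs P s T R →
  (∀ s′ → (∀ x → writes P x ≡ false → ∀ i → s′ x i ≡ s x i) → R s′ → Runs Q s′ U S) → Runs (P ⨾ Q) s (T + U) S
runs-⨾ (t , s′ , d , le , r) f with f s′ (frame d) r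
... | _ , _ , d′ , le′ , q = _ , _ , seq d d′ , +-mono-≤ le le′ , q

runs-assign : ∀ {x i e Q s U} {S : Store → Set} → Runs Q (s [ x , eval i s ↦ eval e s ]) U S →
  Runs (x at i ≔ e ⨾ Q) s ((1 + cost i + cost e) + U) S
runs-assign (_ , _ , d , le , q) = _ , _ , seq assign d , +-monoʳ-≤ _ le , q

runs-weaken : ∀ {P s T U} {R S : Store → Set} → T ≤ U → (∀ {s′} → R s′ → S s′) → Runs P s T R → Runs P s U S
runs-weaken T≤U f (t , s′ , d , le , r) = t , s′ , d , ≤-trans le T≤U , f r

runs-time : ∀ {P s T U} {R : Store → Set} → T ≡ U → Runs P s T R → Runs P s U R
runs-time refl r = r

runs-if : ∀ {b P Q s T U} {R : Store → Set} → (eval b s ≢ 0 → Runs P s T R) → (eval b s ≡ 0 → Runs Q s U R) →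
  Runs (If b P Q) s (1 + cost b + (T + U)) R
runs-if {b} {s = s} f g with eval b s in eq
... | zero with g refl
...   | _ , _ , d , le , r = _ , _ , if-false eq d , s≤s (+-monoʳ-≤ (cost b) (≤-trans le (m≤n+m _ _))) , r
runs-if {b} f g | suc _ with f (λ ())
...   | _ , _ , d , le , r = _ , _ , if-true (λ z → case trans (sym eq) z of λ ()) d
  , s≤s (+-monoʳ-≤ (cost b) (≤-trans le (m≤m+n _ _))) , r

runs-frame : ∀ {P s T} {R : Store → Set} → Runs P s T R →
  Runs P s T (λ s′ → (∀ x → writes P x ≡ false → ∀ i → s′ x i ≡ s x i) × R s′)
runs-frame (t , s′ , d , le , r) = t , s′ , d , le , frame d , r

-- `μ` bounds the number of rounds still to come; the last summand pays for the test that fails.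
runs-while : ∀ {b P} (Inv : Store → Set) (μ : Store → ℕ) B →
  (∀ s → Inv s → eval b s ≢ 0 → Runs P s B (λ s′ → Inv s′ × μ s′ < μ s)) →
  ∀ {s m} → Inv s → μ s ≤ m →
  Runs (While b P) s (m * (suc (cost b) + B) + suc (cost b)) (λ s′ → Inv s′ × eval b s′ ≡ 0)
runs-while {b} {P} Inv μ B body {s} {m} inv μ≤m with eval b s in eq
... | zero = _ , _ , while-false eq , m≤n+m _ _ , inv , eq
... | suc _ with body s inv (λ z → case trans (sym eq) z of λ ())
...   | t , s₁ , d , t≤B , inv₁ , μ< with m
...     | zero   = contradiction (<-≤-trans μ< μ≤m) λ ()
...     | suc m′ with runs-while Inv μ B body {m = m′} inv₁ (≤-pred (<-≤-trans μ< μ≤m))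
...       | u , s₂ , d₂ , u≤ , post = _ , s₂ , while-true (λ z → case trans (sym eq) z of λ ()) d d₂
  , (begin
      1 + cost b + t + u   ≤⟨ +-mono-≤ (+-monoʳ-≤ (suc (cost b)) t≤B) u≤ ⟩
      suc (cost b) + B + (m′ * (suc (cost b) + B) + suc (cost b)) ≡⟨ +-assoc (suc (cost b) + B) _ _ ⟨
      suc m′ * (suc (cost b) + B) + suc (cost b) ∎)
  , post
  where open ≤-Reasoning

-- Counting loops

For : ℕ → Exp → Program → Program
For c n P = c at lit 0 ≔ lit 0 ⨾ While (n ⊖ c at lit 0) (P ⨾ c at lit 0 ≔ (c at lit 0 ⊕ lit 1))

≡ᵇ-refl : ∀ n → (n ≡ᵇ n) ≡ true
≡ᵇ-refl zero = refl
≡ᵇ-refl (suc n) = ≡ᵇ-refl n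

update-here : ∀ (s : Store) x i v → (s [ x , i ↦ v ]) x i ≡ v
update-here s x i v rewrite ≡ᵇ-refl x | ≡ᵇ-refl i = refl

update-other : ∀ (s : Store) c x i {v} k → (c ≡ᵇ x) ≡ false → (s [ c , i ↦ v ]) x k ≡ s x k
update-other s c x i k c≢x rewrite c≢x = refl

update-update : ∀ (s : Store) c v w x i → (s [ c , 0 ↦ w ]) x i ≡ ((s [ c , 0 ↦ v ]) [ c , 0 ↦ w ]) x i
update-update s c v w x i with (c ≡ᵇ x) ∧ (0 ≡ᵇ i)
... | true  = refl
... | false = refl

update-cong : ∀ {s s′ : Store} {x j} c i v → s x j ≡ s′ x j → (s [ c , i ↦ v ]) x j ≡ (s′ [ c , i ↦ v ]) x j
update-cong {x = x} {j} c i v eq with (c ≡ᵇ x) ∧ (i ≡ᵇ j)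
... | true  = refl
... | false = eq

Agree : (ℕ → Bool) → Store → Store → Set
Agree W s s′ = ∀ x → W x ≡ false → ∀ i → s x i ≡ s′ x i

-- Beyond the body and the bound expression, a round costs 10 units and the rest of the loop 7; the
-- 12 rounds both up.
forCost : Exp → ℕ → ℕ → ℕ
forCost n N B = N * (B + (cost n + 12)) + (cost n + 12)

-- The bound is evaluated anew in each round, so it must read nothing that the loop writes. The body
-- may assume that the arrays it does not write are those of the start, with the counter at `j`.
runs-for : ∀ {c n P s₀} B (Inv : ℕ → Store → Set) → writes P c ≡ false →
  independent n (writes (For c n P)) ≡ true → Inv 0 (s₀ [ c , 0 ↦ 0 ]) →
  (∀ j s → j < eval n s₀ → Agree (writes P) s (s₀ [ c , 0 ↦ j ]) → Inv j s →
    Runs P s B (λ s′ → Inv (suc j) (s′ [ c , 0 ↦ suc j ]))) →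
  Runs (For c n P) s₀ (forCost n (eval n s₀) B) (Inv (eval n s₀))
runs-for {c} {n} {P} {s₀} B Inv c-free n-free inv₀ body =
  runs-weaken time≤ post (runs-assign loop)
  where
  N = eval n s₀
  b = n ⊖ c at lit 0
  Inv′ : Store → Set
  Inv′ s = ∃[ j ] (j ≤ N × Agree (writes P) s (s₀ [ c , 0 ↦ j ]) × Inv j s)
  counter : ∀ {s j} → Agree (writes P) s (s₀ [ c , 0 ↦ j ]) → s c 0 ≡ j
  counter {j = j} agree = trans (agree c c-free 0) (update-here s₀ c 0 j)
  n-eval : ∀ {s j} → Agree (writes P) s (s₀ [ c , 0 ↦ j ]) → eval n s ≡ N
  n-eval {s} {j} agree = eval-agree n n-free λ x h i → outer x h i
    where
    outer : ∀ x → writes (For c n P) x ≡ false → ∀ i → s x i ≡ s₀ x i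
    outer x h i with ∨-false {c ≡ᵇ x} h
    ... | c≢x , h′ = trans (agree x (proj₁ (∨-false {writes P x} h′)) i) (cong (λ t → if t ∧ (0 ≡ᵇ i) then j else s₀ x i) c≢x)
  μ : Store → ℕ
  μ s = N ∸ s c 0
  step : ∀ s → Inv′ s → eval b s ≢ 0 →
    Runs (P ⨾ c at lit 0 ≔ (c at lit 0 ⊕ lit 1)) s (B + 6) (λ s′ → Inv′ s′ × μ s′ < μ s)
  step s (j , j≤N , agree , inv) b≢0 = runs-⨾ (body j s j<N agree inv) λ s′ fr inv′ →
    _ , _ , assign , ≤-refl , (suc j , j<N , agree′ s′ fr , subst (λ v → Inv (suc j) (s′ [ c , 0 ↦ v ])) (sym (value s′ fr)) inv′)
    , ≤-<-trans (≤-reflexive (cong (N ∸_) (trans (update-here s′ c 0 _) (value s′ fr))))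
        (<-≤-trans (∸-monoʳ-< ≤-refl j<N) (≤-reflexive (cong (N ∸_) (sym (counter agree)))))
    where
    j<N : j < N
    j<N = ≰⇒> λ N≤j → b≢0 (trans (cong₂ _∸_ (n-eval agree) (counter agree)) (m≤n⇒m∸n≡0 N≤j))
    value : ∀ s′ → (∀ x → writes P x ≡ false → ∀ i → s′ x i ≡ s x i) → s′ c 0 + 1 ≡ suc j
    value s′ fr = trans (+-comm _ 1) (cong suc (trans (fr c c-free 0) (counter agree)))
    agree′ : ∀ s′ → (∀ x → writes P x ≡ false → ∀ i → s′ x i ≡ s x i) →
      Agree (writes P) (s′ [ c , 0 ↦ s′ c 0 + 1 ]) (s₀ [ c , 0 ↦ suc j ])
    agree′ s′ fr x h i rewrite value s′ fr = trans
      (update-cong {s′} {s₀ [ c , 0 ↦ j ]} {x} {i} c 0 (suc j) (trans (fr x h i) (agree x h i)))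
      (sym (update-update s₀ c j (suc j) x i))
  loop : Runs (While b (P ⨾ c at lit 0 ≔ (c at lit 0 ⊕ lit 1))) (s₀ [ c , 0 ↦ 0 ])
    (N * (suc (cost b) + (B + 6)) + suc (cost b)) (λ s″ → Inv′ s″ × eval b s″ ≡ 0)
  loop = runs-while Inv′ μ (B + 6) step (0 , z≤n , (λ _ _ _ → refl) , inv₀) (m∸n≤m N ((s₀ [ c , 0 ↦ 0 ]) c 0))
  post : ∀ {s} → Inv′ s × eval b s ≡ 0 → Inv N s
  post {s} ((j , j≤N , agree , inv) , done) = subst (λ j → Inv j s) j≡N inv
    where
    j≡N : j ≡ N
    j≡N = ≤-antisym j≤N (m∸n≡0⇒m≤n (trans (sym (cong₂ _∸_ (n-eval agree) (counter agree))) done))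
  time≤ : 3 + (N * (suc (cost b) + (B + 6)) + suc (cost b)) ≤ forCost n N B
  time≤ = begin
    3 + (N * (suc (cost b) + (B + 6)) + suc (cost b))
      ≡⟨ solve 3 (λ n N B → con 3 :+ (N :* (con 1 :+ (con 1 :+ n :+ con 2) :+ (B :+ con 6)) :+ (con 1 :+ (con 1 :+ n :+ con 2)))
           := N :* (B :+ (n :+ con 10)) :+ (n :+ con 7)) refl (cost n) N B ⟩
    N * (B + (cost n + 10)) + (cost n + 7)
      ≤⟨ +-mono-≤ (*-monoʳ-≤ N (+-monoʳ-≤ B (+-monoʳ-≤ (cost n) (m≤m+n 10 2)))) (+-monoʳ-≤ (cost n) (m≤m+n 7 5)) ⟩
    forCost n N B ∎
    where
    open ≤-Reasoning
    open +-*-Solver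

branch-elim : {A : Set} (Pr : A → Set) → ∀ n {a b : A} → (n ≢ 0 → Pr a) → (n ≡ 0 → Pr b) → Pr (branch n a b)
branch-elim Pr zero    f g = g refl
branch-elim Pr (suc _) f g = f λ ()

runs-for-loopFree : ∀ {c n P s₀} (Inv : ℕ → Store → Set) → loopFree P ≡ true → writes P c ≡ false →
  independent n (writes (For c n P)) ≡ true → Inv 0 (s₀ [ c , 0 ↦ 0 ]) →
  (∀ j s → j < eval n s₀ → Agree (writes P) s (s₀ [ c , 0 ↦ j ]) → Inv j s →
    Inv (suc j) (run P s [ c , 0 ↦ suc j ])) →
  Runs (For c n P) s₀ (forCost n (eval n s₀) (maxCost P)) (Inv (eval n s₀))
runs-for-loopFree {P = P} Inv lf c-free n-free inv₀ step =
  runs-for (maxCost P) Inv c-free n-free inv₀ λ j s j<N agree inv → runs-loopFree P lf (step j s j<N agree inv)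

≡ᵇ⇒≡′ : ∀ {m n} → (m ≡ᵇ n) ≡ true → m ≡ n
≡ᵇ⇒≡′ {m} {n} h = ≡ᵇ⇒≡ m n (subst T (sym h) tt)

≢⇒≡ᵇ : ∀ {m n} → m ≢ n → (m ≡ᵇ n) ≡ false
≢⇒≡ᵇ {m} {n} m≢n with m ≡ᵇ n in eq
... | true  = contradiction (≡ᵇ⇒≡′ eq) m≢n
... | false = refl

-- The arrays used besides the input: 13 holds the chosen contracts, 14 the
-- number of rejected copies of each contract, 15 and 16 the set to which each
-- entry of the arrays 9 and 10 belongs, 17 the number of chosen contracts in
-- each set, 18 the contracts that their workers cannot add, 19 and 20 the
-- offsets of the copies.  Of the others only the cell 0 is used: 21 and 26 are
-- loop counters, 22 and 23 the result of a search and its key, 24 and 25 the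
-- numbers of entries, 27 the proposed contract, 28 the smallest tight set that
-- contains it, 29 the rejected contract; 30, 31 and 33 serve to fill 15 and 16.

ix : Exp
ix = 21 at lit 0

-- Searches the indices below N that pass the test for the first one of least
-- key; big has to exceed all keys, and the result is N if no index passes.
module Argmin (N test key big : Exp) where

  body scan search : Program
  -- Only a strict improvement replaces the stored index, so among equal keys the first one stays.
  body = If test (If ((23 at lit 0) ⊖ key) (22 at lit 0 ≔ (21 at lit 0) ⨾ 23 at lit 0 ≔ key) skip) skip
  scan = For 21 N body
  search = 22 at lit 0 ≔ N ⨾ 23 at lit 0 ≔ big ⨾ scan

  cost-argmin : ℕ → ℕ
  cost-argmin n = (2 + cost N) + ((2 + cost big) + forCost N n (maxCost body))

  module _ (s₀ : Store) where

    tst ky : ℕ → ℕ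
    tst j = eval test (s₀ [ 21 , 0 ↦ j ])
    ky j = eval key (s₀ [ 21 , 0 ↦ j ])

    Least : ℕ → ℕ → ℕ → Set
    Least n b k = (b ≡ eval N s₀ × ∀ {j} → j < n → tst j ≡ 0)
      ⊎ (b < n × tst b ≢ 0 × k ≡ ky b
        × (∀ {j} → j < n → tst j ≢ 0 → ky b ≤ ky j)
        × (∀ {j} → j < b → tst j ≢ 0 → ky b < ky j))

    runs-argmin : independent test (writes body) ≡ true → independent key (writes body) ≡ true →
      independent N (writes scan) ≡ true → independent big (writes scan) ≡ true →
      (∀ {j} → j < eval N s₀ → tst j ≢ 0 → ky j < eval big s₀) →
      Runs search s₀ (cost-argmin (eval N s₀)) (λ s → Least (eval N s₀) (s 22 0) (s 23 0))
    runs-argmin tf kf Nf bf bound =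
      runs-assign (runs-assign (subst (λ n → Runs scan s₂ (forCost N n (maxCost body)) (λ s → Least n (s 22 0) (s 23 0))) N₂
        (runs-weaken ≤-refl proj₁ (runs-for-loopFree Inv refl refl Nf inv₀ step))))
      where
      s₁ = s₀ [ 22 , 0 ↦ eval N s₀ ]
      s₂ = s₁ [ 23 , 0 ↦ eval big s₁ ]
      unwritten : ∀ x → writes body x ≡ false → (22 ≡ᵇ x) ≡ false × (23 ≡ᵇ x) ≡ false
      unwritten x h = ∨-false {22 ≡ᵇ x} (proj₁ (∨-false (proj₁ (∨-false h))))
      off₁ : ∀ x → writes body x ≡ false → ∀ i → s₁ x i ≡ s₀ x i
      off₁ x h i rewrite proj₁ (unwritten x h) = refl
      off : ∀ x → writes body x ≡ false → ∀ i → s₂ x i ≡ s₀ x i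
      off x h i rewrite proj₁ (unwritten x h) | proj₂ (unwritten x h) = refl
      scan-body : ∀ x → writes scan x ≡ false → writes body x ≡ false
      scan-body x h = proj₁ (∨-false (proj₂ (∨-false {21 ≡ᵇ x} h)))
      N₂ : eval N s₂ ≡ eval N s₀
      N₂ = eval-agree N Nf λ x h → off x (scan-body x h)
      big₁ : eval big s₁ ≡ eval big s₀
      big₁ = eval-agree big bf λ x h → off₁ x (scan-body x h)
      Inv : ℕ → Store → Set
      Inv j s = Least j (s 22 0) (s 23 0) × ((∀ {i} → i < j → tst i ≡ 0) → s 23 0 ≡ eval big s₀)
      inv₀ : Inv 0 (s₂ [ 21 , 0 ↦ 0 ])
      inv₀ = inj₁ (refl , λ ()) , λ _ → big₁
      step : ∀ j s → j < eval N s₂ → Agree (writes body) s (s₂ [ 21 , 0 ↦ j ]) → Inv j s →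
        Inv (suc j) (run body s [ 21 , 0 ↦ suc j ])
      step j s j<N₂ agree (least , none) =
        branch-elim Goal (eval test s)
          (λ t≢0 → branch-elim Goal (s 23 0 ∸ eval key s)
            (λ k≢0 → replace (λ z → t≢0 (trans tst-j z)) k≢0)
            (λ k≡0 → keep λ _ → m∸n≡0⇒m≤n (trans (cong (s 23 0 ∸_) (sym ky-j)) k≡0)))
          (λ t≡0 → keep λ t≢0 → contradiction (trans (sym tst-j) t≡0) t≢0)
        where
        Goal : Store → Set
        Goal s′ = Inv (suc j) (s′ [ 21 , 0 ↦ suc j ])
        j<N : j < eval N s₀
        j<N = <-≤-trans j<N₂ (≤-reflexive N₂)
        at-j : ∀ e → independent e (writes body) ≡ true → eval e s ≡ eval e (s₀ [ 21 , 0 ↦ j ])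
        at-j e h = eval-agree e h λ x w i → trans (agree x w i) (update-cong {s₂} {s₀} 21 0 j (off x w i))
        tst-j : eval test s ≡ tst j
        tst-j = at-j test tf
        ky-j : eval key s ≡ ky j
        ky-j = at-j key kf
        counter : s 21 0 ≡ j
        counter = agree 21 refl 0
        keep : (tst j ≢ 0 → s 23 0 ≤ ky j) → Goal s
        keep old = keep-from least
          where
          keep-from : Least j (s 22 0) (s 23 0) → Goal s
          keep-from (inj₂ (b<j , t , k≡ , min , first)) = inj₂ (m≤n⇒m≤1+n b<j , t , k≡ , min′ , first)
            , λ all → contradiction (all (m≤n⇒m≤1+n b<j)) t
            where
            min′ : ∀ {i} → i < suc j → tst i ≢ 0 → ky (s 22 0) ≤ ky i
            min′ {i} i<j+1 ti with m≤n⇒m<n∨m≡n (≤-pred i<j+1)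
            ... | inj₁ i<j = min i<j ti
            ... | inj₂ refl = ≤-trans (≤-reflexive (sym k≡)) (old ti)
          keep-from (inj₁ (b≡ , zeros)) = inj₁ (b≡ , zeros′) , λ _ → none zeros
            where
            zeros′ : ∀ {i} → i < suc j → tst i ≡ 0
            zeros′ {i} i<j+1 with m≤n⇒m<n∨m≡n (≤-pred i<j+1)
            ... | inj₁ i<j = zeros i<j
            ... | inj₂ refl with tst i ≟ 0
            ...   | yes z = z
            -- The stored key is still `big`, which exceeds all keys, so a passing index would have
            -- been taken.
            ...   | no nz = contradiction (bound j<N nz) (≤⇒≯ (≤-trans (≤-reflexive (sym (none zeros))) (old nz)))
        replace : tst j ≢ 0 → s 23 0 ∸ eval key s ≢ 0 → Goal (run (22 at lit 0 ≔ (21 at lit 0) ⨾ 23 at lit 0 ≔ key) s)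
        replace t≢0 k≢0 rewrite counter = inj₂ (≤-refl , t≢0 , new-key , min′ , first′)
          , λ all → contradiction (all ≤-refl) t≢0
          where
          ky<best : ky j < s 23 0
          ky<best = ≰⇒> λ le → k≢0 (m≤n⇒m∸n≡0 (≤-trans le (≤-reflexive (sym ky-j))))
          new-key : eval key (s [ 22 , 0 ↦ j ]) ≡ ky j
          new-key = trans (eval-agree key kf λ x w i → lemma x w i) ky-j
            where
            lemma : ∀ x → writes body x ≡ false → ∀ i → (s [ 22 , 0 ↦ j ]) x i ≡ s x i
            lemma x w i rewrite proj₁ (unwritten x w) = refl
          first′ : ∀ {i} → i < j → tst i ≢ 0 → ky j < ky i
          first′ {i} i<j ti = first-from least
            where
            first-from : Least j (s 22 0) (s 23 0) → ky j < ky i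
            first-from (inj₁ (_ , zeros)) = contradiction (zeros i<j) ti
            first-from (inj₂ (_ , _ , k≡ , min , _)) = <-≤-trans (<-≤-trans ky<best (≤-reflexive k≡)) (min i<j ti)
          min′ : ∀ {i} → i < suc j → tst i ≢ 0 → ky j ≤ ky i
          min′ i<j+1 ti with m≤n⇒m<n∨m≡n (≤-pred i<j+1)
          ... | inj₁ i<j  = <⇒≤ (first′ i<j ti)
          ... | inj₂ refl = ≤-refl

sumTo : ℕ → (ℕ → ℕ) → ℕ
sumTo zero    f = 0
sumTo (suc n) f = sumTo n f + f n

nonzero : ℕ → Bool
nonzero n = not (n ≡ᵇ 0)

-- Counting the chosen contracts in each set

module Count (mem grp : ℕ) (N : Exp) where

  clear-body clear count-body count : Program
  -- Clearing goes by entries as well: it reaches the cells that are read later, in time independent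
  -- of the number of empty sets.
  clear-body = 17 at (grp at ix) ≔ lit 0
  clear      = For 21 N clear-body
  count-body = If (13 at (mem at ix)) (17 at (grp at ix) ≔ ((17 at (grp at ix)) ⊕ lit 1)) skip
  count      = clear ⨾ For 21 N count-body

  cost-count : ℕ → ℕ
  cost-count n = forCost N n (maxCost clear-body) + forCost N n (maxCost count-body)

  tally : Store → ℕ → ℕ → ℕ
  tally s n g = sumTo n λ p → ⟦ (s grp p ≡ᵇ g) ∧ nonzero (s 13 (s mem p)) ⟧ᵇ

  runs-count : (17 ≡ᵇ grp) ≡ false → (21 ≡ᵇ grp) ≡ false → (17 ≡ᵇ mem) ≡ false → (21 ≡ᵇ mem) ≡ false →
    independent N (writes clear) ≡ true → independent N (writes (For 21 N count-body)) ≡ true → ∀ s₀ →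
    Runs count s₀ (cost-count (eval N s₀))
      (λ s → ∀ {p} → p < eval N s₀ → s 17 (s₀ grp p) ≡ tally s₀ (eval N s₀) (s₀ grp p))
  runs-count g17 g21 m17 m21 N-free₁ N-free₂ s₀ = runs-⨾ (runs-for-loopFree Inv₁ refl refl N-free₁ (λ ()) step₁)
    λ s₁ fr zeros → go s₁ fr zeros
    where
    n = eval N s₀
    Inv₁ : ℕ → Store → Set
    Inv₁ j s = ∀ {p} → p < j → s 17 (s₀ grp p) ≡ 0
    read : ∀ {W s s₁ j} x → Agree W s (s₁ [ 21 , 0 ↦ j ]) → W 21 ≡ false → W x ≡ false → (21 ≡ᵇ x) ≡ false →
      s x (s 21 0) ≡ s₁ x j
    read {W} {s} {s₁} {j} x agree h hx h21 = trans (agree x hx _)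
      (trans (cong (λ b → if b ∧ (0 ≡ᵇ s 21 0) then j else s₁ x (s 21 0)) h21) (cong (s₁ x) (agree 21 h 0)))
    step₁ : ∀ j s → j < n → Agree (writes clear-body) s (s₀ [ 21 , 0 ↦ j ]) → Inv₁ j s →
      Inv₁ (suc j) (run clear-body s [ 21 , 0 ↦ suc j ])
    step₁ j s j<n agree inv {p} p<j+1 rewrite read {s = s} {s₀} {j} grp agree refl g17 g21 with s₀ grp j ≡ᵇ s₀ grp p in eq
    ... | true  = refl
    ... | false with m≤n⇒m<n∨m≡n (≤-pred p<j+1)
    ...   | inj₁ p<j  = inv p<j
    ...   | inj₂ refl = case trans (sym (≡ᵇ-refl (s₀ grp j))) eq of λ ()
    go : ∀ s₁ → (∀ x → writes clear x ≡ false → ∀ i → s₁ x i ≡ s₀ x i) → Inv₁ n s₁ →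
      Runs (For 21 N count-body) s₁ (forCost N n (maxCost count-body)) (λ s → ∀ {p} → p < n → s 17 (s₀ grp p) ≡ tally s₀ n (s₀ grp p))
    go s₁ fr zeros = subst (λ m → Runs (For 21 N count-body) s₁ (forCost N m (maxCost count-body)) (Inv₂ m)) N₁
      (runs-for-loopFree Inv₂ refl refl N-free₂ zeros step₂)
      where
      N₁ : eval N s₁ ≡ n
      N₁ = eval-agree N N-free₁ fr
      Inv₂ : ℕ → Store → Set
      Inv₂ j s = ∀ {p} → p < n → s 17 (s₀ grp p) ≡ tally s₀ j (s₀ grp p)
      step₂ : ∀ j s → j < eval N s₁ → Agree (writes count-body) s (s₁ [ 21 , 0 ↦ j ]) → Inv₂ j s →
        Inv₂ (suc j) (run count-body s [ 21 , 0 ↦ suc j ])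
      step₂ j s j<n agree inv = branch-elim (λ s′ → Inv₂ (suc j) (s′ [ 21 , 0 ↦ suc j ]))
        (s 13 (s mem (s 21 0))) more same
        where
        off : ∀ x → (21 ≡ᵇ x) ≡ false → (17 ≡ᵇ x) ≡ false → ∀ k → s₁ x k ≡ s₀ x k
        off x h h′ k = fr x (cong₂ _∨_ h (cong₂ _∨_ h′ h)) k
        grp-j : s grp (s 21 0) ≡ s₀ grp j
        grp-j = trans (read {s = s} {s₁} {j} grp agree refl (cong (_∨ false) g17) g21) (off grp g21 g17 j)
        mem-j : s 13 (s mem (s 21 0)) ≡ s₀ 13 (s₀ mem j)
        mem-j = trans (agree 13 refl _) (trans (off 13 refl refl _)
          (cong (s₀ 13) (trans (read {s = s} {s₁} {j} mem agree refl (cong (_∨ false) m17) m21) (off mem m21 m17 j))))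
        same : s 13 (s mem (s 21 0)) ≡ 0 → Inv₂ (suc j) (s [ 21 , 0 ↦ suc j ])
        same z {p} p<n rewrite trans (sym mem-j) z with s₀ grp j ≡ᵇ s₀ grp p
        ... | true  = trans (inv p<n) (sym (+-identityʳ _))
        ... | false = trans (inv p<n) (sym (+-identityʳ _))
        more : s 13 (s mem (s 21 0)) ≢ 0 →
          Inv₂ (suc j) ((s [ 17 , s grp (s 21 0) ↦ s 17 (s grp (s 21 0)) + 1 ]) [ 21 , 0 ↦ suc j ])
        more nz {p} p<n rewrite grp-j with s₀ 13 (s₀ mem j) | mem-j
        ... | zero  | z = contradiction z nz
        ... | suc _ | _ with s₀ grp j ≡ᵇ s₀ grp p in eq
        ...   | true  = cong (_+ 1) (trans (cong (s 17) (≡ᵇ⇒≡′ eq)) (inv p<n))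
        ...   | false = trans (inv p<n) (sym (+-identityʳ _))

sumTo-suc : ∀ n f → sumTo (suc n) f ≡ f 0 + sumTo n (f ∘ suc)
sumTo-suc zero    f = +-comm 0 (f 0)
sumTo-suc (suc n) f = trans (cong (_+ f (suc n)) (sumTo-suc n f)) (+-assoc (f 0) _ _)

sumTo-sum : ∀ n f → sumTo n f ≡ sum (λ (x : Fin n) → f (toℕ x))
sumTo-sum zero    f = refl
sumTo-sum (suc n) f = trans (sumTo-suc n f) (cong (f 0 +_) (sumTo-sum n (f ∘ suc)))

-- The entries of all sets of all agents of one side; member p is the set to
-- which the entry p belongs, and code p identifies this set.
record Incidence (n : ℕ) : Set where
  field
    entries      : ℕ
    el           : Fin entries → Fin n
    code         : Fin entries → ℕ
    member       : Fin entries → Fin n → Bool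
    quota        : Fin entries → ℕ
    sound        : ∀ p → member p (el p) ≡ true
    complete     : ∀ p e → member p e ≡ true → ∃[ p′ ] (code p′ ≡ code p × el p′ ≡ e)
    unique       : ∀ {p p′} → code p ≡ code p′ → el p ≡ el p′ → p ≡ p′
    code-member  : ∀ {p p′} → code p ≡ code p′ → ∀ e → member p e ≡ member p′ e
    laminar      : ∀ p p′ → member p ⊑ member p′ ⊎ member p′ ⊑ member p
                   ⊎ (∀ x → member p x ≡ true → member p′ x ≡ true → ⊥)

  asFamily : Family n
  asFamily = record { size = entries ; member = member ; quota = quota ; laminar = laminar }

  open Laminar asFamily using (on)

  -- By `complete` and `unique` the entries with the code of `p₀` correspond one to one to the
  -- contracts in its set; a double sum over entries and contracts is evaluated in both orders.
  count-on : ∀ M p₀ → sum (λ p → ⟦ (code p ≡ᵇ code p₀) ∧ M (el p) ⟧ᵇ) ≡ on M p₀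
  count-on M p₀ = begin
    sum (λ p → ⟦ (code p ≡ᵇ code p₀) ∧ M (el p) ⟧ᵇ) ≡⟨ sum-cong-≗ (λ p → sym (spread p)) ⟩
    sum (λ p → sum λ e → f p e)                   ≡⟨ ∑-comm f ⟩
    sum (λ e → sum λ p → f p e)                   ≡⟨ sum-cong-≗ collect ⟩
    sum (λ e → ⟦ M e ∧ member p₀ e ⟧ᵇ)            ≡⟨ #-sum _ ⟨
    on M p₀                                       ∎
    where
    open ≡-Reasoning
    f : Fin entries → Fin n → ℕ
    f p e = ⟦ does (e ≟ᶠ el p) ∧ ((code p ≡ᵇ code p₀) ∧ M e) ⟧ᵇ
    spread : ∀ p → sum (f p) ≡ ⟦ (code p ≡ᵇ code p₀) ∧ M (el p) ⟧ᵇ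
    spread p = trans (sum-single (f p) (el p) miss) hit
      where
      miss : ∀ e → e ≢ el p → f p e ≡ 0
      miss e e≢ with e ≟ᶠ el p
      ... | yes e≡ = contradiction e≡ e≢
      ... | no _   = refl
      hit : f p (el p) ≡ ⟦ (code p ≡ᵇ code p₀) ∧ M (el p) ⟧ᵇ
      hit rewrite does-refl (el p) = refl
    collect : ∀ e → sum (λ p → f p e) ≡ ⟦ M e ∧ member p₀ e ⟧ᵇ
    collect e with M e | member p₀ e in eq
    ... | false | _ = sum-zero λ p → go (does (e ≟ᶠ el p)) (code p ≡ᵇ code p₀)
      where
      go : ∀ a b → ⟦ a ∧ (b ∧ false) ⟧ᵇ ≡ 0
      go false _ = refl
      go true false = refl
      go true true = refl
    ... | true | false = sum-zero none
      where
      none : ∀ p → ⟦ does (e ≟ᶠ el p) ∧ ((code p ≡ᵇ code p₀) ∧ true) ⟧ᵇ ≡ 0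
      none p with e ≟ᶠ el p | code p ≡ᵇ code p₀ in c
      ... | no _     | _     = refl
      ... | yes _    | false = refl
      ... | yes refl | true  =
        case trans (sym eq) (trans (sym (code-member (≡ᵇ⇒≡′ c) (el p))) (sound p)) of λ ()
    ... | true | true with complete p₀ e eq
    ...   | p₁ , c₁ , e₁ = trans (sum-single g p₁ miss) hit
      where
      g : Fin entries → ℕ
      g p = ⟦ does (e ≟ᶠ el p) ∧ ((code p ≡ᵇ code p₀) ∧ true) ⟧ᵇ
      miss : ∀ p → p ≢ p₁ → g p ≡ 0
      miss p p≢ with e ≟ᶠ el p | code p ≡ᵇ code p₀ in c
      ... | no _    | _     = refl
      ... | yes _   | false = refl
      ... | yes e≡  | true  = contradiction (unique (trans (≡ᵇ⇒≡′ c) (sym c₁)) (trans (sym e≡) (sym e₁))) p≢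
      hit : g p₁ ≡ 1
      hit rewrite c₁ | e₁ | ≡ᵇ-refl (code p₀) | does-refl e = refl

-- The size of a set is not stored; it is the distance between two neighbouring offsets.
record Represents {n} (inc : Incidence n) (s : Store) (mem grp quo set N : ℕ) : Set where
  open Incidence inc
  field
    N-eq   : s N 0 ≡ entries
    el-eq  : ∀ p → s mem (toℕ p) ≡ toℕ (el p)
    grp-eq : ∀ p → s grp (toℕ p) ≡ code p
    quo-eq : ∀ p → s quo (code p) ≡ quota p
    set-eq : ∀ p → s set (code p + 1) ∸ s set (code p) ≡ # (member p)

Represents-agree : ∀ {n} {inc : Incidence n} {s s′ mem grp quo set N} →
  (∀ k → s′ mem k ≡ s mem k) → (∀ k → s′ grp k ≡ s grp k) → (∀ k → s′ quo k ≡ s quo k) →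
  (∀ k → s′ set k ≡ s set k) → (∀ k → s′ N k ≡ s N k) →
  Represents inc s mem grp quo set N → Represents inc s′ mem grp quo set N
Represents-agree m g q t N r = record
  { N-eq   = trans (N 0) N-eq
  ; el-eq  = λ p → trans (m _) (el-eq p)
  ; grp-eq = λ p → trans (g _) (grp-eq p)
  ; quo-eq = λ p → trans (q _) (quo-eq p)
  ; set-eq = λ p → trans (cong₂ _∸_ (t _) (t _)) (set-eq p) }
  where open Represents r

chosen : ∀ {n} → Store → Fin n → Bool
chosen s e = nonzero (s 13 (toℕ e))

stage : ∀ {n} → Store → Fin n → ℕ
stage s e = s 14 (toℕ e)

tally-on : ∀ {n} {inc : Incidence n} {s mem grp quo set N} → Represents inc s mem grp quo set N →
  let open Incidence inc in
  ∀ p → Count.tally mem grp (N at lit 0) s (s N 0) (code p) ≡ Laminar.on asFamily (chosen s) p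
tally-on {inc = inc} {s} {mem} {grp} {N = N} r p = begin
  Count.tally mem grp (N at lit 0) s (s N 0) (code p)  ≡⟨ cong (λ k → Count.tally mem grp (N at lit 0) s k (code p)) N-eq ⟩
  Count.tally mem grp (N at lit 0) s entries (code p)  ≡⟨ sumTo-sum entries _ ⟩
  sum (λ (p′ : Fin entries) → ⟦ (s grp (toℕ p′) ≡ᵇ code p) ∧ nonzero (s 13 (s mem (toℕ p′))) ⟧ᵇ)
    ≡⟨ sum-cong-≗ {entries} (λ p′ → cong₂ (λ a b → ⟦ (a ≡ᵇ code p) ∧ nonzero (s 13 b) ⟧ᵇ) (grp-eq p′) (el-eq p′)) ⟩
  sum (λ p′ → ⟦ (code p′ ≡ᵇ code p) ∧ chosen s (el p′) ⟧ᵇ)  ≡⟨ count-on (chosen s) p ⟩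
  Laminar.on asFamily (chosen s) p ∎
  where
  open ≡-Reasoning
  open Represents r
  open Incidence inc

-- Marking the contracts that their workers cannot add

module Block where

  clear-body mark-body clear mark : Program
  clear-body = 18 at ix ≔ lit 0
  clear = For 21 (0 at lit 0) clear-body
  -- `lit 1 ⊖ x` is nonzero exactly when `x` is 0, so the test holds when the quota is at most the
  -- count.
  mark-body = If (lit 1 ⊖ ((11 at (15 at ix)) ⊖ (17 at (15 at ix)))) (18 at (9 at ix) ≔ lit 1) skip
  mark = For 21 (24 at lit 0) mark-body

  runs-clear : ∀ s₀ → Runs clear s₀ (forCost (0 at lit 0) (s₀ 0 0) (maxCost clear-body))
    (λ s → ∀ {e} → e < s₀ 0 0 → s 18 e ≡ 0)
  runs-clear s₀ = runs-for-loopFree Inv refl refl refl (λ ()) step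
    where
    Inv : ℕ → Store → Set
    Inv j s = ∀ {e} → e < j → s 18 e ≡ 0
    step : ∀ j s → j < s₀ 0 0 → Agree (writes clear-body) s (s₀ [ 21 , 0 ↦ j ]) → Inv j s →
      Inv (suc j) (run clear-body s [ 21 , 0 ↦ suc j ])
    step j s _ agree inv {e} e<j+1 rewrite agree 21 refl 0 with j ≡ᵇ e in eq
    ... | true  = refl
    ... | false with m≤n⇒m<n∨m≡n (≤-pred e<j+1)
    ...   | inj₁ e<j  = inv e<j
    ...   | inj₂ refl = case trans (sym (≡ᵇ-refl e)) eq of λ ()

  Full : Store → ℕ → Set
  Full s p = s 11 (s 15 p) ≤ s 17 (s 15 p)

  Marked : Store → ℕ → ℕ → ℕ → Set
  Marked s₀ j e v = (v ≡ 0 × ∀ {p} → p < j → s₀ 9 p ≡ e → ¬ Full s₀ p)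
    ⊎ (v ≢ 0 × ∃[ p ] (p < j × s₀ 9 p ≡ e × Full s₀ p))

  runs-mark : ∀ s₀ → (∀ {e} → e < s₀ 0 0 → s₀ 18 e ≡ 0) →
    Runs mark s₀ (forCost (24 at lit 0) (s₀ 24 0) (maxCost mark-body))
    (λ s → ∀ {e} → e < s₀ 0 0 → Marked s₀ (s₀ 24 0) e (s 18 e))
  runs-mark s₀ zeros = runs-for-loopFree Inv refl refl refl (λ e<n → inj₁ (zeros e<n , λ ())) step
    where
    Inv : ℕ → Store → Set
    Inv j s = ∀ {e} → e < s₀ 0 0 → Marked s₀ j e (s 18 e)
    step : ∀ j s → j < s₀ 24 0 → Agree (writes mark-body) s (s₀ [ 21 , 0 ↦ j ]) → Inv j s →
      Inv (suc j) (run mark-body s [ 21 , 0 ↦ suc j ])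
    step j s _ agree inv = branch-elim (λ s′ → Inv (suc j) (s′ [ 21 , 0 ↦ suc j ]))
      (1 ∸ (s 11 (s 15 (s 21 0)) ∸ s 17 (s 15 (s 21 0)))) (λ nz → full nz) notFull
      where
      ctr : s 21 0 ≡ j
      ctr = agree 21 refl 0
      el-j : s 9 (s 21 0) ≡ s₀ 9 j
      el-j = trans (agree 9 refl _) (cong (s₀ 9) ctr)
      grp-j : s 15 (s 21 0) ≡ s₀ 15 j
      grp-j = trans (agree 15 refl _) (cong (s₀ 15) ctr)
      diff : s 11 (s 15 (s 21 0)) ∸ s 17 (s 15 (s 21 0)) ≡ s₀ 11 (s₀ 15 j) ∸ s₀ 17 (s₀ 15 j)
      diff = cong₂ _∸_ (trans (agree 11 refl _) (cong (s₀ 11) grp-j)) (trans (agree 17 refl _) (cong (s₀ 17) grp-j))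
      full : 1 ∸ (s 11 (s 15 (s 21 0)) ∸ s 17 (s 15 (s 21 0))) ≢ 0 →
        Inv (suc j) ((s [ 18 , s 9 (s 21 0) ↦ 1 ]) [ 21 , 0 ↦ suc j ])
      full nz {e} e<n rewrite el-j with s₀ 9 j ≡ᵇ e in eq
      ... | true  = inj₂ ((λ ()) , j , ≤-refl , ≡ᵇ⇒≡′ eq , m∸n≡0⇒m≤n (trans (sym diff) (n<1⇒n≡0 (≰⇒> λ le → nz (m≤n⇒m∸n≡0 le)))))
      ... | false with inv e<n
      ...   | inj₂ (v , p , p<j , el , f) = inj₂ (v , p , m≤n⇒m≤1+n p<j , el , f)
      ...   | inj₁ (v , none) = inj₁ (v , none′)
        where
        none′ : ∀ {p} → p < suc j → s₀ 9 p ≡ e → ¬ Full s₀ p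
        none′ p<j+1 el with m≤n⇒m<n∨m≡n (≤-pred p<j+1)
        ... | inj₁ p<j = none p<j el
        ... | inj₂ refl rewrite el = case trans (sym (≡ᵇ-refl e)) eq of λ ()
      notFull : 1 ∸ (s 11 (s 15 (s 21 0)) ∸ s 17 (s 15 (s 21 0))) ≡ 0 → Inv (suc j) (s [ 21 , 0 ↦ suc j ])
      notFull z {e} e<n with inv e<n
      ... | inj₂ (v , p , p<j , el , f) = inj₂ (v , p , m≤n⇒m≤1+n p<j , el , f)
      ... | inj₁ (v , none) = inj₁ (v , none′)
        where
        none′ : ∀ {p} → p < suc j → s₀ 9 p ≡ e → ¬ Full s₀ p
        none′ p<j+1 el with m≤n⇒m<n∨m≡n (≤-pred p<j+1)
        ... | inj₁ p<j = none p<j el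
        ... | inj₂ refl = λ f → case trans (sym z) (cong (1 ∸_) (trans diff (m≤n⇒m∸n≡0 f))) of λ ()

elem : ℕ → List ℕ → Bool
elem x []       = false
elem x (y ∷ ys) = (y ≡ᵇ x) ∨ elem x ys

avoids : (ℕ → Bool) → List ℕ → Bool
avoids W []       = true
avoids W (x ∷ xs) = not (W x) ∧ avoids W xs

inputs kept : List ℕ
inputs = 0 ∷ 3 ∷ 4 ∷ 7 ∷ 8 ∷ 9 ∷ 10 ∷ 11 ∷ 12 ∷ 15 ∷ 16 ∷ 19 ∷ 20 ∷ 24 ∷ 25 ∷ []
kept   = 13 ∷ 14 ∷ inputs

Keeps : List ℕ → Store → Store → Set
Keeps xs s s′ = ∀ x → elem x xs ≡ true → ∀ i → s′ x i ≡ s x i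

keeps-frame : ∀ xs W {s s′} → avoids W xs ≡ true → (∀ x → W x ≡ false → ∀ i → s′ x i ≡ s x i) → Keeps xs s s′
keeps-frame (y ∷ ys) W h fr x x∈ i with W y in eq | y ≡ᵇ x in eqy
... | false | true rewrite ≡ᵇ⇒≡′ {y} eqy = fr x eq i
... | false | false = keeps-frame ys W h fr x x∈ i

keeps-tail : ∀ {x xs s s′} → Keeps (x ∷ xs) s s′ → Keeps xs s s′
keeps-tail {x} {xs} k y y∈ = k y (trans (cong ((x ≡ᵇ y) ∨_) y∈) (∨-zeroʳ (x ≡ᵇ y)))

keeps-trans : ∀ {xs s s′ s″} → Keeps xs s s′ → Keeps xs s′ s″ → Keeps xs s s″
keeps-trans k k′ x x∈ i = trans (k′ x x∈ i) (k x x∈ i)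

keeps-inputs : ∀ {s s′} → Keeps kept s s′ → Keeps inputs s s′
keeps-inputs {s} {s′} k = keeps-tail {14} {inputs} {s} {s′} (keeps-tail {13} {14 ∷ inputs} {s} {s′} k)

1∸≢0 : ∀ {m} → 1 ∸ m ≢ 0 → m ≡ 0
1∸≢0 {zero} _ = refl
1∸≢0 {suc m} h = contradiction (0∸n≡0 m) h

1∸≡0 : ∀ {m} → 1 ∸ m ≡ 0 → m ≢ 0
1∸≡0 {zero} ()

-- Expressions have no comparison; the programs test equality by adding the two truncated
-- differences.
∸∸≡0 : ∀ m n → (m ∸ n) + (n ∸ m) ≡ 0 → m ≡ n
∸∸≡0 m n h = ≤-antisym (m∸n≡0⇒m≤n (m+n≡0⇒m≡0 (m ∸ n) h)) (m∸n≡0⇒m≤n (m+n≡0⇒n≡0 (m ∸ n) h))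

∸∸≡0⁻ : ∀ {m n} → m ≡ n → (m ∸ n) + (n ∸ m) ≡ 0
∸∸≡0⁻ {m} refl rewrite n∸n≡0 m = refl

-- `big` is 4 |E| + 1, since twice a position is at most 2 |E| and an offset at most 2 |E| + 1.
nE big : Exp
nE  = 0 at lit 0
big = (nE ⊕ nE) ⊕ (nE ⊕ nE) ⊕ lit 1

keyExp : ℕ → ℕ → Exp → Exp
keyExp pos tab e = (pos at e) ⊕ (pos at e) ⊕ (tab at (14 at e))

-- The program for one round

module CountW = Count 9 15 (24 at lit 0)
module CountF = Count 10 16 (25 at lit 0)
-- The test passes contracts that are unchosen, unmarked and of stage at most 2. Taking the smallest
-- index among equal keys realises `priority`.
module First = Argmin nE (lit 1 ⊖ ((13 at ix) ⊕ (18 at ix) ⊕ ((14 at ix) ⊖ lit 2))) (keyExp 3 19 ix) (big ⊕ lit 1)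

c : Exp
c = 27 at lit 0

-- The test passes entries of the contract `c` whose set is full; the key is the size of the set.
module Smallest = Argmin (25 at lit 0)
  (lit 1 ⊖ (((10 at ix) ⊖ c) ⊕ (c ⊖ (10 at ix)) ⊕ ((12 at (16 at ix)) ⊖ (17 at (16 at ix)))))
  ((8 at ((16 at ix) ⊕ lit 1)) ⊖ (8 at (16 at ix))) (nE ⊕ lit 1)

-- The test passes entries of the set found that hold chosen contracts; subtracting from `big` turns
-- the worst key into the least one.
module Worst = Argmin (25 at lit 0)
  (lit 1 ⊖ (((16 at ix) ⊖ (28 at lit 0)) ⊕ ((28 at lit 0) ⊖ (16 at ix)) ⊕ (lit 1 ⊖ (13 at (10 at ix)))))
  (big ⊖ keyExp 4 20 (10 at ix)) (big ⊕ lit 1)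

-- Leaves in cell 22 the contract to be proposed, or #E if there is none.
select : Program
select = CountW.count ⨾ Block.clear ⨾ Block.mark ⨾ First.search

loser : Exp
loser = 29 at lit 0

compare replace displace place : Program
-- The proposed contract loses unless a chosen one is strictly worse; this default also covers a
-- full set without chosen contracts.
compare = 29 at lit 0 ≔ c ⨾
  If ((25 at lit 0) ⊖ (22 at lit 0))
    (If (keyExp 4 20 (10 at (22 at lit 0)) ⊖ keyExp 4 20 c) (29 at lit 0 ≔ (10 at (22 at lit 0))) skip)
    skip
-- Inserting `c` before deleting the loser is right also when the two coincide.
replace = 13 at c ≔ lit 1 ⨾ 13 at loser ≔ lit 0 ⨾ 14 at loser ≔ ((14 at loser) ⊕ lit 1)
displace = 28 at lit 0 ≔ (16 at (22 at lit 0)) ⨾ Worst.search ⨾ (compare ⨾ replace)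
place = 27 at lit 0 ≔ (22 at lit 0) ⨾ CountF.count ⨾ Smallest.search ⨾
  If ((25 at lit 0) ⊖ (22 at lit 0)) displace (13 at c ≔ lit 1)

iterate : Program
iterate = select ⨾ If (nE ⊖ (22 at lit 0)) place skip

select-time displace-time place-time iterate-time : ℕ → ℕ → ℕ → ℕ
select-time W F n = CountW.cost-count W + (forCost nE n (maxCost Block.clear-body)
  + (forCost (24 at lit 0) W (maxCost Block.mark-body) + First.cost-argmin n))
displace-time W F n = 5 + (Worst.cost-argmin F + (maxCost compare + maxCost replace))
place-time W F n = 4 + (CountF.cost-count F + (Smallest.cost-argmin F
  + (1 + cost ((25 at lit 0) ⊖ (22 at lit 0)) + (displace-time W F n + maxCost (13 at c ≔ lit 1)))))
iterate-time W F n = select-time W F n + (1 + cost (nE ⊖ (22 at lit 0)) + (place-time W F n + 1))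

-- Correctness of one round

module Iteration {n} (incs : Side → Incidence n) (pos : Side → Fin n → ℕ) (pos≤n : ∀ σ e → pos σ e ≤ n) where

  market : Market n
  market = record { ℱ = λ σ → Incidence.asFamily (incs σ) ; pos = pos ; pos≤n = pos≤n }

  open Market market hiding (pos; pos≤n)

  private module I σ = Incidence (incs σ)

  record Input (s : Store) : Set where
    field
      n-eq : s 0 0 ≡ n
      repW : Represents (incs workers) s 9 15 11 7 24
      repF : Represents (incs firms) s 10 16 12 8 25
      posW : ∀ e → s 3 (toℕ e) ≡ pos workers e
      posF : ∀ e → s 4 (toℕ e) ≡ pos firms e
      tabW : ∀ {t} → t ≤ 2 → s 19 t ≡ offset n workers t
      tabF : ∀ {t} → t ≤ 2 → s 20 t ≡ offset n firms t

  Input-keeps : ∀ {s s′} → Keeps inputs s s′ → Input s → Input s′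
  Input-keeps k inp = record
    { n-eq = trans (k 0 refl 0) n-eq
    ; repW = Represents-agree (k 9 refl) (k 15 refl) (k 11 refl) (k 7 refl) (k 24 refl) repW
    ; repF = Represents-agree (k 10 refl) (k 16 refl) (k 12 refl) (k 8 refl) (k 25 refl) repF
    ; posW = λ e → trans (k 3 refl _) (posW e)
    ; posF = λ e → trans (k 4 refl _) (posF e)
    ; tabW = λ t≤ → trans (k 19 refl _) (tabW t≤)
    ; tabF = λ t≤ → trans (k 20 refl _) (tabF t≤) }
    where open Input inp

  offset≤ : ∀ σ t → offset n σ t ≤ suc (n + n)
  offset≤ workers 0 = z≤n
  offset≤ workers 1 = s≤s z≤n
  offset≤ workers (suc (suc _)) = ≤-refl
  offset≤ firms 0 = ≤-refl
  offset≤ firms 1 = s≤s z≤n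
  offset≤ firms (suc (suc _)) = z≤n

  key≤big : ∀ σ e t → key σ e t ≤ (n + n) + (n + n) + 1
  key≤big σ e t = begin
    key σ e t                ≤⟨ +-mono-≤ (+-mono-≤ (pos≤n σ e) (pos≤n σ e)) (offset≤ σ t) ⟩
    n + n + suc (n + n)      ≡⟨ cong (n + n +_) (+-comm 1 (n + n)) ⟩
    n + n + (n + n + 1)      ≡⟨ +-assoc (n + n) (n + n) 1 ⟨
    (n + n) + (n + n) + 1    ∎
    where open ≤-Reasoning

  #≤n : (A : Fin n → Bool) → # A ≤ n
  #≤n A = ≤-trans (≤-reflexive (#-sum A)) (≤-trans (sum≤*n _ 1 (λ e → ⟦⟧ᵇ≤1 (A e))) (≤-reflexive (*-identityˡ n)))

  Selected : Store → ℕ → Set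
  Selected s b = (b ≡ n × ∀ e → ¬ Candidate (chosen s) (stage s) e)
    ⊎ ∃[ e ] (b ≡ toℕ e × Candidate (chosen s) (stage s) e
      × ∀ e′ → Candidate (chosen s) (stage s) e′ → priority (stage s) e ≤ priority (stage s) e′)

  runs-select : ∀ s → Input s → Runs select s (select-time (I.entries workers) (I.entries firms) n) (λ s′ → Selected s (s′ 22 0))
  runs-select s inp =
    runs-⨾ (runs-time (cong CountW.cost-count N-eq) (CountW.runs-count refl refl refl refl refl refl s)) λ s₁ fr₁ counted →
    runs-⨾ (runs-time (cong (λ m → forCost nE m (maxCost Block.clear-body)) (n₁ {s₁} fr₁)) (Block.runs-clear s₁)) λ s₂ fr₂ zeros →
    runs-⨾ (runs-time (cong (λ N → forCost (24 at lit 0) N (maxCost Block.mark-body)) (trans (fr₂ 24 refl 0) (trans (fr₁ 24 refl 0) N-eq)))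
      (Block.runs-mark s₂ λ e<n → zeros (<-≤-trans e<n (≤-reflexive (fr₂ 0 refl 0))))) λ s₃ fr₃ marked →
      let open Phase s₁ s₂ s₃ fr₁ fr₂ fr₃ counted marked in
      runs-time (cong First.cost-argmin n₃) (runs-weaken ≤-refl (λ {s′} → selected {s′}) (First.runs-argmin s₃ refl refl refl refl bound))
    where
    open Input inp
    open Represents repW
    n₁ : ∀ {s₁} → (∀ x → writes CountW.count x ≡ false → ∀ i → s₁ x i ≡ s x i) → s₁ 0 0 ≡ n
    n₁ fr = trans (fr 0 refl 0) n-eq
    module Phase (s₁ s₂ s₃ : Store)
      (fr₁ : ∀ x → writes CountW.count x ≡ false → ∀ i → s₁ x i ≡ s x i)
      (fr₂ : ∀ x → writes Block.clear x ≡ false → ∀ i → s₂ x i ≡ s₁ x i)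
      (fr₃ : ∀ x → writes Block.mark x ≡ false → ∀ i → s₃ x i ≡ s₂ x i)
      (counted : ∀ {p} → p < s 24 0 → s₁ 17 (s 15 p) ≡ CountW.tally s (s 24 0) (s 15 p))
      (marked : ∀ {e} → e < s₂ 0 0 → Block.Marked s₂ (s₂ 24 0) e (s₃ 18 e)) where

      keeps₂ : Keeps kept s s₂
      keeps₂ = keeps-trans {kept} {s} {s₁} {s₂} (keeps-frame kept (writes CountW.count) refl fr₁)
        (keeps-frame kept (writes Block.clear) refl fr₂)
      keeps₃ : Keeps kept s s₃
      keeps₃ = keeps-trans {kept} {s} {s₂} {s₃} keeps₂ (keeps-frame kept (writes Block.mark) refl fr₃)
      n₃ : s₃ 0 0 ≡ n
      n₃ = trans (keeps₃ 0 refl 0) n-eq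
      tst = First.tst s₃
      ky = First.ky s₃
      M = chosen {n} s
      st = stage {n} s

      count-eq : ∀ p → s₂ 17 (I.code workers p) ≡ Fam.on workers M p
      count-eq p = trans (fr₂ 17 refl _) (trans (cong (s₁ 17) (sym (grp-eq p)))
        (trans (counted (<-≤-trans (toℕ<n p) (≤-reflexive (sym N-eq))))
          (trans (cong (CountW.tally s (s 24 0)) (grp-eq p)) (tally-on repW p))))
      full-eq : ∀ p → Block.Full s₂ (toℕ p) ≡ (I.quota workers p ≤ Fam.on workers M p)
      full-eq p = cong₂ _≤_
        (trans (keeps₂ 11 refl _) (trans (cong (s 11) grp₂) (quo-eq p)))
        (trans (cong (s₂ 17) grp₂) (count-eq p))
        where
        grp₂ : s₂ 15 (toℕ p) ≡ I.code workers p
        grp₂ = trans (keeps₂ 15 refl _) (grp-eq p)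
      bound₂ : ∀ e → toℕ {n} e < s₂ 0 0
      bound₂ e = <-≤-trans (toℕ<n e) (≤-reflexive (sym (trans (keeps₂ 0 refl 0) n-eq)))
      N₂ : s₂ 24 0 ≡ I.entries workers
      N₂ = trans (keeps₂ 24 refl 0) N-eq

      -- Marks of `e` come only from entries whose element is `e`. The set of any `p` containing `e`
      -- has such an entry, with the same count and quota because it has the same code.
      unmarked⇒open : ∀ e → s₃ 18 (toℕ e) ≡ 0 → Fam.Open workers M e
      unmarked⇒open e z p e∈p with marked (bound₂ e)
      ... | inj₂ (nz , _) = contradiction z nz
      ... | inj₁ (_ , none) with I.complete workers p e e∈p
      ...   | p′ , code≡ , el≡ = subst₂ _<_ on≡ quota≡ (≰⇒> λ le → none
          (<-≤-trans (toℕ<n p′) (≤-reflexive (sym N₂)))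
          (trans (keeps₂ 9 refl _) (trans (el-eq p′) (cong toℕ el≡)))
          (subst (λ X → X) (sym (full-eq p′)) le))
        where
        on≡ : Fam.on workers M p′ ≡ Fam.on workers M p
        on≡ = trans (sym (count-eq p′)) (trans (cong (s₂ 17) code≡) (count-eq p))
        quota≡ : I.quota workers p′ ≡ I.quota workers p
        quota≡ = trans (sym (quo-eq p′)) (trans (cong (s 11) code≡) (quo-eq p))
      open⇒unmarked : ∀ e → Fam.Open workers M e → s₃ 18 (toℕ e) ≡ 0
      open⇒unmarked e open-e with marked (bound₂ e)
      ... | inj₁ (z , _) = z
      ... | inj₂ (_ , p , p<N , el≡ , f) = contradiction (open-e r e∈r) (≤⇒≯ (subst (λ X → X) (full-eq r) (subst (Block.Full s₂) (sym toℕ-r) f)))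
        where
        r : Fin (I.entries workers)
        r = fromℕ< (<-≤-trans p<N (≤-reflexive N₂))
        toℕ-r : toℕ r ≡ p
        toℕ-r = toℕ-fromℕ< _
        el-r : I.el workers r ≡ e
        el-r = toℕ-injective (trans (sym (el-eq r)) (trans (cong (s 9) toℕ-r) (trans (sym (keeps₂ 9 refl p)) el≡)))
        e∈r : L workers r e ≡ true
        e∈r = subst (λ x → L workers r x ≡ true) el-r (I.sound workers r)

      test⇒candidate : ∀ e → tst (toℕ e) ≢ 0 → Candidate M st e
      test⇒candidate e h = cong nonzero (trans (sym (keeps₃ 13 refl _)) (m+n≡0⇒m≡0 _ (m+n≡0⇒m≡0 _ zero′)))
        , m∸n≡0⇒m≤n (trans (cong (_∸ 2) (sym (keeps₃ 14 refl _))) (m+n≡0⇒n≡0 _ zero′))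
        , unmarked⇒open e (m+n≡0⇒n≡0 (s₃ 13 (toℕ e)) (m+n≡0⇒m≡0 _ zero′))
        where
        zero′ : s₃ 13 (toℕ e) + s₃ 18 (toℕ e) + (s₃ 14 (toℕ e) ∸ 2) ≡ 0
        zero′ = 1∸≢0 h
      candidate⇒test : ∀ e → Candidate M st e → tst (toℕ e) ≢ 0
      candidate⇒test e (e∉M , st≤2 , o) h = 1∸≡0 h (cong₂ _+_ (cong₂ _+_
          (trans (keeps₃ 13 refl _) (not-nonzero e∉M)) (open⇒unmarked e o))
          (trans (cong (_∸ 2) (keeps₃ 14 refl _)) (m≤n⇒m∸n≡0 st≤2)))
        where
        not-nonzero : ∀ {m} → nonzero m ≡ false → m ≡ 0
        not-nonzero {zero} _ = refl
      ky-eq : ∀ e → st e ≤ 2 → ky (toℕ e) ≡ key workers e (st e)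
      ky-eq e st≤2 = cong₂ _+_ (cong₂ _+_ pos₃ pos₃)
        (trans (cong (s₃ 19) (keeps₃ 14 refl _)) (trans (keeps₃ 19 refl _) (tabW st≤2)))
        where
        pos₃ : s₃ 3 (toℕ e) ≡ pos workers e
        pos₃ = trans (keeps₃ 3 refl _) (posW e)
      as-fin : ∀ {j} → j < s₃ 0 0 → ∃[ e ] (toℕ {n} e ≡ j)
      as-fin j<n = fromℕ< (<-≤-trans j<n (≤-reflexive n₃)) , toℕ-fromℕ< _
      bound : ∀ {j} → j < s₃ 0 0 → tst j ≢ 0 → ky j < eval (big ⊕ lit 1) s₃
      bound j<n h with as-fin j<n
      ... | e , refl = begin-strict
        ky (toℕ e)                     ≡⟨ ky-eq e (proj₁ (proj₂ (test⇒candidate e h))) ⟩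
        key workers e (st e)           ≤⟨ key≤big workers e (st e) ⟩
        (n + n) + (n + n) + 1          <⟨ m<m+n _ (s≤s z≤n) ⟩
        (n + n) + (n + n) + 1 + 1      ≡⟨ cong (λ m → (m + m) + (m + m) + 1 + 1) n₃ ⟨
        eval (big ⊕ lit 1) s₃          ∎
        where open ≤-Reasoning
      selected : ∀ {s′ : Store} → First.Least s₃ (s₃ 0 0) (s′ 22 0) (s′ 23 0) → Selected s (s′ 22 0)
      selected (inj₁ (b≡ , none)) = inj₁ (trans b≡ n₃ , λ e cand → candidate⇒test e cand
        (none (<-≤-trans (toℕ<n e) (≤-reflexive (sym n₃)))))
      selected {s′} (inj₂ (b<n , t , _ , min , first)) with as-fin b<n
      ... | e , eq = inj₂ (e , sym eq , cand-e , least)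
        where
        cand-e : Candidate M st e
        cand-e = test⇒candidate e (subst (λ j → tst j ≢ 0) (sym eq) t)
        least : ∀ e′ → Candidate M st e′ → priority st e ≤ priority st e′
        -- A candidate of smaller index has a strictly larger key; any other has at least the same
        -- key and at least the same index.
        least e′ cand with toℕ e′ <? s′ 22 0
        ... | yes e′<b = <⇒≤ (lexicographic-< e e′ (subst₂ _<_
            (trans (cong ky (sym eq)) (ky-eq e (proj₁ (proj₂ cand-e)))) (ky-eq e′ (proj₁ (proj₂ cand)))
            (first e′<b (candidate⇒test e′ cand))))
        ... | no e′≮b = +-mono-≤ (*-monoˡ-≤ n (subst₂ _≤_
            (trans (cong ky (sym eq)) (ky-eq e (proj₁ (proj₂ cand-e)))) (ky-eq e′ (proj₁ (proj₂ cand)))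
            (min (<-≤-trans (toℕ<n e′) (≤-reflexive (sym n₃))) (candidate⇒test e′ cand))))
          (≤-trans (≤-reflexive eq) (≮⇒≥ e′≮b))

  module Place (s : Store) (inp : Input s) (e : Fin n) (best : s 22 0 ≡ toℕ e)
    (e∉M : chosen {n} s e ≡ false) (st≤2 : stage {n} s e ≤ 2)
    (members≤2 : ∀ {m} → chosen {n} s m ≡ true → stage {n} s m ≤ 2) where

    open Input inp
    open Represents repF

    M = chosen {n} s
    st = stage {n} s

    s₁ : Store
    s₁ = s [ 27 , 0 ↦ s 22 0 ]

    keeps₁ : Keeps kept s s₁
    keeps₁ = keeps-frame kept (writes (27 at lit 0 ≔ (22 at lit 0))) refl (frame {27 at lit 0 ≔ (22 at lit 0)} {s} assign)

    repF₁ : Represents (incs firms) s₁ 10 16 12 8 25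
    repF₁ = Input.repF (Input-keeps (keeps-inputs keeps₁) inp)

    module Counted (s₂ : Store) (fr₂ : ∀ x → writes CountF.count x ≡ false → ∀ i → s₂ x i ≡ s₁ x i)
      (counted : ∀ {p} → p < s₁ 25 0 → s₂ 17 (s₁ 16 p) ≡ CountF.tally s₁ (s₁ 25 0) (s₁ 16 p)) where

      keeps₂ : Keeps kept s s₂
      keeps₂ = keeps-trans {kept} {s} {s₁} {s₂} keeps₁ (keeps-frame kept (writes CountF.count) refl fr₂)
      c₂ : s₂ 27 0 ≡ toℕ e
      c₂ = trans (fr₂ 27 refl 0) best
      N₂ : s₂ 25 0 ≡ I.entries firms
      N₂ = trans (keeps₂ 25 refl 0) N-eq
      tst = Smallest.tst s₂
      ky = Smallest.ky s₂

      count-eq : ∀ p → s₂ 17 (I.code firms p) ≡ Fam.on firms M p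
      count-eq p = trans (cong (s₂ 17) (sym (grp-eq p)))
        (trans (counted (<-≤-trans (toℕ<n p) (≤-reflexive (sym N-eq))))
          (trans (cong (CountF.tally s₁ (s₁ 25 0)) (grp-eq p)) (tally-on repF₁ p)))
      grp₂ : ∀ p → s₂ 16 (toℕ p) ≡ I.code firms p
      grp₂ p = trans (keeps₂ 16 refl _) (grp-eq p)
      quo₂ : ∀ p → s₂ 12 (s₂ 16 (toℕ p)) ≡ I.quota firms p
      quo₂ p = trans (keeps₂ 12 refl _) (trans (cong (s 12) (grp₂ p)) (quo-eq p))
      cnt₂ : ∀ p → s₂ 17 (s₂ 16 (toℕ p)) ≡ Fam.on firms M p
      cnt₂ p = trans (cong (s₂ 17) (grp₂ p)) (count-eq p)
      el₂ : ∀ p → s₂ 10 (toℕ p) ≡ toℕ (I.el firms p)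
      el₂ p = trans (keeps₂ 10 refl _) (el-eq p)
      same-code : ∀ {p p′} → I.code firms p′ ≡ I.code firms p →
        q firms p ≤ Fam.on firms M p → q firms p′ ≤ Fam.on firms M p′
      same-code {p} {p′} c≡ = subst₂ _≤_ (trans (sym (quo-eq p)) (trans (cong (s 12) (sym c≡)) (quo-eq p′)))
        (trans (sym (count-eq p)) (trans (cong (s₂ 17) (sym c≡)) (count-eq p′)))

      test⇒ : ∀ p → tst (toℕ p) ≢ 0 → I.el firms p ≡ e × q firms p ≤ Fam.on firms M p
      test⇒ p h = toℕ-injective (trans (sym (el₂ p)) (trans (∸∸≡0 (s₂ 10 (toℕ p)) (s₂ 27 0) (m+n≡0⇒m≡0 _ z)) c₂))
        , m∸n≡0⇒m≤n (trans (sym (cong₂ _∸_ (quo₂ p) (cnt₂ p))) (m+n≡0⇒n≡0 _ z))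
        where
        z : (s₂ 10 (toℕ p) ∸ s₂ 27 0) + (s₂ 27 0 ∸ s₂ 10 (toℕ p))
          + (s₂ 12 (s₂ 16 (toℕ p)) ∸ s₂ 17 (s₂ 16 (toℕ p))) ≡ 0
        z = 1∸≢0 h
      ⇒test : ∀ p → I.el firms p ≡ e → q firms p ≤ Fam.on firms M p → tst (toℕ p) ≢ 0
      ⇒test p el≡ le h = 1∸≡0 h (cong₂ _+_
        (∸∸≡0⁻ {s₂ 10 (toℕ p)} {s₂ 27 0} (trans (el₂ p) (trans (cong toℕ el≡) (sym c₂))))
        (trans (cong₂ _∸_ (quo₂ p) (cnt₂ p)) (m≤n⇒m∸n≡0 le)))
      ky-eq : ∀ p → ky (toℕ p) ≡ # (L firms p)
      ky-eq p = trans (cong₂ _∸_ (trans (keeps₂ 8 refl _) (cong (λ g → s 8 (g + 1)) (grp₂ p)))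
        (trans (keeps₂ 8 refl _) (cong (s 8) (grp₂ p)))) (set-eq p)
      as-fin : ∀ {j} → j < s₂ 25 0 → ∃[ p ] (toℕ {I.entries firms} p ≡ j)
      as-fin j<N = fromℕ< (<-≤-trans j<N (≤-reflexive N₂)) , toℕ-fromℕ< _
      in-range : ∀ p → toℕ {I.entries firms} p < s₂ 25 0
      in-range p = <-≤-trans (toℕ<n p) (≤-reflexive (sym N₂))
      bound : ∀ {j} → j < s₂ 25 0 → tst j ≢ 0 → ky j < eval (nE ⊕ lit 1) s₂
      bound j<N _ with as-fin j<N
      ... | p , refl = ≤-<-trans (≤-trans (≤-reflexive (ky-eq p)) (#≤n (L firms p)))
        (<-≤-trans (m<m+n n (s≤s z≤n)) (≤-reflexive (cong (_+ 1) (sym (trans (keeps₂ 0 refl 0) n-eq)))))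

      Found : ℕ → Set
      Found b = (b ≡ I.entries firms × Fam.Open firms M e)
        ⊎ (b < I.entries firms × ∃[ p ] (toℕ p ≡ b × Fam.MinTight firms M e p))

      found : ∀ {b k} → Smallest.Least s₂ (s₂ 25 0) b k → Found b
      found (inj₁ (b≡ , none)) = inj₁ (trans b≡ N₂ , λ p e∈p → ≰⇒> λ le → refute p e∈p le)
        where
        refute : ∀ p → L firms p e ≡ true → q firms p ≤ Fam.on firms M p → ⊥
        refute p e∈p le with I.complete firms p e e∈p
        ... | p′ , code≡ , el≡ = ⇒test p′ el≡ (same-code code≡ le) (none (in-range p′))
      found (inj₂ (b<N , t , _ , min , _)) with as-fin b<N
      ... | p , refl with test⇒ p t
      ...   | el≡ , le = inj₂ (toℕ<n p , p , refl
        , (subst (λ x → L firms p x ≡ true) el≡ (I.sound firms p) , le) , least)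
        where
        least : ∀ p′ → Fam.Tight firms M e p′ → # (L firms p) ≤ # (L firms p′)
        least p′ (e∈p′ , le′) with I.complete firms p′ e e∈p′
        ... | p″ , code≡ , el≡″ = begin
          # (L firms p)   ≡⟨ ky-eq p ⟨
          ky (toℕ p)      ≤⟨ min (in-range p″) (⇒test p″ el≡″ (same-code code≡ le′)) ⟩
          ky (toℕ p″)     ≡⟨ ky-eq p″ ⟩
          # (L firms p″)  ≡⟨ #-cong (I.code-member firms code≡) ⟩
          # (L firms p′)  ∎
          where open ≤-Reasoning

    accepted : ∀ s₃ → Keeps kept s s₃ → s₃ 27 0 ≡ toℕ e → Fam.Open firms M e →
      Update M st e (chosen (s₃ [ 13 , s₃ 27 0 ↦ 1 ])) (stage (s₃ [ 13 , s₃ 27 0 ↦ 1 ]))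
    accepted s₃ k c₃ open-e rewrite c₃ = accept open-e hit miss (λ x → k 14 refl _)
      where
      hit : nonzero (if toℕ e ≡ᵇ toℕ e then 1 else s₃ 13 (toℕ e)) ≡ true
      hit rewrite ≡ᵇ-refl (toℕ e) = refl
      miss : ∀ x → x ≢ e → nonzero (if toℕ e ≡ᵇ toℕ x then 1 else s₃ 13 (toℕ x)) ≡ nonzero (s 13 (toℕ x))
      miss x x≢e rewrite ≢⇒≡ᵇ {toℕ e} {toℕ x} (λ eq → x≢e (sym (toℕ-injective eq))) = cong nonzero (k 13 refl _)

    Loser : Fin (I.entries firms) → Fin n → Set
    Loser p w = (w ≡ e ⊎ (M w ≡ true × L firms p w ≡ true))
      × (∀ {m} → M m ≡ true → L firms p m ≡ true → key firms m (st m) ≤ key firms w (st w))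
      × key firms e (st e) ≤ key firms w (st w)

    replaced : ∀ s₆ {p w} → Keeps kept s s₆ → s₆ 27 0 ≡ toℕ e → s₆ 29 0 ≡ toℕ w →
      Fam.MinTight firms M e p → Loser p w → Update M st e (chosen (run replace s₆)) (stage (run replace s₆))
    replaced s₆ {p} {w} k c₆ l₆ mt (w∈ , worst , e≤w) rewrite c₆ | l₆ =
      reject p w mt w∈ worst e≤w w∉ e∈ others grows same
      where
      after : Fin n → ℕ
      after x = if toℕ w ≡ᵇ toℕ x then 0 else (if toℕ e ≡ᵇ toℕ x then 1 else s₆ 13 (toℕ x))
      w∉ : nonzero (after w) ≡ false
      w∉ rewrite ≡ᵇ-refl (toℕ w) = refl
      e∈ : e ≢ w → nonzero (after e) ≡ true
      e∈ e≢w rewrite ≢⇒≡ᵇ {toℕ w} {toℕ e} (λ eq → e≢w (sym (toℕ-injective eq))) | ≡ᵇ-refl (toℕ e) = refl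
      others : ∀ x → x ≢ e → x ≢ w → nonzero (after x) ≡ M x
      others x x≢e x≢w rewrite ≢⇒≡ᵇ {toℕ w} {toℕ x} (λ eq → x≢w (sym (toℕ-injective eq)))
        | ≢⇒≡ᵇ {toℕ e} {toℕ x} (λ eq → x≢e (sym (toℕ-injective eq))) = cong nonzero (k 13 refl _)
      grows : (if toℕ w ≡ᵇ toℕ w then s₆ 14 (toℕ w) + 1 else s₆ 14 (toℕ w)) ≡ suc (st w)
      grows rewrite ≡ᵇ-refl (toℕ w) = trans (+-comm _ 1) (cong suc (k 14 refl _))
      same : ∀ x → x ≢ w → (if toℕ w ≡ᵇ toℕ x then s₆ 14 (toℕ w) + 1 else s₆ 14 (toℕ x)) ≡ st x
      same x x≢w rewrite ≢⇒≡ᵇ {toℕ w} {toℕ x} (λ eq → x≢w (sym (toℕ-injective eq))) = k 14 refl _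

    module Displaced (s₃ : Store) (keeps₃ : Keeps kept s s₃) (c₃ : s₃ 27 0 ≡ toℕ e)
      (p : Fin (I.entries firms)) (b₃ : s₃ 22 0 ≡ toℕ p) (mt : Fam.MinTight firms M e p) where

      s₄ : Store
      s₄ = s₃ [ 28 , 0 ↦ s₃ 16 (s₃ 22 0) ]
      keeps₄ : Keeps kept s s₄
      keeps₄ = keeps-trans {kept} {s} {s₃} {s₄} keeps₃
        (keeps-frame kept (writes (28 at lit 0 ≔ (16 at (22 at lit 0)))) refl
          (frame {28 at lit 0 ≔ (16 at (22 at lit 0))} {s₃} assign))
      grp₄ : ∀ p → s₄ 16 (toℕ p) ≡ I.code firms p
      grp₄ p = trans (keeps₄ 16 refl _) (grp-eq p)
      el₄ : ∀ p → s₄ 10 (toℕ p) ≡ toℕ (I.el firms p)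
      el₄ p = trans (keeps₄ 10 refl _) (el-eq p)
      target : s₄ 28 0 ≡ I.code firms p
      target = trans (cong (s₃ 16) b₃) (grp₄ p)
      N₄ : s₄ 25 0 ≡ I.entries firms
      N₄ = trans (keeps₄ 25 refl 0) N-eq
      n₄ : s₄ 0 0 ≡ n
      n₄ = trans (keeps₄ 0 refl 0) n-eq
      tst = Worst.tst s₄
      ky = Worst.ky s₄
      B = (n + n) + (n + n) + 1

      chosen-eq : ∀ p → nonzero (s₄ 13 (s₄ 10 (toℕ p))) ≡ M (I.el firms p)
      chosen-eq p = cong nonzero (trans (keeps₄ 13 refl _) (cong (s 13) (el₄ p)))
      test⇒ : ∀ p′ → tst (toℕ p′) ≢ 0 → I.code firms p′ ≡ I.code firms p × M (I.el firms p′) ≡ true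
      test⇒ p′ h = trans (sym (grp₄ p′)) (trans (∸∸≡0 (s₄ 16 (toℕ p′)) (s₄ 28 0) (m+n≡0⇒m≡0 _ z)) target)
        , trans (sym (chosen-eq p′)) (positive (s₄ 13 (s₄ 10 (toℕ p′))) (m+n≡0⇒n≡0 ((s₄ 16 (toℕ p′) ∸ s₄ 28 0) + (s₄ 28 0 ∸ s₄ 16 (toℕ p′))) z))
        where
        z : (s₄ 16 (toℕ p′) ∸ s₄ 28 0) + (s₄ 28 0 ∸ s₄ 16 (toℕ p′)) + (1 ∸ s₄ 13 (s₄ 10 (toℕ p′))) ≡ 0
        z = 1∸≢0 h
        positive : ∀ m → 1 ∸ m ≡ 0 → nonzero m ≡ true
        positive (suc m) _ = refl
      ⇒test : ∀ p′ → I.code firms p′ ≡ I.code firms p → M (I.el firms p′) ≡ true → tst (toℕ p′) ≢ 0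
      ⇒test p′ code≡ m∈M h = 1∸≡0 h (cong₂ _+_
        (∸∸≡0⁻ {s₄ 16 (toℕ p′)} {s₄ 28 0} (trans (grp₄ p′) (trans code≡ (sym target))))
        (positive (s₄ 13 (s₄ 10 (toℕ p′))) (trans (chosen-eq p′) m∈M)))
        where
        positive : ∀ m → nonzero m ≡ true → 1 ∸ m ≡ 0
        positive (suc m) _ = 0∸n≡0 m
      key-val : ∀ {t} → Keeps kept s t → ∀ {k} x → k ≡ toℕ x → st x ≤ 2 →
        t 4 k + t 4 k + t 20 (t 14 k) ≡ key firms x (st x)
      key-val {t} kp x refl x≤2 = cong₂ _+_ (cong₂ _+_ pos₄ pos₄)
        (trans (cong (t 20) (kp 14 refl _)) (trans (kp 20 refl _) (tabF x≤2)))
        where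
        pos₄ : t 4 (toℕ x) ≡ pos firms x
        pos₄ = trans (kp 4 refl _) (posF x)
      ky-eq : ∀ p′ → tst (toℕ p′) ≢ 0 → ky (toℕ p′) ≡ B ∸ key firms (I.el firms p′) (st (I.el firms p′))
      ky-eq p′ h = cong₂ _∸_ (cong (λ m → (m + m) + (m + m) + 1) n₄)
        (key-val keeps₄ (I.el firms p′) (el₄ p′) (members≤2 (proj₂ (test⇒ p′ h))))
      as-fin : ∀ {j} → j < s₄ 25 0 → ∃[ p ] (toℕ {I.entries firms} p ≡ j)
      as-fin j<N = fromℕ< (<-≤-trans j<N (≤-reflexive N₄)) , toℕ-fromℕ< _
      in-range : ∀ p → toℕ {I.entries firms} p < s₄ 25 0
      in-range p = <-≤-trans (toℕ<n p) (≤-reflexive (sym N₄))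
      bound : ∀ {j} → j < s₄ 25 0 → tst j ≢ 0 → ky j < eval (big ⊕ lit 1) s₄
      bound {j} _ _ = ≤-<-trans (m∸n≤m (eval big s₄) (eval (keyExp 4 20 (10 at ix)) (s₄ [ 21 , 0 ↦ j ]))) (m<m+n _ (s≤s z≤n))

      member⇒entry : ∀ {m} → M m ≡ true → L firms p m ≡ true →
        ∃[ p′ ] (I.el firms p′ ≡ m × tst (toℕ p′) ≢ 0)
      member⇒entry m∈M m∈p with I.complete firms p _ m∈p
      ... | p′ , code≡ , refl = p′ , refl , ⇒test p′ code≡ m∈M

      runs-compare : ∀ s₅ → Keeps kept s s₅ → s₅ 27 0 ≡ toℕ e → Worst.Least s₄ (s₄ 25 0) (s₅ 22 0) (s₅ 23 0) →
        Runs compare s₅ (maxCost compare) (λ s₆ → ∃[ w ] (s₆ 29 0 ≡ toℕ w × Loser p w))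
      runs-compare s₅ keeps₅ c₅ least = runs-loopFree compare refl (go least)
        where
        s₅′ = s₅ [ 29 , 0 ↦ s₅ 27 0 ]
        Goal : Store → Set
        Goal s₆ = ∃[ w ] (s₆ 29 0 ≡ toℕ w × Loser p w)
        kv = key-val keeps₅
        go : Worst.Least s₄ (s₄ 25 0) (s₅ 22 0) (s₅ 23 0) → Goal (run compare s₅)
        -- No chosen contract lies in the tight set `p`, so its quota is 0 and the proposal itself
        -- is rejected.
        go (inj₁ (b≡ , none)) = branch-elim Goal (s₅ 25 0 ∸ s₅ 22 0)
          (λ h → contradiction (trans (cong₂ _∸_ (trans (keeps₅ 25 refl 0) N-eq) (trans b≡ N₄)) (n∸n≡0 (I.entries firms))) h)
          (λ _ → e , c₅ , inj₁ refl , (λ m∈M m∈p → empty (member⇒entry m∈M m∈p)) , ≤-refl)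
          where
          empty : ∀ {m} {A : Set} → ∃[ p′ ] (I.el firms p′ ≡ m × tst (toℕ p′) ≢ 0) → A
          empty (p′ , _ , t) = contradiction (none (in-range p′)) t
        go (inj₂ (b<N , t , _ , min , _)) with as-fin b<N
        ... | p₁ , b≡ = branch-elim Goal (s₅ 25 0 ∸ s₅ 22 0) (λ _ → inner)
          (λ h → contradiction (m∸n≡0⇒m≤n h) (<⇒≱ (<-≤-trans b<N (≤-reflexive (trans N₄ (sym (trans (keeps₅ 25 refl 0) N-eq)))))))
          where
          m₁ = I.el firms p₁
          t₁ : tst (toℕ p₁) ≢ 0
          t₁ = subst (λ j → tst j ≢ 0) (sym b≡) t
          m₁∈M : M m₁ ≡ true
          m₁∈M = proj₂ (test⇒ p₁ t₁)
          m₁∈p : L firms p m₁ ≡ true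
          m₁∈p = trans (sym (I.code-member firms (proj₁ (test⇒ p₁ t₁)) m₁)) (I.sound firms p₁)
          max : ∀ {m} → M m ≡ true → L firms p m ≡ true → key firms m (st m) ≤ key firms m₁ (st m₁)
          max m∈M m∈p with member⇒entry m∈M m∈p
          ... | p₂ , refl , t₂ = ∸-cancelʳ-≤ (key≤big firms _ _) (subst₂ _≤_
            (trans (cong ky (sym b≡)) (ky-eq p₁ t₁)) (ky-eq p₂ t₂) (min (in-range p₂) t₂))
          el₅ : s₅ 10 (s₅ 22 0) ≡ toℕ m₁
          el₅ = trans (keeps₅ 10 refl _) (trans (cong (s 10) (sym b≡)) (el-eq p₁))
          key₁ : eval (keyExp 4 20 (10 at (22 at lit 0))) s₅′ ≡ key firms m₁ (st m₁)
          key₁ = kv m₁ el₅ (members≤2 m₁∈M)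
          key-e : eval (keyExp 4 20 c) s₅′ ≡ key firms e (st e)
          key-e = kv e c₅ st≤2
          d = eval (keyExp 4 20 (10 at (22 at lit 0))) s₅′ ∸ eval (keyExp 4 20 c) s₅′
          inner : Goal (branch d (s₅′ [ 29 , 0 ↦ s₅ 10 (s₅ 22 0) ]) s₅′)
          inner = branch-elim Goal d
            (λ h → m₁ , el₅ , inj₂ (m₁∈M , m₁∈p) , max , ≮⇒≥ λ lt → h (trans (cong₂ _∸_ key₁ key-e) (m≤n⇒m∸n≡0 (<⇒≤ lt))))
            (λ z → let m₁≤e = m∸n≡0⇒m≤n (trans (sym (cong₂ _∸_ key₁ key-e)) z) in
              e , c₅ , inj₁ refl , (λ m∈M m∈p → ≤-trans (max m∈M m∈p) m₁≤e) , ≤-refl)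

      runs-displace : Runs displace s₃ (displace-time (I.entries workers) (I.entries firms) n) (λ s′ → Update M st e (chosen s′) (stage s′))
      runs-displace = runs-assign (runs-⨾ (runs-time (cong Worst.cost-argmin N₄)
          (Worst.runs-argmin s₄ refl refl refl refl bound)) λ s₅ fr₅ least →
        let keeps₅ = keeps-trans {kept} {s} {s₄} {s₅} keeps₄ (keeps-frame kept (writes Worst.search) refl fr₅)
            c₅ = trans (fr₅ 27 refl 0) c₃
        in runs-⨾ (runs-compare s₅ keeps₅ c₅ least) λ { s₆ fr₆ (w , l₆ , loser) →
          runs-loopFree replace refl (replaced s₆
            (keeps-trans {kept} {s} {s₅} {s₆} keeps₅ (keeps-frame kept (writes compare) refl fr₆))
            (trans (fr₆ 27 refl 0) c₅) l₆ mt loser) })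

    runs-place : Runs place s (place-time (I.entries workers) (I.entries firms) n) (λ s′ → Update M st e (chosen s′) (stage s′))
    runs-place = runs-assign (runs-⨾ (runs-time (cong CountF.cost-count N-eq)
        (CountF.runs-count refl refl refl refl refl refl s₁)) λ s₂ fr₂ counted →
      let open Counted s₂ fr₂ counted in
      runs-⨾ (runs-time (cong Smallest.cost-argmin N₂) (Smallest.runs-argmin s₂ refl refl refl refl bound)) λ s₃ fr₃ least →
      let keeps₃ = keeps-trans {kept} {s} {s₂} {s₃} keeps₂ (keeps-frame kept (writes Smallest.search) refl fr₃)
          c₃ = trans (fr₃ 27 refl 0) c₂
          N₃ = trans (keeps₃ 25 refl 0) N-eq
      in case found least of λ
        { (inj₁ (b≡ , open-e)) → runs-if {T = displace-time (I.entries workers) (I.entries firms) n} {maxCost (13 at c ≔ lit 1)}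
            (λ h → contradiction (trans (cong₂ _∸_ N₃ b≡) (n∸n≡0 (I.entries firms))) h)
            (λ _ → runs-loopFree (13 at c ≔ lit 1) refl (accepted s₃ keeps₃ c₃ open-e))
        ; (inj₂ (b<N , p , b≡ , mt)) → runs-if {T = displace-time (I.entries workers) (I.entries firms) n} {maxCost (13 at c ≔ lit 1)}
            (λ _ → Displaced.runs-displace s₃ keeps₃ c₃ p (sym b≡) mt)
            (λ z → contradiction (m∸n≡0⇒m≤n z) (<⇒≱ (<-≤-trans b<N (≤-reflexive (sym N₃))))) })

-- The main loop

rounds : Exp
rounds = (nE ⊕ nE) ⊕ nE ⊕ lit 1

main : Program
main = For 26 rounds iterate

-- Linear in any common bound of the three sizes; the 1 added to `m` absorbs constants.
Linear : (ℕ → ℕ → ℕ → ℕ) → Set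
Linear f = ∃[ κ ] (∀ {W F n m} → W ≤ m → F ≤ m → n ≤ m → f W F n ≤ κ * suc m)

linear-const : ∀ k → Linear (λ _ _ _ → k)
linear-const k = k , λ {_} {_} {_} {m} _ _ _ → m≤m*n k (suc m)

linear-+ : ∀ {f g} → Linear f → Linear g → Linear (λ W F n → f W F n + g W F n)
linear-+ (κ , f≤) (μ , g≤) = κ + μ , λ {_} {_} {_} {m} w f n →
  ≤-trans (+-mono-≤ (f≤ w f n) (g≤ w f n)) (≤-reflexive (sym (*-distribʳ-+ (suc m) κ μ)))

for-bound : ∀ e {N m} B → N ≤ m → forCost e N B ≤ (B + (cost e + 12)) * suc m
for-bound e {N} {m} B N≤m = begin
  N * (B + a) + a          ≤⟨ +-mono-≤ (*-monoˡ-≤ (B + a) N≤m) (m≤n+m a B) ⟩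
  m * (B + a) + (B + a)    ≡⟨ +-comm (m * (B + a)) (B + a) ⟩
  suc m * (B + a)          ≡⟨ *-comm (suc m) (B + a) ⟩
  (B + a) * suc m          ∎
  where
  open ≤-Reasoning
  a = cost e + 12

linear-W : ∀ e B → Linear (λ W F n → forCost e W B)
linear-W e B = B + (cost e + 12) , λ w f n → for-bound e B w

linear-F : ∀ e B → Linear (λ W F n → forCost e F B)
linear-F e B = B + (cost e + 12) , λ w f n → for-bound e B f

linear-n : ∀ e B → Linear (λ W F n → forCost e n B)
linear-n e B = B + (cost e + 12) , λ w f n → for-bound e B n

linear-countW : Linear (λ W F n → CountW.cost-count W)
linear-countW = linear-+ (linear-W (24 at lit 0) (maxCost CountW.clear-body)) (linear-W (24 at lit 0) (maxCost CountW.count-body))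

linear-countF : Linear (λ W F n → CountF.cost-count F)
linear-countF = linear-+ (linear-F (25 at lit 0) (maxCost CountF.clear-body)) (linear-F (25 at lit 0) (maxCost CountF.count-body))

linear-first : Linear (λ W F n → First.cost-argmin n)
linear-first = linear-+ (linear-const (2 + cost nE))
  (linear-+ (linear-const (2 + cost (big ⊕ lit 1))) (linear-n nE (maxCost First.body)))

linear-smallest : Linear (λ W F n → Smallest.cost-argmin F)
linear-smallest = linear-+ (linear-const (2 + cost (25 at lit 0)))
  (linear-+ (linear-const (2 + cost (nE ⊕ lit 1))) (linear-F (25 at lit 0) (maxCost Smallest.body)))

linear-worst : Linear (λ W F n → Worst.cost-argmin F)
linear-worst = linear-+ (linear-const (2 + cost (25 at lit 0)))
  (linear-+ (linear-const (2 + cost (big ⊕ lit 1))) (linear-F (25 at lit 0) (maxCost Worst.body)))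

linear-select : Linear select-time
linear-select = linear-+ linear-countW (linear-+ (linear-n nE (maxCost Block.clear-body))
  (linear-+ (linear-W (24 at lit 0) (maxCost Block.mark-body)) linear-first))

linear-displace : Linear displace-time
linear-displace = linear-+ (linear-const 5) (linear-+ linear-worst (linear-const (maxCost compare + maxCost replace)))

linear-place : Linear place-time
linear-place = linear-+ (linear-const 4) (linear-+ linear-countF (linear-+ linear-smallest
  (linear-+ (linear-const (1 + cost ((25 at lit 0) ⊖ (22 at lit 0))))
    (linear-+ linear-displace (linear-const (maxCost (13 at c ≔ lit 1)))))))

abstract
  -- Abstract, so that its large constant remains a symbol when the total time is bounded.
  linear-iterate : Linear iterate-time
  linear-iterate = linear-+ linear-select (linear-+ (linear-const (1 + cost (nE ⊖ (22 at lit 0))))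
    (linear-+ linear-place (linear-const 1)))

module Main {n} (incs : Side → Incidence n) (pos : Side → Fin n → ℕ) (pos≤n : ∀ σ e → pos σ e ≤ n) where

  open Iteration incs pos pos≤n
  open Market market hiding (pos; pos≤n)

  private
    W = Incidence.entries (incs workers)
    F = Incidence.entries (incs firms)

  -- Either each round so far raised the potential, or no candidate is left and nothing changes any
  -- more. After 3 |E| + 1 rounds the first alternative contradicts the bound on the potential.
  Progress : ℕ → Store → Set
  Progress j s = Input s × Invariant (chosen s) (stage s)
    × (j ≤ potential (chosen s) (stage s) ⊎ (∀ e → ¬ Candidate (chosen s) (stage s) e))

  progress-step : ∀ {j} s → Progress j s → Runs iterate s (iterate-time W F n) (Progress (suc j))
  progress-step {j} s (inp , inv , prog) = runs-⨾ (runs-select s inp) λ s₁ fr sel →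
    let keeps = keeps-frame kept (writes select) refl fr
        inp₁ = Input-keeps (keeps-inputs keeps) inp
        M≡ = λ e → cong nonzero (sym (keeps 13 refl (toℕ e)))
        st≡ = λ e → sym (keeps 14 refl (toℕ e))
        inv₁ = Invariant-cong M≡ st≡ inv
    in go s₁ inp₁ M≡ st≡ inv₁ sel
    where
    go : ∀ s₁ → Input s₁ → (∀ e → chosen {n} s e ≡ chosen s₁ e) → (∀ e → stage {n} s e ≡ stage s₁ e) →
      Invariant (chosen s₁) (stage s₁) → Selected s (s₁ 22 0) →
      Runs (If (nE ⊖ (22 at lit 0)) place skip) s₁ (1 + cost (nE ⊖ (22 at lit 0)) + (place-time W F n + 1)) (Progress (suc j))
    go s₁ inp₁ M≡ st≡ inv₁ (inj₁ (b≡ , none)) = runs-if {T = place-time W F n} {1}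
      (λ h → contradiction (trans (cong₂ _∸_ (Input.n-eq inp₁) b≡) (n∸n≡0 n)) h)
      (λ _ → runs-loopFree skip refl (inp₁ , inv₁ , inj₂ λ e cand →
        none e (Candidate-cong (sym ∘ M≡) (sym ∘ st≡) cand)))
    go s₁ inp₁ M≡ st≡ inv₁ (inj₂ (e , b≡ , cand , first)) = runs-if {T = place-time W F n} {1}
      (λ _ → placed)
      (λ z → contradiction (m∸n≡0⇒m≤n z) (<⇒≱ (subst₂ _<_ (sym b≡) (sym (Input.n-eq inp₁)) (toℕ<n e))))
      where
      cand₁ = Candidate-cong M≡ st≡ cand
      first₁ : ∀ e′ → Candidate (chosen s₁) (stage s₁) e′ → priority (stage s₁) e ≤ priority (stage s₁) e′
      first₁ e′ cand′ = subst₂ _≤_ (cong (λ t → key workers e t * n + toℕ e) (st≡ e)) (cong (λ t → key workers e′ t * n + toℕ e′) (st≡ e′))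
        (first e′ (Candidate-cong (sym ∘ M≡) (sym ∘ st≡) cand′))
      placed : Runs place s₁ (place-time W F n) (Progress (suc j))
      placed = runs-weaken ≤-refl
        (λ { {s₂} (fr , upd) → Input-keeps (keeps-frame inputs (writes place) refl fr) inp₁
           , advance s₂ upd })
        (runs-frame (Place.runs-place s₁ inp₁ e b≡ (proj₁ cand₁) (proj₁ (proj₂ cand₁)) (invariant⇒stage≤2 inv₁)))
        where
        advance : ∀ s₂ → Update (chosen s₁) (stage s₁) e (chosen s₂) (stage s₂) →
          Invariant (chosen s₂) (stage s₂)
          × (suc j ≤ potential (chosen s₂) (stage s₂) ⊎ (∀ e → ¬ Candidate (chosen s₂) (stage s₂) e))
        advance s₂ upd with step inv₁ cand₁ first₁ upd
        ... | inv₂ , pot = inv₂ , inj₁ (≤-trans (s≤s (j≤ prog)) (≤-reflexive (sym pot)))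
          where
          potential-≡ : potential (chosen s) (stage s) ≡ potential (chosen s₁) (stage s₁)
          potential-≡ = sum-cong-≗ λ x → cong₂ (λ t b → t + ⟦ b ⟧ᵇ) (st≡ x) (M≡ x)
          j≤ : j ≤ potential (chosen s) (stage s) ⊎ (∀ e → ¬ Candidate (chosen s) (stage s) e) → j ≤ potential (chosen s₁) (stage s₁)
          j≤ (inj₁ le)   = ≤-trans le (≤-reflexive potential-≡)
          j≤ (inj₂ none) = contradiction cand (none e)

  main-time : ℕ
  main-time = forCost rounds (n + n + n + 1) (iterate-time W F n)

  runs-main : ∀ s → Input s → (∀ i → s 13 i ≡ 0) → (∀ i → s 14 i ≡ 0) →
    Runs main s main-time (λ s′ → Kernel (chosen s′) (stage s′))
  runs-main s inp zeros₁ zeros₂ = runs-time (cong (λ N → forCost rounds N (iterate-time W F n)) N-eq)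
    (runs-weaken ≤-refl finish (runs-for (iterate-time W F n) Progress refl refl start
      λ j s′ j<N agree prog → runs-weaken ≤-refl (next j) (progress-step s′ prog)))
    where
    N-eq : eval rounds s ≡ n + n + n + 1
    N-eq = cong (λ m → m + m + m + 1) (Input.n-eq inp)
    tick : ∀ s v → Keeps inputs s (s [ 26 , 0 ↦ v ])
    tick s v x x∈ i with 26 ≡ᵇ x in eq
    ... | false = refl
    ... | true rewrite sym (≡ᵇ⇒≡′ {26} {x} eq) = case x∈ of λ ()
    start : Progress 0 (s [ 26 , 0 ↦ 0 ])
    start = Input-keeps (tick s 0) inp
      , initial (λ e → cong nonzero (zeros₁ (toℕ e))) (λ e → zeros₂ (toℕ e)) , inj₁ z≤n
    next : ∀ j {s′} → Progress (suc j) s′ → Progress (suc j) (s′ [ 26 , 0 ↦ suc j ])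
    next j {s′} (inp , inv , prog) = Input-keeps (tick s′ (suc j)) inp , inv , prog
    finish : ∀ {s′} → Progress (eval rounds s) s′ → Kernel (chosen s′) (stage s′)
    finish {s′} (_ , inv , inj₂ none) = invariant⇒kernel inv none
    finish {s′} (_ , inv , inj₁ le) = contradiction (≤-trans le (potential≤ inv)) (<⇒≱ (begin-strict
      3 * n            ≡⟨ cong (n +_) (cong (n +_) (+-identityʳ n)) ⟩
      n + (n + n)      ≡⟨ +-assoc n n n ⟨
      n + n + n        <⟨ m<m+n _ (s≤s z≤n) ⟩
      n + n + n + 1    ≡⟨ N-eq ⟨
      eval rounds s    ∎))
      where open ≤-Reasoning

-- Reading the input

-- A relation rather than an indexing function: positions computed from offsets remain plain
-- numbers, and validity of a position is part of the evidence.
data At {A : Set} : List A → ℕ → A → Set where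
  here  : ∀ {x xs} → At (x ∷ xs) 0 x
  there : ∀ {x y xs i} → At xs i x → At (y ∷ xs) (suc i) x

module _ {A : Set} where

  At-functional : ∀ {xs : List A} {i x y} → At xs i x → At xs i y → x ≡ y
  At-functional here here = refl
  At-functional (there p) (there q) = At-functional p q

  At-< : ∀ {xs : List A} {i x} → At xs i x → i < length xs
  At-< here = s≤s z≤n
  At-< (there p) = s≤s (At-< p)

  At-total : ∀ (xs : List A) {i} → i < length xs → ∃[ x ] At xs i x
  At-total (x ∷ xs) {zero}  _ = x , here
  At-total (x ∷ xs) {suc i} (s≤s i<) = let (y , p) = At-total xs i< in y , there p

  At-++ˡ : ∀ {xs ys : List A} {i x} → At xs i x → At (xs ++ ys) i x
  At-++ˡ here = here
  At-++ˡ (there p) = there (At-++ˡ p)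

  At-++ʳ : ∀ (xs : List A) {ys i x} → At ys i x → At (xs ++ ys) (length xs + i) x
  At-++ʳ []       p = p
  At-++ʳ (_ ∷ xs) p = there (At-++ʳ xs p)

  At⇒∈ : ∀ {xs : List A} {i x} → At xs i x → x Mem.∈ xs
  At⇒∈ here = here refl
  At⇒∈ (there p) = there (At⇒∈ p)

  ∈⇒At : ∀ {xs : List A} {x} → x Mem.∈ xs → ∃[ i ] At xs i x
  ∈⇒At (here refl) = 0 , here
  ∈⇒At (there p) = let (i , q) = ∈⇒At p in suc i , there q

  At-unique : ∀ {xs : List A} {i j x} → Unique xs → At xs i x → At xs j x → i ≡ j
  At-unique u here here = refl
  At-unique (x∉ AllPairs.∷ u) here (there q) = contradiction refl (All.lookup x∉ (At⇒∈ q))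
  At-unique (x∉ AllPairs.∷ u) (there p) here = contradiction refl (All.lookup x∉ (At⇒∈ p))
  At-unique (_ AllPairs.∷ u) (there p) (there q) = cong suc (At-unique u p q)

  begins : List (List A) → ℕ → ℕ
  begins xss g = length (concat (take g xss))

  begins-suc : ∀ {xss : List (List A)} {g xs} → At xss g xs → begins xss (suc g) ≡ begins xss g + length xs
  begins-suc {xs ∷ _} here = trans (length-++ xs) (+-identityʳ _)
  begins-suc {ys ∷ xss} {suc g} {xs} (there p) = begin
    length (ys ++ concat (take (suc g) xss))  ≡⟨ length-++ ys ⟩
    length ys + begins xss (suc g)             ≡⟨ cong (length ys +_) (begins-suc p) ⟩
    length ys + (begins xss g + length xs)     ≡⟨ +-assoc (length ys) _ _ ⟨
    length ys + begins xss g + length xs       ≡⟨ cong (_+ length xs) (length-++ ys) ⟨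
    length (ys ++ concat (take g xss)) + length xs ∎
    where open ≡-Reasoning

  begins-step : ∀ (xss : List (List A)) g → begins xss g ≤ begins xss (suc g)
  begins-step []         zero    = ≤-refl
  begins-step []         (suc g) = ≤-refl
  begins-step (xs ∷ xss) zero    = z≤n
  begins-step (xs ∷ xss) (suc g) = begin
    length (xs ++ concat (take g xss))        ≡⟨ length-++ xs ⟩
    length xs + begins xss g                   ≤⟨ +-monoʳ-≤ (length xs) (begins-step xss g) ⟩
    length xs + begins xss (suc g)             ≡⟨ length-++ xs ⟨
    length (xs ++ concat (take (suc g) xss))  ∎
    where open ≤-Reasoning

  begins-mono : ∀ (xss : List (List A)) {g h} → g ≤ h → begins xss g ≤ begins xss h
  begins-mono xss {g} {zero} z≤n = ≤-refl
  begins-mono xss {g} {suc h} g≤h with g ≟ suc h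
  ... | yes refl = ≤-refl
  ... | no g≢h   = ≤-trans (begins-mono xss (≤-pred (≤∧≢⇒< g≤h g≢h))) (begins-step xss h)

  begins-length : ∀ (xss : List (List A)) → begins xss (length xss) ≡ length (concat xss)
  begins-length [] = refl
  begins-length (xs ∷ xss) = trans (length-++ xs) (trans (cong (length xs +_) (begins-length xss)) (sym (length-++ xs)))

  -- The strict upper bounds exclude empty blocks, so monotonicity leaves one block for each
  -- position.
  begins-unique : ∀ (xss : List (List A)) {p g h} → begins xss g ≤ p → p < begins xss (suc g) →
    begins xss h ≤ p → p < begins xss (suc h) → g ≡ h
  begins-unique xss {p} {g} {h} g≤ <g h≤ <h = ≤-antisym
    (≮⇒≥ λ h<g → <⇒≱ <h (≤-trans (begins-mono xss h<g) g≤))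
    (≮⇒≥ λ g<h → <⇒≱ <g (≤-trans (begins-mono xss g<h) h≤))

  At-concat : ∀ {xss : List (List A)} {g xs j x} → At xss g xs → At xs j x → At (concat xss) (begins xss g + j) x
  At-concat here q = At-++ˡ q
  At-concat {ys ∷ xss} {suc g} {j = j} {x} (there p) q = subst (λ k → At (ys ++ concat xss) k x)
    (trans (sym (+-assoc (length ys) _ _)) (cong (_+ j) (sym (length-++ ys)))) (At-++ʳ ys (At-concat p q))

  At-concat⁻ : ∀ (xss : List (List A)) {p x} → At (concat xss) p x →
    ∃[ g ] ∃[ xs ] ∃[ j ] (At xss g xs × At xs j x × p ≡ begins xss g + j)
  At-concat⁻ ([] ∷ xss) q with At-concat⁻ xss q
  ... | g , xs , j , ag , aj , eq = suc g , xs , j , there ag , aj , eq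
  At-concat⁻ ((y ∷ ys) ∷ xss) here = 0 , y ∷ ys , 0 , here , here , refl
  At-concat⁻ ((y ∷ ys) ∷ xss) (there q) with At-concat⁻ (ys ∷ xss) q
  ... | zero , _ , j , here , aj , refl = 0 , y ∷ ys , suc j , here , there aj , refl
  ... | suc g , xs , j , there ag , aj , refl = suc g , xs , j , there ag , aj , refl

  array-offsets : ∀ k (xss : List (List A)) {g} → g ≤ length xss →
    array (scanl (λ n xs → n + length xs) k xss) g ≡ k + begins xss g
  array-offsets k []         {zero}  _ = sym (+-identityʳ k)
  array-offsets k (xs ∷ xss) {zero}  _ = sym (+-identityʳ k)
  array-offsets k (xs ∷ xss) {suc g} (s≤s g≤) = begin
    array (scanl _ (k + length xs) xss) g  ≡⟨ array-offsets (k + length xs) xss g≤ ⟩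
    k + length xs + begins xss g            ≡⟨ +-assoc k _ _ ⟩
    k + (length xs + begins xss g)          ≡⟨ cong (k +_) (length-++ xs) ⟨
    k + begins (xs ∷ xss) (suc g)           ∎
    where open ≡-Reasoning

At-array : ∀ {xs : List ℕ} {i x} → At xs i x → array xs i ≡ x
At-array here = refl
At-array (there p) = At-array p

At-map : ∀ {A B : Set} (f : A → B) {xs i x} → At xs i x → At (map f xs) i (f x)
At-map f here = here
At-map f (there p) = there (At-map f p)

At-map⁻ : ∀ {A B : Set} (f : A → B) xs {i y} → At (map f xs) i y → ∃[ x ] (At xs i x × y ≡ f x)
At-map⁻ f (x ∷ xs) here = x , here , refl
At-map⁻ f (x ∷ xs) (there p) = let (z , q , eq) = At-map⁻ f xs p in z , there q , eq

At-tabulate : ∀ {A : Set} {n} (f : Fin n → A) i → At (tabulate f) (toℕ i) (f i)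
At-tabulate f zero    = here
At-tabulate f (suc i) = there (At-tabulate (f ∘ suc) i)

At-tabulate⁻ : ∀ {A : Set} {n} (f : Fin n → A) {i x} → At (tabulate f) i x → ∃[ k ] (toℕ k ≡ i × x ≡ f k)
At-tabulate⁻ {n = suc n} f here = zero , refl , refl
At-tabulate⁻ {n = suc n} f (there p) with At-tabulate⁻ (f ∘ suc) p
... | k , refl , eq = suc k , refl , eq

At-allFin : ∀ {n} (i : Fin n) → At (allFin n) (toℕ i) i
At-allFin = At-tabulate (λ i → i)

At-allFin⁻ : ∀ {n i} {x : Fin n} → At (allFin n) i x → toℕ x ≡ i
At-allFin⁻ p with At-tabulate⁻ (λ i → i) p
... | k , eq , refl = eq

length-filter-tabulate : ∀ {A : Set} {P : A → Set} (P? : Decidable₁ P) {n} (f : Fin n → A) →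
  length (filter P? (tabulate f)) ≡ sum (λ i → ⟦ does (P? (f i)) ⟧ᵇ)
length-filter-tabulate P? {zero} f = refl
length-filter-tabulate P? {suc n} f with does (P? (f zero))
... | true  = cong suc (length-filter-tabulate P? (f ∘ suc))
... | false = length-filter-tabulate P? (f ∘ suc)

∈⇒lookup : ∀ {n} {S : Subset n} {x} → x ∈ S → lookup S x ≡ true
∈⇒lookup = []=⇒lookup

lookup⇒∈ : ∀ {n} {S : Subset n} {x} → lookup S x ≡ true → x ∈ S
lookup⇒∈ {S = S} {x} = lookup⇒[]= x S

length-elements : ∀ {n} (S : Subset n) → length (elements S) ≡ # (lookup S)
length-elements S = trans (length-filter-tabulate (_∈? S) (λ i → i))
  (trans (sum-cong-≗ λ i → cong ⟦_⟧ᵇ (ext-true (does-true (i ∈? S)) (λ h → true-does (i ∈? S) (lookup⇒∈ h)))) (sym (#-sum _)))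
  where
  does-true : ∀ {i} (d : Dec (i ∈ S)) → does d ≡ true → lookup S i ≡ true
  does-true (yes i∈) _ = ∈⇒lookup i∈
  true-does : ∀ {i} (d : Dec (i ∈ S)) → i ∈ S → does d ≡ true
  true-does (yes _) _ = refl
  true-does (no i∉) i∈ = contradiction i∈ i∉

∣∣≡# : ∀ {n} (S : Subset n) → ∣ S ∣ ≡ # (lookup S)
∣∣≡# S = trans (go S) (sym (#-sum _))
  where
  go : ∀ {n} (S : Subset n) → ∣ S ∣ ≡ sum (⟦_⟧ᵇ ∘ lookup S)
  go [] = refl
  go (true ∷ S) = cong suc (go S)
  go (false ∷ S) = go S

elements-Unique : ∀ {n} (S : Subset n) → Unique (elements S)
elements-Unique S = filter⁺ (_∈? S) (allFin⁺ _)

At-elements⁻ : ∀ {n} {S : Subset n} {j e} → At (elements S) j e → e ∈ S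
At-elements⁻ {S = S} p = proj₂ (∈-filter⁻ (_∈? S) {xs = allFin _} (At⇒∈ p))

At-elements : ∀ {n} {S : Subset n} {e} → e ∈ S → ∃[ j ] At (elements S) j e
At-elements {S = S} {e} e∈S = ∈⇒At (∈-filter⁺ (_∈? S) (∈-allFin e) e∈S)

begins-cong : ∀ {A B C : Set} (f : A → List B) (g : A → List C) → (∀ a → length (f a) ≡ length (g a)) →
  ∀ xs k → begins (map f xs) k ≡ begins (map g xs) k
begins-cong f g eq []       zero    = refl
begins-cong f g eq []       (suc k) = refl
begins-cong f g eq (x ∷ xs) zero    = refl
begins-cong f g eq (x ∷ xs) (suc k) = trans (length-++ (f x))
  (trans (cong₂ _+_ (eq x) (begins-cong f g eq xs k)) (sym (length-++ (g x))))

subset-ext : ∀ {n} {S T : Subset n} → (∀ x → lookup S x ≡ lookup T x) → S ≡ T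
subset-ext {S = S} {T} eq = trans (sym (tabulate∘lookup S)) (trans (tabulate-cong eq) (tabulate∘lookup T))

-- The arrays of one side of the market

module Layout (I : Instance) (σ : Side) where

  open Instance I

  fams : List (List (List ℕ))
  fams = families I σ

  sets : List (List ℕ)
  sets = concat fams

  members : List ℕ
  members = memberArray I σ

  OnSide : Agent → Set
  OnSide a = At (agents I σ) (index I a) a

  agents-index : ∀ {w a} → At (agents I σ) w a → w ≡ index I a
  agents-index = go σ
    where
    go : ∀ σ {w a} → At (agents I σ) w a → w ≡ index I a
    go workers p with At-map⁻ inj₁ (allFin #W) p
    ... | x , q , refl = sym (At-allFin⁻ q)
    go firms p with At-map⁻ inj₂ (allFin #F) p
    ... | x , q , refl = sym (At-allFin⁻ q)

  onSide-∂ : ∀ e → OnSide (∂ σ e)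
  onSide-∂ = go σ
    where
    go : ∀ σ e → At (agents I σ) (index I (∂ σ e)) (∂ σ e)
    go workers e = At-map inj₁ (At-allFin (∂W e))
    go firms   e = At-map inj₂ (At-allFin (∂F e))

  ∂-unique : ∀ {a e} → OnSide a → e ∈ E a → a ≡ ∂ σ e
  ∂-unique = go σ
    where
    does⇒≡ : ∀ {k} {x y : Fin k} → does (x ≟ᶠ y) ≡ true → x ≡ y
    does⇒≡ {x = x} {y} h with x ≟ᶠ y
    ... | yes eq = eq
    go : ∀ σ {a e} → At (agents I σ) (index I a) a → e ∈ E a → a ≡ ∂ σ e
    go workers {e = e} p e∈ with At-map⁻ inj₁ (allFin #W) p
    ... | x , _ , refl = cong inj₁ (sym (does⇒≡ (trans (sym (lookup∘tabulate _ e)) (∈⇒lookup e∈))))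
    go firms {e = e} p e∈ with At-map⁻ inj₂ (allFin #F) p
    ... | x , _ , refl = cong inj₂ (sym (does⇒≡ (trans (sym (lookup∘tabulate _ e)) (∈⇒lookup e∈))))

  ∈E-∂ : ∀ e → e ∈ E (∂ σ e)
  ∈E-∂ = go σ
    where
    go : ∀ σ e → e ∈ E (∂ σ e)
    go workers e = lookup⇒∈ (trans (lookup∘tabulate _ e) (does-refl (∂W e)))
    go firms   e = lookup⇒∈ (trans (lookup∘tabulate _ e) (does-refl (∂F e)))

  first : Agent → ℕ
  first a = begins fams (index I a)

  -- The number of the set in the enumeration of all sets of the side; it serves as the code of the
  -- set.
  setIndex : ∀ a → Fin (#ℒ a) → ℕ
  setIndex a i = first a + toℕ i

  At-family : ∀ {a} → OnSide a → At fams (index I a) (family I a)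
  At-family = At-map (family I)

  length-family : ∀ a → length (family I a) ≡ #ℒ a
  length-family a = trans (length-map _ (allFin (#ℒ a))) (length-tabulate (λ (i : Fin (#ℒ a)) → i))

  first-suc : ∀ {a} → OnSide a → begins fams (suc (index I a)) ≡ first a + #ℒ a
  first-suc {a} on = trans (begins-suc (At-family on)) (cong (first a +_) (length-family a))

  At-sets : ∀ {a} → OnSide a → ∀ i → At sets (setIndex a i) (map toℕ (elements (ℒ a i)))
  At-sets on i = At-concat (At-family on) (At-map _ (At-allFin i))

  sets-suc : ∀ {a} → OnSide a → ∀ i → begins sets (suc (setIndex a i)) ≡ begins sets (setIndex a i) + # (lookup (ℒ a i))
  sets-suc {a} on i = trans (begins-suc (At-sets on i))
    (cong (begins sets (setIndex a i) +_) (trans (length-map toℕ (elements (ℒ a i))) (length-elements (ℒ a i))))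

  setIndex-injective : ∀ {a b} → OnSide a → OnSide b → ∀ {i : Fin (#ℒ a)} {j : Fin (#ℒ b)} → setIndex a i ≡ setIndex b j →
    _≡_ {A = ∃[ a ] Fin (#ℒ a)} (a , i) (b , j)
  setIndex-injective {a} {b} on-a on-b {i} {j} eq = same on-a on-b (begins-unique fams (m≤m+n _ _) (below on-a i)
      (≤-trans (m≤m+n _ _) (≤-reflexive (sym eq))) (<-≤-trans (s≤s (≤-reflexive eq)) (below on-b j)))
    where
    below : ∀ {a} → OnSide a → ∀ i → setIndex a i < begins fams (suc (index I a))
    below {a} on i = <-≤-trans (+-monoʳ-< (first a) (toℕ<n i)) (≤-reflexive (sym (first-suc on)))
    same : OnSide a → OnSide b → index I a ≡ index I b → _≡_ {A = ∃[ a ] Fin (#ℒ a)} (a , i) (b , j)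
    same on-a on-b index≡ with At-functional on-a (subst (λ w → At (agents I σ) w b) (sym index≡) on-b)
    ... | refl = cong (a ,_) (toℕ-injective (+-cancelˡ-≡ (first a) _ _ eq))

  record Entry (p : ℕ) : Set where
    constructor mkEntry
    field
      {agent}  : Agent
      onSide   : OnSide agent
      set      : Fin (#ℒ agent)
      {shift}  : ℕ
      {el}     : Contract
      at-el    : At (elements (ℒ agent set)) shift el
      position-eq : p ≡ begins sets (setIndex agent set) + shift
    set-index : ℕ
    set-index = setIndex agent set
    in-set : el ∈ ℒ agent set
    in-set = At-elements⁻ at-el

  entry-at : ∀ {p} (en : Entry p) → At members p (toℕ (Entry.el en))
  entry-at (mkEntry on i at-el refl) = At-concat (At-sets on i) (At-map toℕ at-el)

  entry : ∀ {p} → p < length members → Entry p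
  entry p< with At-total members p<
  ... | v , loc with At-concat⁻ sets loc
  ...   | g , xs , j , at-g , at-j , eq with At-concat⁻ fams at-g
  ...     | w , fs , k , at-w , at-k , eq′ with At-map⁻ (family I) (agents I σ) at-w
  ...       | a , at-a , refl with At-map⁻ _ (allFin (#ℒ a)) at-k
  ...         | i , at-i , refl with At-map⁻ toℕ (elements (ℒ a i)) at-j
  ...           | e , at-e , refl = mkEntry (subst (λ w → At (agents I σ) w a) (agents-index at-a) at-a) i at-e
    (trans eq (cong (λ g → begins sets g + j) (trans eq′ (cong₂ (λ w k → begins fams w + k) (agents-index at-a) (sym (At-allFin⁻ at-i))))))

  entry-of : ∀ {a} → OnSide a → ∀ i {e} → e ∈ ℒ a i → ∃[ p ] Σ[ en ∈ Entry p ]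
    (Entry.el en ≡ e × Entry.set-index en ≡ setIndex a i)
  entry-of on i e∈ with At-elements e∈
  ... | j , loc = _ , mkEntry on i loc refl , refl , refl

  entry-unique : ∀ {p p′} (en : Entry p) (en′ : Entry p′) →
    Entry.set-index en ≡ Entry.set-index en′ → Entry.el en ≡ Entry.el en′ → p ≡ p′
  entry-unique (mkEntry {a} on i loc p≡) (mkEntry on′ i′ loc′ p≡′) idx el with setIndex-injective on on′ idx
  entry-unique (mkEntry {a} on i loc p≡) (mkEntry on′ i′ loc′ p≡′) idx refl | refl =
    trans p≡ (trans (cong (begins sets (setIndex a i) +_) (At-unique (elements-Unique (ℒ a i)) loc loc′)) (sym p≡′))

  entry-lower : ∀ {p} (en : Entry p) → begins sets (Entry.set-index en) ≤ p
  entry-lower (mkEntry on i loc refl) = m≤m+n _ _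

  entry-upper : ∀ {p} (en : Entry p) → p < begins sets (suc (Entry.set-index en))
  entry-upper (mkEntry on i loc refl) = <-≤-trans (+-monoʳ-< _ (At-< loc))
    (≤-reflexive (sym (trans (sets-suc on i) (cong (begins sets (setIndex _ i) +_) (sym (length-elements (ℒ _ i)))))))

  values : ∀ {p} → Entry p → ℕ × Contract
  values en = Entry.set-index en , Entry.el en

  -- A position lies in a single block of the concatenation, which fixes the set, and the array
  -- fixes the contract. Hence any two analyses of one position give the same values.
  entries-agree : ∀ {p p′} → p ≡ p′ → (en : Entry p) (en′ : Entry p′) → values en ≡ values en′
  entries-agree refl en en′ = cong₂ _,_ (index≡ en en′) (toℕ-injective (At-functional (entry-at en) (entry-at en′)))
    where
    index≡ : ∀ {p} (en en′ : Entry p) → Entry.set-index en ≡ Entry.set-index en′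
    index≡ en en′ = begins-unique sets (entry-lower en) (entry-upper en) (entry-lower en′) (entry-upper en′)

  agent-≟ : ∀ a b → OnSide a → OnSide b → Dec (a ≡ b)
  agent-≟ a b on-a on-b with index I a ≟ index I b
  ... | yes eq = yes (At-functional on-a (subst (λ w → At (agents I σ) w b) (sym eq) on-b))
  ... | no ≢   = no λ { refl → ≢ refl }

  abstract
    -- Abstract: later arguments use the fields of the entry, not the search that found it.
    at-index : ∀ (p : Fin (length members)) → Entry (toℕ p)
    at-index p = entry (toℕ<n p)

  private module At-index (p : Fin (length members)) = Entry (at-index p)
  open At-index

  member-of : Fin (length members) → Fin #E → Bool
  member-of p = lookup (ℒ (agent p) (set p))

  incidence : Incidence #E
  incidence = record
    { entries = length members
    ; el = el
    ; code = set-index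
    ; member = member-of
    ; quota = λ p → quota (agent p) (set p)
    ; sound = λ p → ∈⇒lookup (in-set p)
    ; complete = comp
    ; unique = λ {p} {p′} c≡ e≡ → toℕ-injective (entry-unique (at-index p) (at-index p′) c≡ e≡)
    ; code-member = λ {p} {p′} c≡ e → cong (λ { (a , i) → lookup (ℒ a i) e }) (setIndex-injective (onSide p) (onSide p′) c≡)
    ; laminar = lam }
    where
    comp : ∀ p e → member-of p e ≡ true → ∃[ p′ ] (set-index p′ ≡ set-index p × el p′ ≡ e)
    comp p e e∈ with entry-of (onSide p) (set p) (lookup⇒∈ e∈)
    ... | r , en , el≡ , idx≡ = p′ , trans (cong proj₁ same) idx≡ , trans (cong proj₂ same) el≡
      where
      r< : r < length members
      r< = At-< (entry-at en)
      p′ = fromℕ< r<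
      same : values (at-index p′) ≡ values en
      same = entries-agree (toℕ-fromℕ< r<) (at-index p′) en
    lam : ∀ p p′ → member-of p ⊑ member-of p′ ⊎ member-of p′ ⊑ member-of p
      ⊎ (∀ x → member-of p x ≡ true → member-of p′ x ≡ true → ⊥)
    lam p p′ = go (onSide p) (onSide p′) (set p) (set p′)
      where
      go : ∀ {a b} → OnSide a → OnSide b → ∀ i j → lookup (ℒ a i) ⊑ lookup (ℒ b j) ⊎ lookup (ℒ b j) ⊑ lookup (ℒ a i)
        ⊎ (∀ x → lookup (ℒ a i) x ≡ true → lookup (ℒ b j) x ≡ true → ⊥)
      go {a} {b} on-a on-b i j with agent-≟ a b on-a on-b
      -- A contract determines its agent on the side, so sets of different agents are disjoint.
      ... | no a≢b = inj₂ (inj₂ λ x x∈ x∈′ → a≢b (trans (∂-unique on-a (ℒ⊆E a i (lookup⇒∈ x∈)))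
                       (sym (∂-unique on-b (ℒ⊆E b j (lookup⇒∈ x∈′))))))
      ... | yes refl with laminar a i j
      ...   | inj₁ sub = inj₁ λ x∈ → ∈⇒lookup (sub (lookup⇒∈ x∈))
      ...   | inj₂ (inj₁ sub) = inj₂ (inj₁ λ x∈ → ∈⇒lookup (sub (lookup⇒∈ x∈)))
      ...   | inj₂ (inj₂ empty) = inj₂ (inj₂ λ x x∈ x∈′ → empty (x , x∈p∩q⁺ (lookup⇒∈ x∈ , lookup⇒∈ x∈′)))

  length-agents : length (agents I σ) ≡ length fams
  length-agents = sym (length-map (family I) (agents I σ))

  familyArray-at : ∀ {w} → w ≤ length fams → array (familyArray I σ) w ≡ begins fams w
  familyArray-at = array-offsets 0 fams

  setArray-at : ∀ {g} → g ≤ length sets → array (setArray I σ) g ≡ begins sets g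
  setArray-at = array-offsets 0 sets

  total-at : array (setArray I σ) (array (familyArray I σ) (length (agents I σ))) ≡ length members
  total-at = begin
    array (setArray I σ) (array (familyArray I σ) (length (agents I σ)))
      ≡⟨ cong (λ w → array (setArray I σ) (array (familyArray I σ) w)) length-agents ⟩
    array (setArray I σ) (array (familyArray I σ) (length fams))
      ≡⟨ cong (array (setArray I σ)) (trans (familyArray-at ≤-refl) (begins-length fams)) ⟩
    array (setArray I σ) (length sets)  ≡⟨ trans (setArray-at ≤-refl) (begins-length sets) ⟩
    length members ∎
    where open ≡-Reasoning

  quotaArray-at : ∀ {a} → OnSide a → ∀ i → array (quotaArray I σ) (setIndex a i) ≡ quota a i
  quotaArray-at {a} on i = trans
    (cong (λ k → array (quotaArray I σ) (k + toℕ i)) (begins-cong (family I) quotas (λ a → trans (length-family a)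
      (sym (trans (length-map _ (allFin (#ℒ a))) (length-tabulate (λ (i : Fin (#ℒ a)) → i))))) (agents I σ) (index I a)))
    (At-array (At-concat (At-map quotas on) (At-map (quota a) (At-allFin i))))
    where
    quotas : Agent → List ℕ
    quotas a = map (quota a) (allFin (#ℒ a))

  endArray-at : ∀ e → array (endArray I σ) (toℕ e) ≡ index I (∂ σ e)
  endArray-at e = At-array (At-map (λ e → index I (∂ σ e)) (At-allFin e))

  positionArray-at : ∀ e → array (positionArray I σ) (toℕ e) ≡ position I (∂ σ e) e
  positionArray-at e = At-array (At-map (λ e → position I (∂ σ e) e) (At-allFin e))

  setIndex< : ∀ {a} → OnSide a → ∀ i → setIndex a i < length sets
  setIndex< on i = At-< (At-sets on i)

  index< : ∀ {a} → OnSide a → index I a < length fams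
  index< on = At-< (At-family on)

  first≤ : ∀ w → begins fams w ≤ length sets
  first≤ w with ≤-total w (length fams)
  ... | inj₁ le = ≤-trans (begins-mono fams le) (≤-reflexive (begins-length fams))
  ... | inj₂ ge = ≤-trans (≤-reflexive (begins-beyond fams ge)) ≤-refl
    where
    begins-beyond : ∀ {A : Set} (xss : List (List A)) {w} → length xss ≤ w → begins xss w ≡ length (concat xss)
    begins-beyond [] {zero} _ = refl
    begins-beyond [] {suc w} _ = refl
    begins-beyond (xs ∷ xss) {suc w} (s≤s le) = trans (length-++ xs)
      (trans (cong (length xs +_) (begins-beyond xss le)) (sym (length-++ xs)))

  sets-total : ∀ g → g ≤ length sets → begins sets g ≤ length members
  sets-total g le = ≤-trans (begins-mono sets le) (≤-reflexive (begins-length sets))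

  -- All sets of an agent but at most one are nonempty.
  #ℒ-bound : ∀ {a} → OnSide a → begins sets (first a) + #ℒ a ≤ suc (begins sets (begins fams (suc (index I a))))
  #ℒ-bound {a} on = subst (λ g → begins sets (first a) + #ℒ a ≤ suc (begins sets g)) (sym (first-suc on)) (weaken (go (#ℒ a) ≤-refl))
    where
    ∅ : Fin (#ℒ a) → Set
    ∅ i = # (lookup (ℒ a i)) ≡ 0
    State : ℕ → Set
    State k = begins sets (first a) + k ≤ begins sets (first a + k)
      ⊎ ((∃[ i ] (toℕ i < k × ∅ i)) × begins sets (first a) + k ≤ suc (begins sets (first a + k)))
    weaken : ∀ {k} → State k → begins sets (first a) + k ≤ suc (begins sets (first a + k))
    weaken (inj₁ le) = m≤n⇒m≤1+n le
    weaken (inj₂ (_ , le)) = le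
    ∅-unique : ∀ {i j} → ∅ i → ∅ j → i ≡ j
    ∅-unique {i} {j} zi zj = ℒ-injective a (subset-ext λ x → trans (absent i zi x) (sym (absent j zj x)))
      where
      absent : ∀ i → ∅ i → ∀ x → lookup (ℒ a i) x ≡ false
      absent i z x = not-true λ h → case ≤-trans (#-positive {A = lookup (ℒ a i)} h) (≤-reflexive z) of λ ()
    go : ∀ k → k ≤ #ℒ a → State k
    go zero _ = inj₁ (≤-reflexive (trans (+-identityʳ _) (cong (begins sets) (sym (+-identityʳ (first a))))))
    go (suc k) k< = next (go k (<⇒≤ k<)) (# (lookup (ℒ a i)) ≟ 0)
      where
      i : Fin (#ℒ a)
      i = fromℕ< k<
      grow : begins sets (first a + suc k) ≡ begins sets (first a + k) + # (lookup (ℒ a i))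
      grow = trans (cong (begins sets) (+-suc (first a) k))
        (subst (λ r → begins sets (suc (first a + r)) ≡ begins sets (first a + r) + # (lookup (ℒ a i))) (toℕ-fromℕ< k<) (sets-suc on i))
      larger : ¬ ∅ i → ∀ {m} → m ≤ begins sets (first a + k) → suc m ≤ begins sets (first a + suc k)
      larger ne {m} le = ≤-trans (≤-reflexive (+-comm 1 m)) (≤-trans (+-mono-≤ le (n≢0⇒n>0 ne)) (≤-reflexive (sym grow)))
      base≤ : begins sets (first a + k) ≤ begins sets (first a + suc k)
      base≤ = ≤-trans (m≤m+n _ _) (≤-reflexive (sym grow))
      next : State k → Dec (∅ i) → State (suc k)
      next (inj₁ le) (no ne) = inj₁ (≤-trans (≤-reflexive (+-suc _ k)) (larger ne le))
      next (inj₁ le) (yes e) = inj₂ ((i , s≤s (≤-reflexive (toℕ-fromℕ< k<)) , e)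
        , ≤-trans (≤-reflexive (+-suc _ k)) (s≤s (≤-trans le base≤)))
      next (inj₂ ((j , j<k , ej) , le)) (yes e) = contradiction (cong toℕ (∅-unique ej e))
        (λ eq → <-irrefl (trans eq (toℕ-fromℕ< k<)) j<k)
      next (inj₂ ((j , j<k , ej) , le)) (no ne) = inj₂ ((j , m≤n⇒m≤1+n j<k , ej)
        , ≤-trans (≤-reflexive (+-suc _ k)) (s≤s (≤-trans le (≤-trans (≤-reflexive (+-comm 1 _))
          (≤-trans (+-monoʳ-≤ _ (n≢0⇒n>0 ne)) (≤-reflexive (sym grow)))))))

  entry-for : ∀ {a} → OnSide a → ∀ i → (∀ x → lookup (ℒ a i) x ≡ false)
    ⊎ ∃[ p ] ((∀ x → member-of p x ≡ lookup (ℒ a i) x) × quota (agent p) (set p) ≡ quota a i)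
  entry-for {a} on i with any? (λ x → lookup (ℒ a i) x ≟ᵇ true)
  ... | no ∄ = inj₁ λ x → not-true λ h → ∄ (x , h)
  ... | yes (x , x∈) with entry-of on i (lookup⇒∈ x∈)
  ...   | r , en , _ , idx≡ = inj₂ (p , (λ x → cong (λ { (a , i) → lookup (ℒ a i) x }) same) , cong (λ { (a , i) → quota a i }) same)
    where
    r< : r < length members
    r< = At-< (entry-at en)
    p = fromℕ< r<
    same : _≡_ {A = ∃[ a ] Fin (#ℒ a)} (agent p , set p) (a , i)
    same = setIndex-injective (onSide p) on (trans (cong proj₁ (entries-agree (toℕ-fromℕ< r<) (at-index p) en)) idx≡)

  private module Inc = Incidence incidence
  open Laminar Inc.asFamily using (⊑-of-size)

  -- The sets containing e, sorted by size, are a chain.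
  chain : ∀ e fuel (S : Fin (length members) → Bool) → # S ≤ fuel → (∀ {p} → S p ≡ true → el p ≡ e) →
    Σ[ (c , _) ∈ Chain I (∂ σ e) (# S) ] (∀ j → ∃[ p ] (S p ≡ true × (∀ x → lookup (ℒ (∂ σ e) (c j)) x ≡ member-of p x)))
  chain e fuel S #S≤ same with any? (λ p → S p ≟ᵇ true)
  ... | no ∄ rewrite trans (#-sum S) (sum-zero λ p → cong ⟦_⟧ᵇ (not-true λ h → ∄ (p , h))) = ((λ ()) , λ ()) , λ ()
  ... | yes ∃p with argmin (λ p → S p ≟ᵇ true) (λ p → # (member-of p)) ∃p
  chain e zero S #S≤ same | yes ∃p | p₀ , p₀∈ , min = contradiction (≤-trans (#-positive {A = S} p₀∈) #S≤) λ ()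
  chain e (suc fuel) S #S≤ same | yes ∃p | p₀ , p₀∈ , min = extend (chain e fuel S′ (≤-pred (≤-trans (≤-reflexive (sym #S)) #S≤)) (same ∘ S′⊑S))
    where
    a = ∂ σ e
    S′ : Fin (length members) → Bool
    S′ p = S p ∧ not (does (p ≟ᶠ p₀))
    S′⊑S : S′ ⊑ S
    S′⊑S {p} h = proj₁ (∧-true {S p} h)
    S′≢ : ∀ {p} → S′ p ≡ true → p ≢ p₀
    S′≢ {p} h refl with S p | p ≟ᶠ p
    ... | true | no ≢ = ≢ refl
    S′-p₀ : S′ p₀ ≡ false
    S′-p₀ = not-true λ h → S′≢ h refl
    #S : # S ≡ suc (# S′)
    #S = trans (sym (+-identityʳ _)) (trans (cong (λ b → # S + ⟦ b ⟧ᵇ) (sym S′-p₀))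
      (trans (#-update S S′ p₀ agree) (trans (cong (λ b → # S′ + ⟦ b ⟧ᵇ) p₀∈) (+-comm _ 1))))
      where
      agree : ∀ p → p ≢ p₀ → S p ≡ S′ p
      agree p p≢ with S p | p ≟ᶠ p₀
      ... | _     | yes p≡ = contradiction p≡ p≢
      ... | true  | no _   = refl
      ... | false | no _   = refl
    e∈ : ∀ {p} → S p ≡ true → member-of p e ≡ true
    e∈ {p} h = subst (λ x → member-of p x ≡ true) (same h) (Inc.sound p)
    as-set : ∀ p → S p ≡ true → ∃[ i ] ((∀ x → lookup (ℒ a i) x ≡ member-of p x))
    as-set p h = go (∂-unique (onSide p) (ℒ⊆E _ _ (in-set p))) (same h) (set p) λ _ → refl
      where
      go : ∀ {b e′} → b ≡ ∂ σ e′ → e′ ≡ e → (i : Fin (#ℒ b)) → (∀ x → lookup (ℒ b i) x ≡ member-of p x) →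
        ∃[ i ] (∀ x → lookup (ℒ a i) x ≡ member-of p x)
      go refl refl i eq = i , eq
    i₀ = proj₁ (as-set p₀ p₀∈)
    i₀-eq = proj₂ (as-set p₀ p₀∈)
    above : ∀ {p} → S′ p ≡ true → ∀ i → (∀ x → lookup (ℒ a i) x ≡ member-of p x) → ℒ a i₀ ⊂ ℒ a i
    above {p} h i eq = (λ x∈ → lookup⇒∈ (trans (eq _) (sub (trans (sym (i₀-eq _)) (∈⇒lookup x∈))))) , witness
      where
      sub : member-of p₀ ⊑ member-of p
      sub = ⊑-of-size (e∈ p₀∈) (e∈ (S′⊑S h)) (min p (S′⊑S h))
      witness : ∃[ x ] (x ∈ ℒ a i × ¬ x ∈ ℒ a i₀)
      witness with any? (λ x → (member-of p x ≟ᵇ true) ×-dec (member-of p₀ x ≟ᵇ false))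
      ... | yes (x , x∈ , x∉) = x , lookup⇒∈ (trans (eq x) x∈) , λ x∈₀ → case trans (sym x∉) (trans (sym (i₀-eq x)) (∈⇒lookup x∈₀)) of λ ()
      -- Equal sets with the same element would be the same entry, so the inclusion is strict.
      ... | no ∄ = contradiction (Inc.unique code≡ (trans (same (S′⊑S h)) (sym (same p₀∈)))) (S′≢ h)
        where
        back : ∀ x → member-of p x ≡ member-of p₀ x
        back x with member-of p x in eq₁ | member-of p₀ x in eq₂
        ... | true  | true  = refl
        ... | false | false = refl
        ... | true  | false = contradiction (x , eq₁ , eq₂) ∄
        ... | false | true  = trans (sym eq₁) (sub eq₂)
        code≡ : set-index p ≡ set-index p₀
        code≡ = go (∂-unique (onSide p) (ℒ⊆E _ _ (in-set p))) (∂-unique (onSide p₀) (ℒ⊆E _ _ (in-set p₀)))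
          (trans (same (S′⊑S h)) (sym (same p₀∈))) (set p) (set p₀) back
          where
          go : ∀ {b b′ d d′} → b ≡ ∂ σ d → b′ ≡ ∂ σ d′ → d ≡ d′ → (i : Fin (#ℒ b)) (i′ : Fin (#ℒ b′)) →
            (∀ x → lookup (ℒ b i) x ≡ lookup (ℒ b′ i′) x) → setIndex b i ≡ setIndex b′ i′
          go {b} refl refl refl i i′ eq = cong (setIndex b) (ℒ-injective b (subset-ext eq))
    extend : Σ[ (c , _) ∈ Chain I a (# S′) ] (∀ j → ∃[ p ] (S′ p ≡ true × (∀ x → lookup (ℒ a (c j)) x ≡ member-of p x))) →
      Σ[ (c , _) ∈ Chain I a (# S) ] (∀ j → ∃[ p ] (S p ≡ true × (∀ x → lookup (ℒ a (c j)) x ≡ member-of p x)))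
    extend ((c , increasing) , from) rewrite #S = (c′ , inc′) , from′
      where
      c′ : Fin (suc (# S′)) → Fin (#ℒ a)
      c′ zero    = i₀
      c′ (suc j) = c j
      inc′ : ∀ j j′ → j Fin.< j′ → ℒ a (c′ j) ⊂ ℒ a (c′ j′)
      inc′ zero    (suc j′) _        = let (p , h , eq) = from j′ in above h (c j′) eq
      inc′ (suc j) (suc j′) (s≤s lt) = increasing j j′ lt
      from′ : ∀ j → ∃[ p ] (S p ≡ true × (∀ x → lookup (ℒ a (c′ j)) x ≡ member-of p x))
      from′ zero    = p₀ , p₀∈ , i₀-eq
      from′ (suc j) = let (p , h , eq) = from j in p , S′⊑S h , eq

  -- Entries are counted by contract: the sets with an entry for `e` form a chain in the family of
  -- its agent, so there are at most `k` of them.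
  members-bound : ∀ {k} → (∀ a n → Chain I a n → n ≤ k) → length members ≤ k * #E
  members-bound {k} bound = begin
    length members                                  ≡⟨ ones ⟨
    sum (λ (p : Fin (length members)) → 1)          ≡⟨ sum-cong-≗ (λ p → sym (pick p)) ⟩
    sum (λ p → sum λ e → ⟦ does (e ≟ᶠ el p) ⟧ᵇ)     ≡⟨ ∑-comm (λ p e → ⟦ does (e ≟ᶠ el p) ⟧ᵇ) ⟩
    sum (λ e → sum λ p → ⟦ does (e ≟ᶠ el p) ⟧ᵇ)     ≤⟨ sum≤*n _ k short ⟩
    k * #E                                          ∎
    where
    open ≤-Reasoning
    ones : sum (λ (p : Fin (length members)) → 1) ≡ length members
    ones = go (length members)
      where
      go : ∀ m → sum (λ (p : Fin m) → 1) ≡ m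
      go zero = refl
      go (suc m) = cong suc (go m)
    pick : ∀ p → sum (λ e → ⟦ does (e ≟ᶠ el p) ⟧ᵇ) ≡ 1
    pick p = trans (sum-single (λ e → ⟦ does (e ≟ᶠ el p) ⟧ᵇ) (el p) miss) hit
      where
      miss : ∀ e → e ≢ el p → ⟦ does (e ≟ᶠ el p) ⟧ᵇ ≡ 0
      miss e e≢ with e ≟ᶠ el p
      ... | yes e≡ = contradiction e≡ e≢
      ... | no _   = refl
      hit : ⟦ does (el p ≟ᶠ el p) ⟧ᵇ ≡ 1
      hit = cong ⟦_⟧ᵇ (does-refl (el p))
    short : ∀ e → sum (λ p → ⟦ does (e ≟ᶠ el p) ⟧ᵇ) ≤ k
    short e = ≤-trans (≤-reflexive (sym (#-sum S))) (bound (∂ σ e) (# S) (proj₁ (chain e (# S) S ≤-refl same)))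
      where
      S : Fin (length members) → Bool
      S p = does (e ≟ᶠ el p)
      same : ∀ {p} → S p ≡ true → el p ≡ e
      same {p} h with e ≟ᶠ el p
      ... | yes e≡ = sym e≡

update-elsewhere : ∀ (s : Store) x {i j} v → i ≢ j → (s [ x , i ↦ v ]) x j ≡ s x j
update-elsewhere s x {i} {j} v i≢j rewrite ≡ᵇ-refl x | ≢⇒≡ᵇ i≢j = refl

-- Running through all sets would be too slow, since there is no bound on the
-- number of agents without contracts: the sets are reached from the contracts.
module Preprocess (end fam set grp : ℕ) where

  cur pos lim : Exp
  cur = 30 at lit 0
  pos = 31 at lit 0
  lim = 33 at lit 0

  fill-body fill visit preprocess : Program
  -- Two pointers move together: if the set `cur` extends beyond the entry `pos`, the entry is
  -- labelled with it, otherwise the next set begins. Empty sets are passed over in this way.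
  fill-body = If ((set at (cur ⊕ lit 1)) ⊖ pos)
    (grp at pos ≔ cur ⨾ 31 at lit 0 ≔ (pos ⊕ lit 1))
    (30 at lit 0 ≔ (cur ⊕ lit 1))
  fill = While (lim ⊖ cur) fill-body
  -- An agent is visited once for each of its contracts; a repeated visit rewrites the same labels.
  visit = 30 at lit 0 ≔ (fam at (end at (26 at lit 0))) ⨾ 31 at lit 0 ≔ (set at cur) ⨾
    33 at lit 0 ≔ (fam at ((end at (26 at lit 0)) ⊕ lit 1)) ⨾ fill
  preprocess = For 26 nE visit

  -- Each step advances one of the two pointers, so `m` has to bound the sets and the entries of an
  -- agent together.
  fill-time visit-time : ℕ → ℕ
  fill-time m = m * (suc (cost (lim ⊖ cur)) + maxCost fill-body) + suc (cost (lim ⊖ cur))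
  visit-time m = (1 + cost (lit 0) + cost (fam at (end at (26 at lit 0))))
    + ((1 + cost (lit 0) + cost (set at cur))
    + ((1 + cost (lit 0) + cost (fam at ((end at (26 at lit 0)) ⊕ lit 1))) + fill-time m))

  Fresh : ℕ → Set
  Fresh x = (30 ≡ᵇ x) ≡ false × (31 ≡ᵇ x) ≡ false × (33 ≡ᵇ x) ≡ false × (26 ≡ᵇ x) ≡ false × (grp ≡ᵇ x) ≡ false

  record Apart : Set where
    field
      fr-set : Fresh set
      fr-fam : Fresh fam
      fr-end : Fresh end
      g0  : (grp ≡ᵇ 0) ≡ false
      g26 : (grp ≡ᵇ 26) ≡ false
      g30 : (grp ≡ᵇ 30) ≡ false
      g31 : (grp ≡ᵇ 31) ≡ false
      g33 : (grp ≡ᵇ 33) ≡ false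
      26g : (26 ≡ᵇ grp) ≡ false
      30g : (30 ≡ᵇ grp) ≡ false
      31g : (31 ≡ᵇ grp) ≡ false
      33g : (33 ≡ᵇ grp) ≡ false

  module _ (apart : Apart) (T : ℕ → ℕ) (T-mono : ∀ {g h} → g ≤ h → T g ≤ T h) (G : ℕ) where

    open Apart apart

    -- Quantified over the block that contains `p`; there is at most one, so overwriting a correct
    -- label in a later visit keeps it correct.
    Right : Store → ℕ → Set
    Right s p = ∀ g → T g ≤ p → p < T (suc g) → s grp p ≡ g

    T-unique : ∀ {p g h} → T g ≤ p → p < T (suc g) → T h ≤ p → p < T (suc h) → g ≡ h
    T-unique {p} {g} {h} g≤ <g h≤ <h = ≤-antisym
      (≮⇒≥ λ h<g → <⇒≱ <h (≤-trans (T-mono h<g) g≤))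
      (≮⇒≥ λ g<h → <⇒≱ <g (≤-trans (T-mono g<h) h≤))

    Sets : Store → Set
    Sets s = ∀ {g} → g ≤ G → s set g ≡ T g

    module Fill (s₀ : Store) (lo hi : ℕ) (lo≤hi : lo ≤ hi) (hi≤G : hi ≤ G) (sets₀ : Sets s₀)
      (cur₀ : s₀ 30 0 ≡ lo) (pos₀ : s₀ 31 0 ≡ T lo) (lim₀ : s₀ 33 0 ≡ hi) where

      record Inv (s : Store) : Set where
        field
          sets  : Sets s
          limit : s 33 0 ≡ hi
          cur≤  : s 30 0 ≤ hi
          from  : T (s 30 0) ≤ s 31 0
          pos≤  : s 31 0 ≤ T hi
          upto  : s 30 0 < hi → s 31 0 ≤ T (suc (s 30 0))
          old   : ∀ p → Right s₀ p → Right s p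
          new   : ∀ p → T lo ≤ p → p < s 31 0 → Right s p

      μ : Store → ℕ
      μ s = (hi ∸ s 30 0) + (T hi ∸ s 31 0)

      write : ∀ {s} → Inv s → s 30 0 < hi → s 31 0 < T (suc (s 30 0)) →
        let s′ = (s [ grp , s 31 0 ↦ s 30 0 ]) [ 31 , 0 ↦ (s [ grp , s 31 0 ↦ s 30 0 ]) 31 0 + 1 ] in
        Inv s′ × μ s′ < μ s
      write {s} inv i<hi p<T = record
        { sets = λ g≤G → trans set-same (sets g≤G)
        ; limit = trans lim-same limit
        ; cur≤ = ≤-trans (≤-reflexive cur-same) cur≤
        ; from = ≤-trans (≤-trans (≤-reflexive (cong T cur-same)) from) (≤-trans (m≤m+n _ 1) (≤-reflexive (sym pos-same)))
        ; pos≤ = ≤-trans (≤-reflexive pos-same) (≤-trans p+1≤ (T-mono i<hi))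
        ; upto = λ _ → ≤-trans (≤-reflexive pos-same) (≤-trans p+1≤ (≤-reflexive (cong (T ∘ suc) (sym cur-same))))
        ; old = λ p r → keep p (old p r)
        ; new = λ p lo≤p p<s → new′ p lo≤p (≤-pred (≤-trans p<s (≤-reflexive (trans pos-same (+-comm _ 1))))) }
        , (begin-strict
          (hi ∸ s′ 30 0) + (T hi ∸ s′ 31 0)       ≡⟨ cong₂ (λ k p → (hi ∸ k) + (T hi ∸ p)) cur-same pos-same ⟩
          (hi ∸ s 30 0) + (T hi ∸ (s 31 0 + 1))   <⟨ +-monoʳ-< (hi ∸ s 30 0) (∸-monoʳ-< (m<m+n _ (s≤s z≤n)) (≤-trans p+1≤ (T-mono i<hi))) ⟩
          μ s ∎)
        where
        open Inv inv
        open ≤-Reasoning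
        s′ = (s [ grp , s 31 0 ↦ s 30 0 ]) [ 31 , 0 ↦ (s [ grp , s 31 0 ↦ s 30 0 ]) 31 0 + 1 ]
        pos-same : s′ 31 0 ≡ s 31 0 + 1
        pos-same = cong (_+ 1) (update-other s grp 31 (s 31 0) 0 g31)
        p+1≤ : s 31 0 + 1 ≤ T (suc (s 30 0))
        p+1≤ = ≤-trans (≤-reflexive (+-comm _ 1)) p<T
        set-same : ∀ {g} → s′ set g ≡ s set g
        set-same {g} = trans (update-other (s [ grp , s 31 0 ↦ s 30 0 ]) 31 set 0 g (proj₁ (proj₂ fr-set)))
          (update-other s grp set (s 31 0) g (proj₂ (proj₂ (proj₂ (proj₂ fr-set)))))
        lim-same : s′ 33 0 ≡ s 33 0
        lim-same = update-other s grp 33 (s 31 0) 0 g33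
        cur-same : s′ 30 0 ≡ s 30 0
        cur-same = update-other s grp 30 (s 31 0) 0 g30
        hit : s′ grp (s 31 0) ≡ s 30 0
        hit = trans (update-other (s [ grp , s 31 0 ↦ s 30 0 ]) 31 grp 0 (s 31 0) 31g) (update-here s grp (s 31 0) (s 30 0))
        miss : ∀ p → p ≢ s 31 0 → s′ grp p ≡ s grp p
        miss p p≢ = trans (update-other (s [ grp , s 31 0 ↦ s 30 0 ]) 31 grp 0 p 31g) (update-elsewhere s grp (s 30 0) (λ eq → p≢ (sym eq)))
        keep : ∀ p → Right s p → Right s′ p
        keep p r g g≤ <g with p ≟ s 31 0
        ... | yes refl = trans hit (T-unique from p<T g≤ <g)
        ... | no p≢    = trans (miss p p≢) (r g g≤ <g)
        new′ : ∀ p → T lo ≤ p → p ≤ s 31 0 → Right s′ p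
        new′ p lo≤p p≤s g g≤ <g with p ≟ s 31 0
        ... | yes refl = trans hit (T-unique from p<T g≤ <g)
        ... | no p≢    = trans (miss p p≢) (new p lo≤p (≤∧≢⇒< p≤s p≢) g g≤ <g)

      advance : ∀ {s} → Inv s → s 30 0 < hi → T (suc (s 30 0)) ≤ s 31 0 →
        let s′ = s [ 30 , 0 ↦ s 30 0 + 1 ] in Inv s′ × μ s′ < μ s
      advance {s} inv i<hi T≤p = record
        { sets = λ g≤G → trans set-same (sets g≤G)
        ; limit = limit
        ; cur≤ = ≤-trans (≤-reflexive (+-comm _ 1)) i<hi
        ; from = ≤-trans (≤-reflexive (cong T (+-comm _ 1))) T≤p
        ; pos≤ = pos≤
        ; upto = λ _ → ≤-trans (upto i<hi) (T-mono (s≤s (m≤m+n _ 1)))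
        ; old = λ p r → keep p (old p r)
        ; new = λ p lo≤p p<s → keep p (new p lo≤p p<s) }
        , +-monoˡ-< (T hi ∸ s 31 0) (∸-monoʳ-< (m<m+n _ (s≤s z≤n)) (≤-trans (≤-reflexive (+-comm _ 1)) i<hi))
        where
        open Inv inv
        s′ = s [ 30 , 0 ↦ s 30 0 + 1 ]
        set-same : ∀ {g} → s′ set g ≡ s set g
        set-same {g} = update-other s 30 set 0 g (proj₁ fr-set)
        keep : ∀ p → Right s p → Right s′ p
        keep p r g g≤ <g = trans (update-other s 30 grp 0 p 30g) (r g g≤ <g)

      body : ∀ s → Inv s → eval (lim ⊖ cur) s ≢ 0 → Runs fill-body s (maxCost fill-body) (λ s′ → Inv s′ × μ s′ < μ s)
      body s inv h = runs-loopFree fill-body refl (branch-elim (λ s′ → Inv s′ × μ s′ < μ s) (s set (s 30 0 + 1) ∸ s 31 0)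
        (λ nz → write inv i<hi (≤-trans (≰⇒> λ le → nz (m≤n⇒m∸n≡0 le)) (≤-reflexive next-T)))
        (λ z → advance inv i<hi (≤-trans (≤-reflexive (sym next-T)) (m∸n≡0⇒m≤n z))))
        where
        open Inv inv
        i<hi : s 30 0 < hi
        i<hi = ≰⇒> λ le → h (m≤n⇒m∸n≡0 (≤-trans (≤-reflexive limit) le))
        next-T : s set (s 30 0 + 1) ≡ T (suc (s 30 0))
        next-T = trans (sets (≤-trans (≤-reflexive (+-comm _ 1)) (≤-trans i<hi hi≤G))) (cong T (+-comm _ 1))

      start : Inv s₀
      start = record
        { sets = sets₀ ; limit = lim₀ ; cur≤ = ≤-trans (≤-reflexive cur₀) lo≤hi
        ; from = ≤-reflexive (trans (cong T cur₀) (sym pos₀))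
        ; pos≤ = ≤-trans (≤-reflexive pos₀) (T-mono lo≤hi)
        ; upto = λ _ → ≤-trans (≤-reflexive (trans pos₀ (cong T (sym cur₀)))) (T-mono (n≤1+n _))
        ; old = λ p r → r
        ; new = λ p lo≤p p<s → contradiction (<-≤-trans p<s (≤-trans (≤-reflexive pos₀) lo≤p)) (<-irrefl refl) }

      runs-fill : ∀ {m} → (hi ∸ lo) + (T hi ∸ T lo) ≤ m → Runs fill s₀ (fill-time m)
        (λ s → (∀ p → Right s₀ p → Right s p) × (∀ p → T lo ≤ p → p < T hi → Right s p))
      runs-fill {m} bound = runs-weaken ≤-refl done (runs-while Inv μ (maxCost fill-body) body start
        (≤-trans (≤-reflexive (cong₂ (λ i p → (hi ∸ i) + (T hi ∸ p)) cur₀ pos₀)) bound))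
        where
        done : ∀ {s} → Inv s × eval (lim ⊖ cur) s ≡ 0 →
          (∀ p → Right s₀ p → Right s p) × (∀ p → T lo ≤ p → p < T hi → Right s p)
        done {s} (inv , z) = old , λ p lo≤p p<hi → new p lo≤p (<-≤-trans p<hi (≤-trans
          (T-mono (≤-trans (≤-reflexive (sym limit)) (m∸n≡0⇒m≤n z))) from))
          where open Inv inv

    module _ (n : ℕ) (lo hi : ℕ → ℕ) (m : ℕ) (s₀ : Store) (n-eq : s₀ 0 0 ≡ n) (sets₀ : Sets s₀)
      (lo-eq : ∀ {e} → e < n → s₀ fam (s₀ end e) ≡ lo e) (hi-eq : ∀ {e} → e < n → s₀ fam (s₀ end e + 1) ≡ hi e)
      (lo≤hi : ∀ {e} → e < n → lo e ≤ hi e) (hi≤G : ∀ {e} → e < n → hi e ≤ G)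
      (bound : ∀ {e} → e < n → (hi e ∸ lo e) + (T (hi e) ∸ T (lo e)) ≤ m) where

      Filled : ℕ → Store → Set
      Filled j s = ∀ {e} → e < j → ∀ p → T (lo e) ≤ p → p < T (hi e) → Right s p

      runs-preprocess : Runs preprocess s₀ (forCost nE n (visit-time m)) (Filled n)
      runs-preprocess = subst (λ N → Runs preprocess s₀ (forCost nE N (visit-time m)) (Filled N)) n-eq
        (runs-for (visit-time m) Filled visit-26 n-free (λ ()) step)
        where
        visit-26 : writes visit 26 ≡ false
        visit-26 = cong (λ b → (b ∨ false) ∨ false) g26
        n-free : independent nE (writes preprocess) ≡ true
        n-free = cong (λ b → not (((b ∨ false) ∨ false) ∨ false) ∧ true) g0
        unwritten : ∀ {x} → Fresh x → writes visit x ≡ false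
        unwritten (x30 , x31 , x33 , _ , xg) = cong₂ _∨_ x30 (cong₂ _∨_ x31 (cong₂ _∨_ x33 (cong₂ _∨_ (cong₂ _∨_ xg x31) x30)))
        step : ∀ j s → j < s₀ 0 0 → Agree (writes visit) s (s₀ [ 26 , 0 ↦ j ]) → Filled j s →
          Runs visit s (visit-time m) (λ s′ → Filled (suc j) (s′ [ 26 , 0 ↦ suc j ]))
        step j s j<n₀ agree filled = runs-assign (runs-assign (runs-assign (runs-weaken ≤-refl (λ {s′} → finish {s′})
          (Fill.runs-fill s₃ (lo j) (hi j) (lo≤hi j<n) (hi≤G j<n) sets₃ cur₃ pos₃ lim₃ (bound j<n)))))
          where
          j<n : j < n
          j<n = <-≤-trans j<n₀ (≤-reflexive n-eq)
          s₁ = s [ 30 , 0 ↦ s fam (s end (s 26 0)) ]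
          s₂ = s₁ [ 31 , 0 ↦ s₁ set (s₁ 30 0) ]
          s₃ = s₂ [ 33 , 0 ↦ s₂ fam (s₂ end (s₂ 26 0) + 1) ]
          read : ∀ {x} → Fresh x → ∀ k → s x k ≡ s₀ x k
          read {x} fr@(_ , _ , _ , x26 , _) k = trans (agree x (unwritten fr) k) (update-other s₀ 26 x 0 k x26)
          ctr : s 26 0 ≡ j
          ctr = agree 26 visit-26 0
          read₁ : ∀ {x} → Fresh x → ∀ k → s₁ x k ≡ s x k
          read₁ {x} (x30 , _) k = update-other s 30 x 0 k x30
          read₂ : ∀ {x} → Fresh x → ∀ k → s₂ x k ≡ s₁ x k
          read₂ {x} (_ , x31 , _) k = update-other s₁ 31 x 0 k x31
          read₃ : ∀ {x} → Fresh x → ∀ k → s₃ x k ≡ s₂ x k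
          read₃ {x} (_ , _ , x33 , _) k = update-other s₂ 33 x 0 k x33
          end-j : s end (s 26 0) ≡ s₀ end j
          end-j = trans (read fr-end _) (cong (s₀ end) ctr)
          cur₁ : s₁ 30 0 ≡ lo j
          cur₁ = trans (read fr-fam _) (trans (cong (s₀ fam) end-j) (lo-eq j<n))
          cur₃ : s₃ 30 0 ≡ lo j
          cur₃ = cur₁
          pos₃ : s₃ 31 0 ≡ T (lo j)
          pos₃ = trans (read₁ fr-set _) (trans (read fr-set _) (trans (cong (s₀ set) cur₁) (sets₀ (≤-trans (lo≤hi j<n) (hi≤G j<n)))))
          lim₃ : s₃ 33 0 ≡ hi j
          lim₃ = trans (read₂ fr-fam _) (trans (read₁ fr-fam _) (trans (read fr-fam _)
            (trans (cong (λ k → s₀ fam (k + 1)) (trans (read₂ fr-end _) (trans (read₁ fr-end _) end-j))) (hi-eq j<n))))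
          sets₃ : Sets s₃
          sets₃ {g} g≤ = trans (read₃ fr-set g) (trans (read₂ fr-set g) (trans (read₁ fr-set g) (trans (read fr-set g) (sets₀ g≤))))
          Right₃ : ∀ p → Right s p → Right s₃ p
          Right₃ p r g g≤ <g = trans (update-other s₂ 33 grp 0 p 33g)
            (trans (update-other s₁ 31 grp 0 p 31g) (trans (update-other s 30 grp 0 p 30g) (r g g≤ <g)))
          finish : ∀ {s′} → (∀ p → Right s₃ p → Right s′ p) × (∀ p → T (lo j) ≤ p → p < T (hi j) → Right s′ p) →
            Filled (suc j) (s′ [ 26 , 0 ↦ suc j ])
          finish {s′} (old , new) {e} e<j+1 p lo≤p p<hi g g≤ <g with m≤n⇒m<n∨m≡n (≤-pred e<j+1)
          ... | inj₁ e<j  = trans (update-other s′ 26 grp 0 p 26g) (old p (Right₃ p (filled e<j p lo≤p p<hi)) g g≤ <g)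
          ... | inj₂ refl = trans (update-other s′ 26 grp 0 p 26g) (new p lo≤p p<hi g g≤ <g)

-- Stability in the instance

length-filter-mono : ∀ {A : Set} {P Q : A → Set} (P? : Decidable₁ P) (Q? : Decidable₁ Q) xs →
  (∀ {x} → x Mem.∈ xs → P x → Q x) → length (filter P? xs) ≤ length (filter Q? xs)
length-filter-mono P? Q? []       sub = z≤n
length-filter-mono P? Q? (x ∷ xs) sub with P? x | Q? x
... | yes p | yes q = s≤s (length-filter-mono P? Q? xs (sub ∘ there))
... | yes p | no ¬q = contradiction (sub (here refl) p) ¬q
... | no ¬p | yes q = m≤n⇒m≤1+n (length-filter-mono P? Q? xs (sub ∘ there))
... | no ¬p | no ¬q = length-filter-mono P? Q? xs (sub ∘ there)

length-filter-strict : ∀ {A : Set} {P Q : A → Set} (P? : Decidable₁ P) (Q? : Decidable₁ Q) {x} xs →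
  (∀ {x} → x Mem.∈ xs → P x → Q x) → x Mem.∈ xs → Q x → ¬ P x → length (filter P? xs) < length (filter Q? xs)
length-filter-strict P? Q? (x ∷ xs) sub (here refl) qx ¬px with P? x | Q? x
... | yes p | _     = contradiction p ¬px
... | no _  | yes _ = s≤s (length-filter-mono P? Q? xs (sub ∘ there))
... | no _  | no ¬q = contradiction qx ¬q
length-filter-strict P? Q? (y ∷ xs) sub (there x∈) qx ¬px with P? y | Q? y
... | yes p | yes q = s≤s (length-filter-strict P? Q? xs (sub ∘ there) x∈ qx ¬px)
... | yes p | no ¬q = contradiction (sub (here refl) p) ¬q
... | no ¬p | yes q = m≤n⇒m≤1+n (length-filter-strict P? Q? xs (sub ∘ there) x∈ qx ¬px)
... | no ¬p | no ¬q = length-filter-strict P? Q? xs (sub ∘ there) x∈ qx ¬px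

x∈p─q⇒x∉q : ∀ {n} (p q : Subset n) {x} → x ∈ p ─ q → x ∉ q
x∈p─q⇒x∉q p q {x} x∈ x∈q = case trans (sym (∈⇒lookup x∈)) (go p q (∈⇒lookup x∈q)) of λ ()
  where
  go : ∀ {n} (p q : Subset n) {x} → lookup q x ≡ true → lookup (p ─ q) x ≡ false
  go (_ ∷ p) (inside ∷ q)  {zero}  _ = refl
  go (_ ∷ p) (inside ∷ q)  {suc x} h = go p q h
  go (_ ∷ p) (outside ∷ q) {suc x} h = go p q h

module Translate (I : Instance) where

  open Instance I

  module _ (a : Agent) where

    private
      open module P = IsTotalPreorder (≿-isTotalPreorder a) using (total) renaming (trans to ≿-trans)

      elements⇒∈ : ∀ {e} → e Mem.∈ elements (E a) → e ∈ E a
      elements⇒∈ e∈ = let (_ , loc) = ∈⇒At e∈ in At-elements⁻ loc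

      ∈⇒elements : ∀ {e} → e ∈ E a → e Mem.∈ elements (E a)
      ∈⇒elements e∈ = let (_ , loc) = At-elements e∈ in At⇒∈ loc

      ≻-≿ : ∀ {e m u} → e ∈ E a → m ∈ E a → u ∈ E a → e ≻[ a ] m → m ≿[ a ] u → e ≻[ a ] u
      ≻-≿ {e} {m} {u} e∈ m∈ u∈ (e≿m , ¬m≿e) m≿u =
          ≿-trans {e , e∈} {m , m∈} {u , u∈} e≿m m≿u
        , λ u≿e → ¬m≿e (≿-trans {m , m∈} {u , u∈} {e , e∈} m≿u u≿e)

    position-mono : ∀ {m u} → m ∈ E a → u ∈ E a → m ≿[ a ] u → position I a m ≤ position I a u
    position-mono {m} {u} m∈ u∈ m≿u = length-filter-mono (λ e → ≻-dec a e m) (λ e → ≻-dec a e u) (elements (E a))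
      λ {e} e∈ e≻m → ≻-≿ {e} {m} {u} (elements⇒∈ e∈) m∈ u∈ e≻m m≿u

    -- All that is preferred to `m` is preferred to `u`, and `m` itself is counted in addition.
    position-strict : ∀ {m u} → m ∈ E a → u ∈ E a → m ≻[ a ] u → position I a m < position I a u
    position-strict {m} {u} m∈ u∈ m≻u = length-filter-strict (λ e → ≻-dec a e m) (λ e → ≻-dec a e u) {m} (elements (E a))
      (λ {e} e∈ e≻m → ≻-≿ {e} {m} {u} (elements⇒∈ e∈) m∈ u∈ e≻m (proj₁ m≻u)) (∈⇒elements m∈) m≻u
      λ { (m≿m , ¬m≿m) → ¬m≿m m≿m }

    position<⇒≻ : ∀ {m u} → m ∈ E a → u ∈ E a → position I a m < position I a u → m ≻[ a ] u
    position<⇒≻ {m} {u} m∈ u∈ lt = m≿u , ¬u≿m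
      where
      ¬u≿m : ¬ u ≿[ a ] m
      ¬u≿m u≿m = <⇒≱ lt (position-mono u∈ m∈ u≿m)
      m≿u : m ≿[ a ] u
      m≿u with total (m , m∈) (u , u∈)
      ... | inj₁ h = h
      ... | inj₂ h = contradiction h ¬u≿m

  position≤ : ∀ a e → position I a e ≤ #E
  position≤ a e = ≤-trans (length-filter (λ e′ → ≻-dec a e′ e) (elements (E a)))
    (≤-trans (length-filter (_∈? E a) (allFin #E)) (≤-reflexive (length-tabulate (λ (e : Fin #E) → e))))

  incs : Side → Incidence #E
  incs σ = Layout.incidence I σ

  pos : Side → Contract → ℕ
  pos σ e = position I (∂ σ e) e

  open Iteration incs pos (λ σ e → position≤ (∂ σ e) e) using (market) public
  open Market market hiding (pos)

  onSide : ∀ a → ∃[ σ ] Layout.OnSide I σ a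
  onSide (inj₁ w) = workers , At-map inj₁ (At-allFin w)
  onSide (inj₂ f) = firms   , At-map inj₂ (At-allFin f)

  -- The sets of `a` consist of contracts of `a`, which absorbs the intersection with `E a`.
  count-≡ : ∀ X a i → ∣ (X ∩ E a) ∩ ℒ a i ∣ ≡ # (λ x → lookup X x ∧ lookup (ℒ a i) x)
  count-≡ X a i = trans (∣∣≡# ((X ∩ E a) ∩ ℒ a i)) (#-cong λ x → ext-true
    (λ h → let (xe , l) = x∈p∩q⁻ (X ∩ E a) (ℒ a i) (lookup⇒∈ {S = (X ∩ E a) ∩ ℒ a i} h)
               (x∈ , _) = x∈p∩q⁻ X (E a) xe
           in cong₂ _∧_ (∈⇒lookup x∈) (∈⇒lookup l))
    (λ h → let (x∈ , l) = ∧-true {lookup X x} h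
               l∈ = lookup⇒∈ l
           in ∈⇒lookup {S = (X ∩ E a) ∩ ℒ a i} (x∈p∩q⁺ {p = X ∩ E a} (x∈p∩q⁺ {p = X} (lookup⇒∈ x∈ , ℒ⊆E a i l∈) , l∈))))

  -- The empty sets of a family, which have no entries, impose no constraint.
  feasible-intro : ∀ σ {a} → Layout.OnSide I σ a → ∀ X →
    (∀ p → (∀ {x} → L σ p x ≡ true → x ∈ E a) → # (λ x → lookup X x ∧ L σ p x) ≤ q σ p) → Feasible I a X
  feasible-intro σ {a} on X bound i = ≤-trans (≤-reflexive (count-≡ X a i)) (go (Layout.entry-for I σ on i))
    where
    go : (∀ x → lookup (ℒ a i) x ≡ false) ⊎ ∃[ p ] ((∀ x → L σ p x ≡ lookup (ℒ a i) x) × q σ p ≡ quota a i) →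
      # (λ x → lookup X x ∧ lookup (ℒ a i) x) ≤ quota a i
    go (inj₁ empty) = ≤-trans (#-mono {A = λ x → lookup X x ∧ lookup (ℒ a i) x} {B = λ _ → false}
        λ {x} h → trans (sym (empty x)) (proj₂ (∧-true {lookup X x} h)))
      (≤-trans (≤-reflexive (trans (#-sum (λ _ → false)) (sum-zero {#E} λ _ → refl))) z≤n)
    go (inj₂ (p , same , quota≡)) = subst₂ _≤_ (#-cong λ x → cong (lookup X x ∧_) (same x)) quota≡
      (bound p λ {x} h → ℒ⊆E a i (lookup⇒∈ (trans (sym (same x)) h)))

  L⊆E : ∀ σ p {e} → L σ p e ≡ true → ∀ {x} → L σ p x ≡ true → x ∈ E (∂ σ e)
  L⊆E σ p e∈ {x} x∈ = subst (λ a → x ∈ E a) (Layout.∂-unique I σ onSide′ (ℒ⊆E agent set (lookup⇒∈ e∈))) (ℒ⊆E agent set (lookup⇒∈ x∈))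
    where open Layout.Entry (Layout.at-index I σ p) renaming (onSide to onSide′)

  feasible-elim-∂ : ∀ σ p {e X} → L σ p e ≡ true → Feasible I (∂ σ e) X → # (λ x → lookup X x ∧ L σ p x) ≤ q σ p
  feasible-elim-∂ σ p {e} {X} e∈ feas = go (Layout.∂-unique I σ onSide′ (ℒ⊆E agent set (lookup⇒∈ e∈))) feas
    where
    open Layout.Entry (Layout.at-index I σ p) renaming (onSide to onSide′)
    go : ∀ {b} → agent ≡ b → Feasible I b X → # (λ x → lookup X x ∧ L σ p x) ≤ q σ p
    go refl feas = ≤-trans (≤-reflexive (sym (count-≡ X agent set))) (feas set)

  matching⇒Feas : ∀ {N} → Matching I N → ∀ σ → Fam.Feas σ (lookup N)
  matching⇒Feas {N} match σ p = ≤-trans (≤-reflexive (sym (count-≡ N agent set))) (match agent set)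
    where open Layout.Entry (Layout.at-index I σ p)

  ∂-cong : ∀ σ p {m u} → L σ p m ≡ true → L σ p u ≡ true → ∂ σ m ≡ ∂ σ u
  ∂-cong σ p {m} {u} m∈ u∈ = trans
    (sym (Layout.∂-unique I σ onSide′ (ℒ⊆E agent set (lookup⇒∈ m∈))))
    (Layout.∂-unique I σ onSide′ (ℒ⊆E agent set (lookup⇒∈ u∈)))
    where open Layout.Entry (Layout.at-index I σ p) renaming (onSide to onSide′)

  -- Feasibility after the exchange is checked set by set: a full set that gains `m` loses `u` by
  -- the last clause of `Improves`, and any other set has room or does not grow.
  improves⇒free : ∀ {N m} → Matching I N → lookup N m ≡ false → ∀ σ → Improves (lookup N) m σ → Free I N m (∂ σ m)
  improves⇒free {N} {m} match m∉N σ (u , u∈N , (p , m∈p , u∈p) , pos< , tight) =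
    inj₂ (u , x∈p∩q⁺ (lookup⇒∈ u∈N , u∈E) , position<⇒≻ a m∈E u∈E pos<′ , feasible-intro σ (Layout.onSide-∂ I σ m) X bound)
    where
    a = ∂ σ m
    m∈E : m ∈ E a
    m∈E = Layout.∈E-∂ I σ m
    u∈E : u ∈ E a
    u∈E = L⊆E σ p m∈p u∈p
    pos<′ : position I a m < position I a u
    pos<′ = subst (λ b → position I a m < position I b u) (sym (∂-cong σ p m∈p u∈p)) pos<
    X = ((N ∩ E a) ∪ ⁅ m ⁆) - u
    sw = exchanged-Swap σ m∉N u∈N
    X⊑ : lookup X ⊑ exchanged (lookup N) m u
    X⊑ {x} h with x ≟ᶠ m
    ... | yes _ = refl
    ... | no x≢m with x ≟ᶠ u
    ...   | yes refl = contradiction (x∈⁅x⁆ u) (x∈p─q⇒x∉q ((N ∩ E a) ∪ ⁅ m ⁆) ⁅ u ⁆ (lookup⇒∈ h))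
    ...   | no _ with x∈p∪q⁻ (N ∩ E a) ⁅ m ⁆ (p─q⊆p ((N ∩ E a) ∪ ⁅ m ⁆) ⁅ u ⁆ (lookup⇒∈ h))
    ...     | inj₁ x∈ rewrite ∈⇒lookup (proj₁ (x∈p∩q⁻ N (E a) x∈)) = refl
    ...     | inj₂ x∈ = contradiction (x∈⁅y⁆⇒x≡y m x∈) x≢m
    bound : ∀ p′ → (∀ {x} → L σ p′ x ≡ true → x ∈ E a) → # (λ x → lookup X x ∧ L σ p′ x) ≤ q σ p′
    bound p′ _ = ≤-trans (Fam.on-mono σ {lookup X} {exchanged (lookup N) m u} p′ λ _ → X⊑)
      (go (L σ p′ m) refl (L σ p′ u) refl (Fam.on-swap σ sw p′))
      where
      B = exchanged (lookup N) m u
      feasN = matching⇒Feas {N} match σ p′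
      go : ∀ b → L σ p′ m ≡ b → ∀ d → L σ p′ u ≡ d → Fam.on σ B p′ + ⟦ L σ p′ u ⟧ᵇ ≡ Fam.on σ (lookup N) p′ + ⟦ L σ p′ m ⟧ᵇ →
        Fam.on σ B p′ ≤ q σ p′
      go false m∉ d _ eq rewrite m∉ = ≤-trans (m≤m+n _ _) (≤-trans (≤-reflexive (trans eq (+-identityʳ _))) feasN)
      go true m∈ true u∈ eq rewrite m∈ | u∈ = ≤-trans (≤-reflexive (+-cancelʳ-≡ 1 _ _ eq)) feasN
      go true m∈ false u∉ eq with q σ p′ ≤? Fam.on σ (lookup N) p′
      ... | yes q≤ = case trans (sym u∉) (tight p′ m∈ q≤) of λ ()
      ... | no q≰ rewrite m∈ | u∉ = ≤-trans (≤-reflexive (trans (sym (+-identityʳ _)) (trans eq (+-comm _ 1)))) (≰⇒> q≰)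

  stable⇒no-improvement : ∀ {N} → Stable I N → ∀ {m} → lookup N m ≡ false → ¬ (∀ σ → Improves (lookup N) m σ)
  stable⇒no-improvement {N} (match , no-block) {m} m∉N improves =
    no-block m ((λ m∈ → case trans (sym m∉N) (∈⇒lookup m∈) of λ ()) , λ σ → improves⇒free match m∉N σ (improves σ))

  -- The copy 1 has offset 1 at both agents. In the tight set dominating it, adding `e` exceeds the
  -- quota; a contract whose removal repairs this lies in that set, hence is at least as good as `e`
  -- and cannot be the strictly worse one given up for it.
  kernel⇒stable : ∀ {M st} → Kernel (lookup M) st → Stable I M
  kernel⇒stable {M} {st} kernel = matching , no-block
    where
    open Kernel kernel
    matching : Matching I M
    matching a = let (σ , on) = onSide a in feasible-intro σ on M λ p _ → feasible σ p
    no-block : ∀ e → ¬ Blocks I e M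
    no-block e (e∉ , free) with dominated (not-true λ h → e∉ (lookup⇒∈ h)) 1 (s≤s z≤n)
    ... | σ , p , (e∈p , q≤) , best = refute (free σ)
      where
      a = ∂ σ e
      overfull : ∀ X → (∀ {x} → L σ p x ≡ true → x ∈ M ⊎ x ≡ e → x ∈ X) → ¬ Feasible I a X
      overfull X sup feas = <⇒≱ (begin-strict
        q σ p                                     ≤⟨ q≤ ⟩
        Fam.on σ (lookup M) p                     <⟨ m<m+n _ (s≤s z≤n) ⟩
        Fam.on σ (lookup M) p + 1                 ≡⟨ cong (λ b → Fam.on σ (lookup M) p + ⟦ b ⟧ᵇ) e∈p ⟨
        Fam.on σ (lookup M) p + ⟦ L σ p e ⟧ᵇ      ≡⟨ Fam.on-insert σ e p (not-true λ h → e∉ (lookup⇒∈ h))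
                                                       (⊞-here (lookup M) e) (⊞-there (lookup M) e) ⟨
        Fam.on σ M+e p                            ≤⟨ Fam.on-mono σ {M+e} {lookup X} p (λ {x} l h → ∈⇒lookup (sup l (cases x h))) ⟩
        # (λ x → lookup X x ∧ L σ p x)            ∎) (feasible-elim-∂ σ p {X = X} e∈p feas)
        where
        open ≤-Reasoning
        M+e : Contract → Bool
        M+e = lookup M ⊞ e
        cases : ∀ x → M+e x ≡ true → x ∈ M ⊎ x ≡ e
        cases x h with lookup M x in eq | x ≟ᶠ e
        ... | true  | _       = inj₁ (lookup⇒∈ eq)
        ... | false | yes x≡e = inj₂ x≡e
      extended : ∀ {x} → L σ p x ≡ true → x ∈ M ⊎ x ≡ e → x ∈ (M ∩ E a) ∪ ⁅ e ⁆
      extended l (inj₁ x∈M) = x∈p∪q⁺ (inj₁ (x∈p∩q⁺ (x∈M , L⊆E σ p e∈p l)))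
      extended l (inj₂ refl) = x∈p∪q⁺ (inj₂ (x∈⁅x⁆ e))
      refute : ¬ Free I M e a
      refute (inj₁ feas) = overfull ((M ∩ E a) ∪ ⁅ e ⁆) extended feas
      refute (inj₂ (e′ , e′∈ , e≻e′ , feas)) = overfull (((M ∩ E a) ∪ ⁅ e ⁆) - e′)
        (λ {x} l x∈ → x∈p∧x≢y⇒x∈p-y (extended l x∈) λ { refl → not-worse l }) feas
        where
        e′∈M = proj₁ (x∈p∩q⁻ M (E a) e′∈)
        not-worse : L σ p e′ ≡ true → ⊥
        not-worse l = <⇒≱ (position-strict a (Layout.∈E-∂ I σ e) (proj₂ (x∈p∩q⁻ M (E a) e′∈)) e≻e′)
          (subst (λ b → position I b e′ ≤ pos σ e) (∂-cong σ p l e∈p)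
            (double-cancel-≤ (pos σ e′) (pos σ e) {offset #E σ (st e′)}
              (≤-trans (best (∈⇒lookup e′∈M) l) (≤-reflexive (middle σ)))))
          where
          middle : ∀ σ → key σ e 1 ≡ suc (pos σ e + pos σ e)
          middle workers = +-comm _ 1
          middle firms   = +-comm _ 1

  approximation : ∀ {M st N} → Kernel (lookup M) st → Stable I N → 2 * ∣ N ∣ ≤ 3 * ∣ M ∣
  approximation {M} {st} {N} kernel stable = subst₂ (λ a b → 2 * a ≤ 3 * b) (sym (∣∣≡# N)) (sym (∣∣≡# M))
    (Approximation.2∣N∣≤3∣M∣ kernel (matching⇒Feas {N} (proj₁ stable)) (stable⇒no-improvement stable))

-- The complete program and its running time

module PreprocessW = Preprocess 1 5 7 15
module PreprocessF = Preprocess 2 6 8 16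

setup program : Program
-- The family offset behind the last agent is the number of sets, and the set offset found there is
-- the number of entries.
setup = 24 at lit 0 ≔ (7 at (5 at (0 at lit 1))) ⨾ 25 at lit 0 ≔ (8 at (6 at (0 at lit 2))) ⨾
  -- The cell 0 of array 19 and the cell 2 of array 20 already hold their offset 0.
  19 at lit 1 ≔ lit 1 ⨾ 19 at lit 2 ≔ ((nE ⊕ nE) ⊕ lit 1) ⨾
  20 at lit 0 ≔ ((nE ⊕ nE) ⊕ lit 1) ⨾ 20 at lit 1 ≔ lit 1
program = setup ⨾ PreprocessW.preprocess ⨾ PreprocessF.preprocess ⨾ main

module _ (I : Instance) (σ : Side) (end fam set grp : ℕ) where

  open Instance I
  open Layout I σ
  open Preprocess end fam set grp

  -- All sets of an agent but at most one empty set have entries, whence the additional 1.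
  fill-bound : ℕ
  fill-bound = suc (length members) + length members

  runs-grouping : Apart → ∀ s → s 0 0 ≡ #E → (∀ k → s end k ≡ array (endArray I σ) k) →
    (∀ k → s fam k ≡ array (familyArray I σ) k) → (∀ k → s set k ≡ array (setArray I σ) k) →
    Runs preprocess s (forCost nE #E (visit-time fill-bound)) (λ s′ → ∀ p → s′ grp (toℕ p) ≡ Incidence.code incidence p)
  runs-grouping apart s n-eq end-eq fam-eq set-eq = runs-weaken ≤-refl (λ {s′} → grouped {s′})
    (runs-preprocess apart (begins sets) (begins-mono sets) (length sets) #E lo hi fill-bound s n-eq
      (λ {g} g≤ → trans (set-eq g) (setArray-at g≤))
        lo-eq hi-eq (λ {e} _ → begins-step fams (agent-index e)) (λ {e} _ → first≤ (suc (agent-index e))) bound)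
    where
    agent-index lo hi : ℕ → ℕ
    agent-index = array (endArray I σ)
    lo e = begins fams (agent-index e)
    hi e = begins fams (suc (agent-index e))
    agent-of : ∀ {e} → e < #E → ∃[ c ] (agent-index e ≡ index I (∂ σ c))
    agent-of e<n = fromℕ< e<n , trans (cong agent-index (sym (toℕ-fromℕ< e<n))) (endArray-at (fromℕ< e<n))
    in-range : ∀ {e} → e < #E → agent-index e < length fams
    in-range e<n with agent-of e<n
    ... | c , eq = ≤-trans (s≤s (≤-reflexive eq)) (index< (onSide-∂ c))
    lo-eq : ∀ {e} → e < #E → s fam (s end e) ≡ lo e
    lo-eq {e} e<n = trans (fam-eq _) (trans (cong (array (familyArray I σ)) (end-eq e)) (familyArray-at (<⇒≤ (in-range e<n))))
    hi-eq : ∀ {e} → e < #E → s fam (s end e + 1) ≡ hi e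
    hi-eq {e} e<n = trans (fam-eq _) (trans (cong (array (familyArray I σ)) (trans (+-comm _ 1) (cong suc (end-eq e)))) (familyArray-at (in-range e<n)))
    bound : ∀ {e} → e < #E → (hi e ∸ lo e) + (begins sets (hi e) ∸ begins sets (lo e)) ≤ fill-bound
    bound {e} e<n with agent-of e<n
    ... | c , eq rewrite eq = +-mono-≤
      (≤-trans (≤-trans (≤-reflexive (trans (cong (_∸ first a) (first-suc on)) (m+n∸m≡n (first a) (#ℒ a))))
        (≤-trans (m≤n+m (#ℒ a) _) (#ℒ-bound on))) (s≤s T≤))
      (≤-trans (m∸n≤m _ (begins sets (first a))) T≤)
      where
      a = ∂ σ c
      on = onSide-∂ c
      T≤ : begins sets (begins fams (suc (index I a))) ≤ length members
      T≤ = sets-total _ (first≤ (suc (index I a)))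
    grouped : ∀ {s′} → Filled apart (begins sets) (begins-mono sets) (length sets) #E lo hi fill-bound s n-eq
        (λ {g} g≤ → trans (set-eq g) (setArray-at g≤))
        lo-eq hi-eq (λ {e} _ → begins-step fams (agent-index e)) (λ {e} _ → first≤ (suc (agent-index e))) bound #E s′ →
      ∀ p → s′ grp (toℕ p) ≡ Incidence.code incidence p
    -- An entry has its label since the contract it holds has been visited.
    grouped filled p = filled (toℕ<n el) (toℕ p)
      (≤-trans (begins-mono sets lo≤) (entry-lower (at-index p)))
      (<-≤-trans (entry-upper (at-index p)) (begins-mono sets hi≥))
      set-index (entry-lower (at-index p)) (entry-upper (at-index p))
      where
      open Entry (at-index p) renaming (set to set′)
      index≡ : agent-index (toℕ el) ≡ index I agent
      index≡ = trans (endArray-at el) (cong (index I) (sym (∂-unique onSide (ℒ⊆E agent set′ in-set))))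
      lo≤ : lo (toℕ el) ≤ set-index
      lo≤ = ≤-trans (≤-reflexive (cong (begins fams) index≡)) (m≤m+n _ _)
      hi≥ : suc set-index ≤ hi (toℕ el)
      hi≥ = ≤-trans (+-monoʳ-< (first agent) (toℕ<n set′))
        (≤-reflexive (trans (sym (first-suc onSide)) (cong (begins fams ∘ suc) (sym index≡))))

  represented : ∀ mem quo N s → (∀ k → s mem k ≡ array members k) → (∀ k → s quo k ≡ array (quotaArray I σ) k) →
    (∀ k → s set k ≡ array (setArray I σ) k) → s N 0 ≡ length members →
    (∀ p → s grp (toℕ p) ≡ Incidence.code incidence p) → Represents incidence s mem grp quo set N
  represented mem quo N s mem-eq quo-eq set-eq N-eq grp-eq = record
    { N-eq = N-eq
    ; el-eq = λ p → trans (mem-eq (toℕ p)) (At-array (entry-at (at-index p)))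
    ; grp-eq = grp-eq
    ; quo-eq = λ p → let open Entry (at-index p) renaming (set to set′) in
        trans (quo-eq _) (quotaArray-at onSide set′)
    ; set-eq = λ p → let open Entry (at-index p) renaming (set to set′) in begin-equality
        s set (set-index + 1) ∸ s set set-index
          ≡⟨ cong₂ _∸_ (trans (cong (s set) (+-comm set-index 1)) (trans (set-eq _) (setArray-at (setIndex< onSide set′))))
               (trans (set-eq _) (setArray-at (<⇒≤ (setIndex< onSide set′)))) ⟩
        begins sets (suc set-index) ∸ begins sets set-index
          ≡⟨ cong (_∸ begins sets set-index) (sets-suc onSide set′) ⟩
        begins sets set-index + # (lookup (ℒ agent set′)) ∸ begins sets set-index
          ≡⟨ m+n∸m≡n (begins sets set-index) _ ⟩
        # (lookup (ℒ agent set′)) ∎ }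
    where open ≤-Reasoning

-- The product of 3n + 1 and K n + 1 has the terms 3 K n n, 3n, K n and 1; for positive `n` the
-- first three are at most 3, 3 and 1 times K n n, which gives the 7. For `n` = 0 the added 1 pays.
rounds-bound : ∀ {N n K} → N ≤ n + n + n + 1 → 1 ≤ K → N * suc (K * n) ≤ 7 * (K * n * n + 1)
rounds-bound {N} {zero} {K} N≤ _ rewrite *-zeroʳ K = ≤-trans (*-monoˡ-≤ 1 N≤) (s≤s z≤n)
rounds-bound {N} {n@(suc n′)} {K@(suc _)} N≤ _ = begin
  N * suc M                   ≤⟨ *-monoˡ-≤ (suc M) N≤ ⟩
  (n + n + n + 1) * suc M
    ≡⟨ solve 2 (λ n m → (n :+ n :+ n :+ con 1) :* (con 1 :+ m) := con 3 :* (m :* n) :+ con 3 :* n :+ m :+ con 1) refl n M ⟩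
  3 * (M * n) + 3 * n + M + 1
    ≤⟨ +-mono-≤ (+-mono-≤ (+-monoʳ-≤ (3 * (M * n)) (*-monoʳ-≤ 3 (m≤n*m n M))) (m≤m*n M n)) (m≤m+n 1 6) ⟩
  3 * (M * n) + 3 * (M * n) + M * n + 7
    ≡⟨ solve 1 (λ x → con 3 :* x :+ con 3 :* x :+ x :+ con 7 := con 7 :* (x :+ con 1)) refl (M * n) ⟩
  7 * (M * n + 1)  ∎
  where
  open ≤-Reasoning
  open +-*-Solver
  M = K * n

for-total : ∀ e {N n K B} κ → N ≤ n + n + n + 1 → 1 ≤ K → B ≤ κ * suc (K * n) →
  forCost e N B ≤ (7 * (κ + (cost e + 12)) + (cost e + 12)) * (K * n * n + 1)
for-total e {N} {n} {K} {B} κ N≤ K≥1 B≤ = begin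
  N * (B + a) + a           ≤⟨ +-mono-≤ (*-monoʳ-≤ N (+-mono-≤ B≤ (m≤m*n a (suc M)))) (m≤m*n a (X + 1) {{>-nonZero (m≤n+m 1 X)}}) ⟩
  N * (κ * suc M + a * suc M) + a * (X + 1)
    ≡⟨ cong (_+ a * (X + 1)) (solve 4 (λ N k a m → N :* (k :* m :+ a :* m) := (k :+ a) :* (N :* m)) refl N κ a (suc M)) ⟩
  (κ + a) * (N * suc M) + a * (X + 1)
    ≤⟨ +-monoˡ-≤ (a * (X + 1)) (*-monoʳ-≤ (κ + a) (rounds-bound N≤ K≥1)) ⟩
  (κ + a) * (7 * (X + 1)) + a * (X + 1)
    ≡⟨ solve 3 (λ k a x → (k :+ a) :* (con 7 :* x) :+ a :* x := (con 7 :* (k :+ a) :+ a) :* x) refl κ a (X + 1) ⟩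
  (7 * (κ + a) + a) * (X + 1) ∎
  where
  open ≤-Reasoning
  open +-*-Solver
  a = cost e + 12
  M = K * n
  X = K * n * n

module _ (end fam set grp : ℕ) where

  open Preprocess end fam set grp

  private
    base slope : ℕ
    base = (1 + cost (lit 0) + cost (fam at (end at (26 at lit 0)))) + ((1 + cost (lit 0) + cost (set at cur))
      + ((1 + cost (lit 0) + cost (fam at ((end at (26 at lit 0)) ⊕ lit 1))) + suc (cost (lim ⊖ cur))))
    slope = suc (cost (lim ⊖ cur)) + maxCost fill-body

  -- The factor 2 accounts for the sets and the entries that a visit passes through.
  visit-rate : ℕ
  visit-rate = 2 * (base + slope)

  visit-linear : ∀ {N M} → N ≤ M → visit-time (suc N + N) ≤ visit-rate * suc M
  visit-linear {N} {M} N≤M = begin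
    visit-time (suc N + N)
      ≡⟨ solve 5 (λ a b c x y → a :+ (b :+ (c :+ (x :+ y))) := (a :+ (b :+ (c :+ y))) :+ x) refl
           (1 + cost (lit 0) + cost (fam at (end at (26 at lit 0)))) (1 + cost (lit 0) + cost (set at cur))
           (1 + cost (lit 0) + cost (fam at ((end at (26 at lit 0)) ⊕ lit 1))) ((suc N + N) * slope) (suc (cost (lim ⊖ cur))) ⟩
    base + (suc N + N) * slope
      ≤⟨ +-mono-≤ (m≤m*n base (2 * suc M)) (*-monoˡ-≤ slope (+-mono-≤ (s≤s N≤M)
          (≤-trans N≤M (≤-trans (n≤1+n M) (≤-reflexive (sym (+-identityʳ (suc M)))))))) ⟩
    base * (2 * suc M) + (2 * suc M) * slope
      ≡⟨ solve 3 (λ b s m → b :* (con 2 :* m) :+ (con 2 :* m) :* s := con 2 :* (b :+ s) :* m) refl base slope (suc M) ⟩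
    visit-rate * suc M ∎
    where
    open ≤-Reasoning
    open +-*-Solver

constant : ℕ
constant = maxCost setup + ((7 * (visit-rate 1 5 7 15 + (cost nE + 12)) + (cost nE + 12))
  + ((7 * (visit-rate 2 6 8 16 + (cost nE + 12)) + (cost nE + 12))
  + (7 * (proj₁ linear-iterate + (cost rounds + 12)) + (cost rounds + 12))))

module Run (I : Instance) where

  open Instance I
  open Translate I using (incs; pos; position≤; kernel⇒stable; approximation)
  open Iteration incs pos (λ σ e → position≤ (∂ σ e) e)
  open Main incs pos (λ σ e → position≤ (∂ σ e) e)

  N : Side → ℕ
  N σ = Incidence.entries (incs σ)

  run-time : ℕ
  run-time = maxCost setup + (forCost nE #E (PreprocessW.visit-time (fill-bound I workers 1 5 7 15))
    + (forCost nE #E (PreprocessF.visit-time (fill-bound I firms 2 6 8 16)) + main-time))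

  runs-program : Runs program (encode I) run-time (λ s → Market.Kernel market (chosen s) (stage s))
  runs-program =
    runs-⨾ (runs-loopFree setup {Q = λ s → s ≡ run setup (encode I)} refl refl) λ { s₁ _ refl →
    runs-⨾ (runs-grouping I workers 1 5 7 15 (record
      { fr-set = refl , refl , refl , refl , refl ; fr-fam = refl , refl , refl , refl , refl ; fr-end = refl , refl , refl , refl , refl
      ; g0 = refl ; g26 = refl ; g30 = refl ; g31 = refl ; g33 = refl ; 26g = refl ; 30g = refl ; 31g = refl ; 33g = refl })
      s₁ refl (λ _ → refl) (λ _ → refl) (λ _ → refl)) λ s₂ fr₂ grpW →
    runs-⨾ (runs-grouping I firms 2 6 8 16 (record
      { fr-set = refl , refl , refl , refl , refl ; fr-fam = refl , refl , refl , refl , refl ; fr-end = refl , refl , refl , refl , refl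
      ; g0 = refl ; g26 = refl ; g30 = refl ; g31 = refl ; g33 = refl ; 26g = refl ; 30g = refl ; 31g = refl ; 33g = refl })
      s₂ (fr₂ 0 refl 0) (fr₂ 2 refl) (fr₂ 6 refl) (fr₂ 8 refl)) λ s₃ fr₃ grpF →
    runs-main s₃ (input s₂ s₃ fr₂ fr₃ grpW grpF)
      (λ k → trans (fr₃ 13 refl k) (fr₂ 13 refl k)) (λ k → trans (fr₃ 14 refl k) (fr₂ 14 refl k)) }
    where
    s₁ : Store
    s₁ = run setup (encode I)
    input : ∀ s₂ s₃ → (∀ x → writes PreprocessW.preprocess x ≡ false → ∀ i → s₂ x i ≡ s₁ x i) →
      (∀ x → writes PreprocessF.preprocess x ≡ false → ∀ i → s₃ x i ≡ s₂ x i) →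
      (∀ p → s₂ 15 (toℕ p) ≡ Incidence.code (incs workers) p) → (∀ p → s₃ 16 (toℕ p) ≡ Incidence.code (incs firms) p) → Input s₃
    input s₂ s₃ fr₂ fr₃ grpW grpF = record
      { n-eq = trans (fr₃ 0 refl 0) (fr₂ 0 refl 0)
      ; repW = represented I workers 1 5 7 15 9 11 24 s₃
          (λ k → trans (fr₃ 9 refl k) (fr₂ 9 refl k)) (λ k → trans (fr₃ 11 refl k) (fr₂ 11 refl k))
          (λ k → trans (fr₃ 7 refl k) (fr₂ 7 refl k)) (trans (fr₃ 24 refl 0) (trans (fr₂ 24 refl 0) totalW))
          (λ p → trans (fr₃ 15 refl _) (grpW p))
      ; repF = represented I firms 2 6 8 16 10 12 25 s₃
          (λ k → trans (fr₃ 10 refl k) (fr₂ 10 refl k)) (λ k → trans (fr₃ 12 refl k) (fr₂ 12 refl k))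
          (λ k → trans (fr₃ 8 refl k) (fr₂ 8 refl k)) (trans (fr₃ 25 refl 0) (trans (fr₂ 25 refl 0) totalF))
          grpF
      ; posW = λ e → trans (fr₃ 3 refl _) (trans (fr₂ 3 refl _) (Layout.positionArray-at I workers e))
      ; posF = λ e → trans (fr₃ 4 refl _) (trans (fr₂ 4 refl _) (Layout.positionArray-at I firms e))
      ; tabW = λ {t} t≤ → trans (fr₃ 19 refl t) (trans (fr₂ 19 refl t) (tableW t≤))
      ; tabF = λ {t} t≤ → trans (fr₃ 20 refl t) (trans (fr₂ 20 refl t) (tableF t≤)) }
      where
      totalW : s₁ 24 0 ≡ length (memberArray I workers)
      totalW = trans (cong (λ w → array (setArray I workers) (array (familyArray I workers) w))
        (sym (trans (length-map inj₁ (allFin #W)) (length-tabulate (λ (w : Fin #W) → w))))) (Layout.total-at I workers)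
      totalF : s₁ 25 0 ≡ length (memberArray I firms)
      totalF = trans (cong (λ f → array (setArray I firms) (array (familyArray I firms) f))
        (sym (trans (length-map inj₂ (allFin #F)) (length-tabulate (λ (f : Fin #F) → f))))) (Layout.total-at I firms)
      tableW : ∀ {t} → t ≤ 2 → s₁ 19 t ≡ offset #E workers t
      tableW {0} _ = refl
      tableW {1} _ = refl
      tableW {2} _ = +-comm _ 1
      tableW {suc (suc (suc _))} (s≤s (s≤s ()))
      tableF : ∀ {t} → t ≤ 2 → s₁ 20 t ≡ offset #E firms t
      tableF {0} _ = +-comm _ 1
      tableF {1} _ = refl
      tableF {2} _ = refl
      tableF {suc (suc (suc _))} (s≤s (s≤s ()))

  run-time≤ : ∀ {k} → IsMaxNesting I k → run-time ≤ constant * ((1 ⊔ k) * #E ^ 2 + 1)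
  run-time≤ {k} nesting = begin
    run-time
      ≤⟨ +-mono-≤ (m≤m*n (maxCost setup) X {{>-nonZero (m≤n+m 1 (K * #E * #E))}})
        (+-mono-≤ (for-total nE {n = #E} {K} (visit-rate 1 5 7 15) #E≤ K≥1 (visit-linear 1 5 7 15 (N≤ workers)))
        (+-mono-≤ (for-total nE {n = #E} {K} (visit-rate 2 6 8 16) #E≤ K≥1 (visit-linear 2 6 8 16 (N≤ firms)))
        (for-total rounds {n = #E} {K} (proj₁ linear-iterate) ≤-refl K≥1
          (proj₂ linear-iterate (N≤ workers) (N≤ firms) (m≤n*m #E K {{>-nonZero K≥1}}))))) ⟩
    a * X + (b * X + (c′ * X + d * X))
      ≡⟨ solve 5 (λ a b c d x → a :* x :+ (b :* x :+ (c :* x :+ d :* x)) := (a :+ (b :+ (c :+ d))) :* x) refl a b c′ d X ⟩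
    constant * X
      ≡⟨ cong (λ m → constant * (m + 1)) (trans (*-assoc K #E #E) (cong (λ m → K * (#E * m)) (sym (*-identityʳ #E)))) ⟩
    constant * (K * #E ^ 2 + 1) ∎
    where
    open ≤-Reasoning
    open +-*-Solver
    -- When all families are empty, `k` is 0 while the scan of the contracts still takes time; the 1
    -- makes `K * #E` an upper bound of `#E`.
    K = 1 ⊔ k
    X = K * #E * #E + 1
    a = maxCost setup
    b = 7 * (visit-rate 1 5 7 15 + (cost nE + 12)) + (cost nE + 12)
    c′ = 7 * (visit-rate 2 6 8 16 + (cost nE + 12)) + (cost nE + 12)
    d = 7 * (proj₁ linear-iterate + (cost rounds + 12)) + (cost rounds + 12)
    K≥1 : 1 ≤ K
    K≥1 = m≤m⊔n 1 k
    N≤ : ∀ σ → N σ ≤ K * #E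
    N≤ σ = Layout.members-bound I σ λ a n chain → ≤-trans (proj₁ nesting a n chain) (m≤n⊔m 1 k)
    #E≤ : #E ≤ #E + #E + #E + 1
    #E≤ = ≤-trans (m≤m+n #E (#E + (#E + 1))) (≤-reflexive (solve 1 (λ e → e :+ (e :+ (e :+ con 1)) := e :+ e :+ e :+ con 1) refl #E))

theorem2 : ∃[ P ] ∃[ C ] (∀ (I : Instance) (k : ℕ) → IsMaxNesting I k →
    ∃[ t ] ∃[ s ] (⟨ P , encode I ⟩⇓[ t ] s
    × t ≤ C * ((1 ⊔ k) * Instance.#E I ^ 2 + 1)
    × Stable I (output I s)
    × (∀ Mopt → MaximumStable I Mopt → 2 * ∣ Mopt ∣ ≤ 3 * ∣ output I s ∣)))
theorem2 = program , constant , λ I k nesting → result I nesting (Run.runs-program I)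
  where
  result : ∀ I {k} → IsMaxNesting I k →
    Runs program (encode I) (Run.run-time I) (λ s → Market.Kernel (Translate.market I) (chosen s) (stage s)) →
    ∃[ t ] ∃[ s ] (⟨ program , encode I ⟩⇓[ t ] s
    × t ≤ constant * ((1 ⊔ k) * Instance.#E I ^ 2 + 1)
    × Stable I (output I s)
    × (∀ Mopt → MaximumStable I Mopt → 2 * ∣ Mopt ∣ ≤ 3 * ∣ output I s ∣))
  result I nesting (t , s , d , t≤ , kernel) = t , s , d , ≤-trans t≤ (Run.run-time≤ I nesting)
    , Translate.kernel⇒stable I {output I s} kernel′
    , λ Mopt max → Translate.approximation I {output I s} {N = Mopt} kernel′ (proj₁ max)
    where
    -- `output` tabulates the very test that `chosen` performs, so the two agree pointwise.
    kernel′ = Market.Kernel-cong (Translate.market I)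
      (λ e → sym (lookup∘tabulate (λ e → nonzero (s 13 (toℕ e))) e)) kernel
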